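{- Let $R(q)=\dfrac{(q;q^5)_\infty(q^4;q^5)_\infty}{(q^2;q^5)_\infty(q^3;q^5)_\infty}$ and define integers $A(n),B(n),C(n),D(n)$ by $$\frac{1}{R^5(q)}=\sum_{n\ge0}A(n)q^n,\quad R^5(q)=\sum_{n\ge0}B(n)q^n,\quad \frac{R^5(q)}{R(q^5)}=\sum_{n\ge0}C(n)q^n,\quad \frac{R(q^5)}{R^5(q)}=\sum_{n\ge0}D(n)q^n.$$ Then for all integers $n\ge 0$: $A(9n+4)\equiv 0 \pmod 3$; $B(9n+2)\equiv 0\pmod 3$; $A(16n+13)\equiv 0\pmod 4$; $B(16n+11)\equiv 0\pmod 4$; $A(15n+r)\equiv 0\pmod{15}$ for $r\in\{4,8,13,14\}$; $B(15n+r)\equiv 0\pmod{15}$ for $r\in\{2,6,11,12\}$; $C(15n+r)\equiv 0\pmod{30}$ for $r\in\{3,13\}$; $D(15n+r)\equiv 0\pmod{30}$ for $r\in\{7,12\}$.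
   Context: For complex $a,q$ with $|q|<1$, $(a;q)_\infty:=\prod_{k=0}^{\infty}(1-aq^k)$. All series are power series in $q$ with integer coefficients. -}

module Defs where

open import Data.Nat as ℕ using (ℕ; zero; suc; _≤ᵇ_; _≡ᵇ_)
open import Data.Nat.DivMod using (_/_; _%_)
open import Data.Integer using (ℤ; +_; _+_; _*_; -_; _-_)
open import Data.Bool using (if_then_else_)

-- Formal power series in q with integer coefficients: n ↦ coefficient of q^n.
Series : Set
Series = ℕ → ℤ

sumBelow : ℕ → (ℕ → ℤ) → ℤ
sumBelow zero    g = + 0
sumBelow (suc n) g = sumBelow n g + g n

one : Series
one n = if n ≡ᵇ 0 then + 1 else + 0

qpow : ℕ → Series
qpow m n = if n ≡ᵇ m then + 1 else + 0

_⊕_ : Series → Series → Series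
(f ⊕ g) n = f n + g n

_⊖_ : Series → Series → Series
(f ⊖ g) n = f n - g n

_⊛_ : Series → Series → Series
(f ⊛ g) n = sumBelow (suc n) (λ k → f k * g (n ℕ.∸ k))

infixl 7 _⊛_
infixl 6 _⊕_ _⊖_

powS : Series → ℕ → Series
powS f zero    = one
powS f (suc e) = f ⊛ powS f e

prodBelow : ℕ → (ℕ → Series) → Series
prodBelow zero    F = one
prodBelow (suc n) F = prodBelow n F ⊛ F n

-- Infinite product ∏_{k ≥ 0} F k of factors with F k ≡ 1 (mod q^(k+1)):
-- the coefficient of q^n is that of the finite product of the first n+1 factors
-- (further factors do not change it).
infProd : (ℕ → Series) → Series
infProd F n = prodBelow (suc n) F n

-- (q^a ; q^b)_∞ = ∏_{k ≥ 0} (1 - q^(a + b k)), used with a ≥ 1.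
poch : ℕ → ℕ → Series
poch a b = infProd (λ k → one ⊖ qpow (a ℕ.+ b ℕ.* k))

-- Multiplicative inverse of a series with constant term 1:
-- b 0 = 1, b n = - Σ_{k=1}^{n} f k * b (n - k).
-- invUpTo f n m is correct for m ≤ n.
invUpTo : Series → ℕ → Series
invUpTo f zero    m = one m
invUpTo f (suc n) m =
  if m ≤ᵇ n then invUpTo f n m
  else (if m ≡ᵇ suc n
        then - sumBelow (suc n) (λ j → f (suc j) * invUpTo f n (n ℕ.∸ j))
        else + 0)

inv : Series → Series
inv f n = invUpTo f n n

dil5 : Series → Series
dil5 f n = if (n % 5) ≡ᵇ 0 then f (n / 5) else + 0

R : Series
R = poch 1 5 ⊛ poch 4 5 ⊛ inv (poch 2 5 ⊛ poch 3 5)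

R⁵ : Series
R⁵ = powS R 5

A B C D : Series
A = inv R⁵
B = R⁵
C = R⁵ ⊛ inv (dil5 R)
D = dil5 R ⊛ inv R⁵

{-# OPTIONS --safe #-}

-- Write E(q) = (q;q)_∞ and u = q R(q⁵). By Jacobi's triple product, E(q) E(q⁵) = θ₁ θ₂ is a theta series over ℤ²;
-- summing it over the cosets of a sublattice of index 5 gives E(q) R(q⁵) = E(q²⁵) (1 - u - u²). Taking norms over the
-- fifth roots of unity turns this into 1/R⁵ - 11 q - q² R⁵ = g, where g = E(q)⁶/E(q⁵)⁶, and the two relations together
-- determine R(q⁵)/R⁵ as a rational function of u.
--
-- Modulo 15 and 30: A, B, C, D become polynomials in u times powers of R(q⁵) and a cube. The exponents modulo 5 can be
-- read off from the powers of u, and modulo 3 every cube is a series in q³.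
--
-- Modulo 3: g is a series in q³, and y = 1/R⁵ + q² R⁵ satisfies y² = g² + g q - q², so y = y³/(g² + g q - q²) where y³
-- is again a series in q³; doing this twice gives the exponents modulo 9.
--
-- Modulo 4: put k = q R⁵ and j = 1/(1 + k). The trace and the norm under q ↦ -q of the equation for k show that its
-- even part is j(q²) - 1 and that the even part of j is j(q²)². This leaves the parity of the coefficients of j, whose
-- odd part is q E(q)⁴ E(q⁵)⁴ modulo 2 because E(q) E(q⁵) = E(q)⁶ + q E(q⁵)⁶ there.
module Submission where

open import Defs
open import Algebra.Bundles using (CommutativeRing)
import Algebra.Solver.Ring
open import Algebra.Solver.Ring.AlmostCommutativeRing using (_-Raw-AlmostCommutative⟶_; fromCommutativeRing)
open import Algebra.Structures using (IsCommutativeRing)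
open import Data.Bool as Bool using (if_then_else_; true; false)
open import Data.Integer as ℤ using (ℤ; +_; -[1+_]; ∣_∣)
import Data.Integer.Divisibility as Unsigned
open import Data.Integer.Divisibility.Signed
  using (divides; ∣m∣n⇒∣m+n; ∣m⇒∣-m; ∣m⇒∣m*n; ∣n⇒∣m*n; *-monoʳ-∣; ∣-trans; 0∣⇒≡0; ∣⇒∣ᵤ)
import Data.Integer.Divisibility.Signed as Signed
import Data.Integer.Properties as ℤₚ
open import Data.Integer.Tactic.RingSolver using (solve-∀)
open import Data.List using (List; []; _∷_)
open import Data.Maybe using (Maybe; map)
open import Data.Nat as ℕ using (ℕ; zero; suc; _≤_; _<_; z≤n; s≤s; _≡ᵇ_; _≤ᵇ_; NonZero)
open import Data.Nat.Divisibility using () renaming (divides to dividesℕ)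
open import Data.Nat.DivMod
import Data.Nat.Properties as ℕₚ
open import Data.Nat.Tactic.RingSolver using () renaming (solve-∀ to solve-∀ℕ)
open import Data.Product using (Σ; ∃; _×_; _,_; proj₁; proj₂)
open import Data.Sum using (inj₁; inj₂)
open import Data.Unit using (⊤; tt)
open import Function using (_∘_)
open import Level using (0ℓ)
open import Relation.Binary.Consequences using (dec⇒weaklyDec)
open import Relation.Binary.PropositionalEquality
  using (_≡_; _≢_; _≗_; cong; cong₂; subst; subst₂; module ≡-Reasoning)
  renaming (refl to ≡-refl; sym to ≡-sym; trans to ≡-trans)
open import Relation.Nullary using (yes; no; contradiction)

-- The fifth roots of unity ζ do not live in ℤ, so the norm over them is handled through q d/dq: the
-- logarithmic derivative of ∏ f(ζq) is five times the part of that of f with exponents divisible by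
-- 5, and it determines a series with constant term 1. The change q ↦ -q, in contrast, acts on
-- integer series, and its norms are formed directly.
--
-- Modulo 3 the Frobenius congruence f³ ≡ f(q³) is available. Modulo 4 it has no counterpart: f² ≡
-- f(q²) holds modulo 2 only, and is squared or doubled to reach modulus 4. This is why the series
-- modulo 4 are arranged as squares, fourth powers and doubled terms, and why the trace and norm
-- relations have to be solved although some unknowns are accessible only after doubling.
--
-- A consequence of several relations is certified as ideal membership: the difference of its two
-- sides is a combination of the relations with explicit cofactors, and the ring solver checks this.

module IntegerAlgebra (R : CommutativeRing 0ℓ 0ℓ)
                      (morphism : ℤ.+-*-rawRing -Raw-AlmostCommutative⟶ fromCommutativeRing R) where

  open CommutativeRing R public
  open _-Raw-AlmostCommutative⟶_ morphism public using (+-homo; *-homo; -‿homo) renaming (⟦_⟧ to ι)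

  decide : (a b : ℤ) → Maybe (ι a ≈ ι b)
  decide a b = map (λ e → reflexive (cong ι e)) (dec⇒weaklyDec ℤₚ._≟_ a b)

  open Algebra.Solver.Ring ℤ.+-*-rawRing (fromCommutativeRing R) morphism decide public
    using (solve; _:=_; _:+_; _:*_; _:-_; :-_; _:^_; con; Polynomial)

  infix 10 :#_

  :#_ : ∀ {n} → ℕ → Polynomial n
  :# k = con (+ k)

-- Convolution of coefficient sequences, and congruence modulo m.

module Convolution where
  open import Data.Integer.Divisibility.Signed using (_∣_)
  open import Data.Integer using (_+_; _*_; -_; _-_)
  open import Relation.Binary.PropositionalEquality using (refl; sym; trans)

  _∣0 : ∀ m → m ∣ + 0
  m ∣0 = divides (+ 0) refl

  sumBelow-cong : ∀ n {f g : ℕ → ℤ} → (∀ k → k < n → f k ≡ g k) → sumBelow n f ≡ sumBelow n g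
  sumBelow-cong zero    h = refl
  sumBelow-cong (suc n) h =
    cong₂ _+_ (sumBelow-cong n (λ k k<n → h k (ℕₚ.m<n⇒m<1+n k<n))) (h n ℕₚ.≤-refl)

  sumBelow-head : ∀ n (f : ℕ → ℤ) → sumBelow (suc n) f ≡ f 0 + sumBelow n (f ∘ suc)
  sumBelow-head zero    f = trans (ℤₚ.+-identityˡ (f 0)) (sym (ℤₚ.+-identityʳ (f 0)))
  sumBelow-head (suc n) f =
    trans (cong (_+ f (suc n)) (sumBelow-head n f)) (ℤₚ.+-assoc (f 0) _ (f (suc n)))

  sumBelow-zero : ∀ n → sumBelow n (λ _ → + 0) ≡ + 0
  sumBelow-zero zero    = refl
  sumBelow-zero (suc n) = trans (ℤₚ.+-identityʳ _) (sumBelow-zero n)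

  sumBelow-+ : ∀ n (f g : ℕ → ℤ) → sumBelow n (λ k → f k + g k) ≡ sumBelow n f + sumBelow n g
  sumBelow-+ zero    f g = refl
  sumBelow-+ (suc n) f g =
    trans (cong (_+ (f n + g n)) (sumBelow-+ n f g)) (interchange (sumBelow n f) (sumBelow n g) (f n) (g n))
    where
    interchange : ∀ a b c d → (a + b) + (c + d) ≡ (a + c) + (b + d)
    interchange = solve-∀

  sumBelow-*ˡ : ∀ n c (f : ℕ → ℤ) → sumBelow n (λ k → c * f k) ≡ c * sumBelow n f
  sumBelow-*ˡ zero    c f = sym (ℤₚ.*-zeroʳ c)
  sumBelow-*ˡ (suc n) c f =
    trans (cong (_+ c * f n) (sumBelow-*ˡ n c f)) (sym (ℤₚ.*-distribˡ-+ c _ (f n)))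

  sumBelow-∣ : ∀ {m} n {f : ℕ → ℤ} → (∀ k → k < n → m ∣ f k) → m ∣ sumBelow n f
  sumBelow-∣ {m} zero    h = m ∣0
  sumBelow-∣ (suc n) h =
    ∣m∣n⇒∣m+n (sumBelow-∣ n (λ k k<n → h k (ℕₚ.m<n⇒m<1+n k<n))) (h n ℕₚ.≤-refl)

  sumBelow-- : ∀ n (f g : ℕ → ℤ) → sumBelow n f - sumBelow n g ≡ sumBelow n (λ k → f k - g k)
  sumBelow-- zero    f g = refl
  sumBelow-- (suc n) f g =
    trans (interchange (sumBelow n f) (f n) (sumBelow n g) (g n)) (cong (_+ (f n - g n)) (sumBelow-- n f g))
    where
    interchange : ∀ a b c d → (a + b) - (c + d) ≡ (a - c) + (b - d)
    interchange = solve-∀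

  tail : Series → Series
  tail f n = f (suc n)

  const : ℤ → Series
  const c n = if n ≡ᵇ 0 then c else + 0

  infix 9 #_

  #_ : ℕ → Series
  # k = const (+ k)

  ⊛-zero : ∀ f g → (f ⊛ g) 0 ≡ f 0 * g 0
  ⊛-zero f g = ℤₚ.+-identityˡ _

  ⊛-suc : ∀ f g n → (f ⊛ g) (suc n) ≡ f 0 * g (suc n) + (tail f ⊛ g) n
  ⊛-suc f g n = sumBelow-head (suc n) _

  ⊛-sucʳ : ∀ f g n → (f ⊛ g) (suc n) ≡ (f ⊛ tail g) n + f (suc n) * g 0
  ⊛-sucʳ f g n = cong₂ _+_
    (sumBelow-cong (suc n) (λ { k (s≤s k≤n) → cong (λ i → f k * g i) (ℕₚ.+-∸-assoc 1 k≤n) }))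
    (cong (λ i → f (suc n) * g i) (ℕₚ.n∸n≡0 n))

  ⊛-cong≤ : ∀ n {f f′ g g′} → (∀ k → k ≤ n → f k ≡ f′ k) → (∀ k → k ≤ n → g k ≡ g′ k) →
            (f ⊛ g) n ≡ (f′ ⊛ g′) n
  ⊛-cong≤ n p r = sumBelow-cong (suc n) (λ { k (s≤s k≤n) → cong₂ _*_ (p k k≤n) (r _ (ℕₚ.m∸n≤m n k)) })

  ⊛-comm : ∀ f g → f ⊛ g ≗ g ⊛ f
  ⊛-comm f g zero    = trans (⊛-zero f g) (trans (ℤₚ.*-comm (f 0) (g 0)) (sym (⊛-zero g f)))
  ⊛-comm f g (suc n) = begin
    (f ⊛ g) (suc n)                  ≡⟨ ⊛-suc f g n ⟩
    f 0 * g (suc n) + (tail f ⊛ g) n ≡⟨ cong₂ _+_ (ℤₚ.*-comm (f 0) _) (⊛-comm (tail f) g n) ⟩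
    g (suc n) * f 0 + (g ⊛ tail f) n ≡⟨ ℤₚ.+-comm (g (suc n) * f 0) _ ⟩
    (g ⊛ tail f) n + g (suc n) * f 0 ≡⟨ ⊛-sucʳ g f n ⟨
    (g ⊛ f) (suc n)                  ∎
    where open ≡-Reasoning

  ⊛-distribʳ : ∀ h f g → (f ⊕ g) ⊛ h ≗ (f ⊛ h) ⊕ (g ⊛ h)
  ⊛-distribʳ h f g n = trans
    (sumBelow-cong (suc n) (λ k _ → ℤₚ.*-distribʳ-+ (h (n ℕ.∸ k)) (f k) (g k)))
    (sumBelow-+ (suc n) _ _)

  ⊛-scale : ∀ c f g n → ((λ k → c * f k) ⊛ g) n ≡ c * (f ⊛ g) n
  ⊛-scale c f g n = trans
    (sumBelow-cong (suc n) (λ k _ → ℤₚ.*-assoc c (f k) (g (n ℕ.∸ k))))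
    (sumBelow-*ˡ (suc n) c _)

  ⊛-assoc : ∀ f g h → (f ⊛ g) ⊛ h ≗ f ⊛ (g ⊛ h)
  ⊛-assoc f g h zero = begin
    ((f ⊛ g) ⊛ h) 0     ≡⟨ trans (⊛-zero (f ⊛ g) h) (cong (_* h 0) (⊛-zero f g)) ⟩
    f 0 * g 0 * h 0     ≡⟨ ℤₚ.*-assoc (f 0) (g 0) (h 0) ⟩
    f 0 * (g 0 * h 0)   ≡⟨ trans (⊛-zero f (g ⊛ h)) (cong (f 0 *_) (⊛-zero g h)) ⟨
    (f ⊛ (g ⊛ h)) 0     ∎
    where open ≡-Reasoning
  ⊛-assoc f g h (suc n) = begin
    ((f ⊛ g) ⊛ h) (suc n)
      ≡⟨ ⊛-suc (f ⊛ g) h n ⟩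
    (f ⊛ g) 0 * h (suc n) + (tail (f ⊛ g) ⊛ h) n
      ≡⟨ cong₂ (λ x y → x * h (suc n) + y) (⊛-zero f g)
           (⊛-cong≤ n {g = h} (λ k _ → ⊛-suc f g k) (λ _ _ → refl)) ⟩
    f 0 * g 0 * h (suc n) + (((λ k → f 0 * tail g k) ⊕ (tail f ⊛ g)) ⊛ h) n
      ≡⟨ cong (λ x → f 0 * g 0 * h (suc n) + x) (⊛-distribʳ h (λ k → f 0 * tail g k) (tail f ⊛ g) n) ⟩
    f 0 * g 0 * h (suc n) + (((λ k → f 0 * tail g k) ⊛ h) n + ((tail f ⊛ g) ⊛ h) n)
      ≡⟨ cong₂ (λ x y → f 0 * g 0 * h (suc n) + (x + y)) (⊛-scale (f 0) (tail g) h n) (⊛-assoc (tail f) g h n) ⟩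
    f 0 * g 0 * h (suc n) + (f 0 * (tail g ⊛ h) n + (tail f ⊛ (g ⊛ h)) n)
      ≡⟨ regroup (f 0) (g 0) (h (suc n)) _ _ ⟩
    f 0 * (g 0 * h (suc n) + (tail g ⊛ h) n) + (tail f ⊛ (g ⊛ h)) n
      ≡⟨ cong (λ x → f 0 * x + (tail f ⊛ (g ⊛ h)) n) (⊛-suc g h n) ⟨
    f 0 * (g ⊛ h) (suc n) + (tail f ⊛ (g ⊛ h)) n
      ≡⟨ ⊛-suc f (g ⊛ h) n ⟨
    (f ⊛ (g ⊛ h)) (suc n) ∎
    where
    open ≡-Reasoning
    regroup : ∀ a b c d e → a * b * c + (a * d + e) ≡ a * (b * c + d) + e
    regroup = solve-∀

  const-⊛ : ∀ c f n → (const c ⊛ f) n ≡ c * f n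
  const-⊛ c f zero    = ⊛-zero (const c) f
  const-⊛ c f (suc n) = trans (⊛-suc (const c) f n) (trans
    (cong (λ x → c * f (suc n) + x)
      (trans (sumBelow-cong (suc n) (λ k _ → ℤₚ.*-zeroˡ (f (n ℕ.∸ k)))) (sumBelow-zero (suc n))))
    (ℤₚ.+-identityʳ _))

  qpow-⊛-+ : ∀ d f n → (qpow d ⊛ f) (d ℕ.+ n) ≡ f n
  qpow-⊛-+ zero    f n = trans (const-⊛ (+ 1) f n) (ℤₚ.*-identityˡ (f n))
  qpow-⊛-+ (suc d) f n = trans (⊛-suc (qpow (suc d)) f (d ℕ.+ n)) (trans
    (cong₂ _+_ (ℤₚ.*-zeroˡ (f (suc (d ℕ.+ n)))) (qpow-⊛-+ d f n)) (ℤₚ.+-identityˡ (f n)))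

  qpow-⊛-< : ∀ d f n → n < d → (qpow d ⊛ f) n ≡ + 0
  qpow-⊛-< (suc d) f zero    _         = trans (⊛-zero (qpow (suc d)) f) (ℤₚ.*-zeroˡ (f 0))
  qpow-⊛-< (suc d) f (suc n) (s≤s n<d) = trans (⊛-suc (qpow (suc d)) f n)
    (cong₂ _+_ (ℤₚ.*-zeroˡ (f (suc n))) (qpow-⊛-< d f n n<d))

  -- The modulus is a parameter so that one theory serves for congruences and, at m = 0, for
  -- equality: 0 divides x - y only if x = y. The relations are records so that x and y can be
  -- inferred, which a bare divisibility of x - y does not allow.
  module Mod (m : ℤ) where

    infix 4 _≈_ _∼_

    record _∼_ (x y : ℤ) : Set where
      constructor cong-mod
      field m∣x-y : m ∣ x - y
    open _∼_ public

    ∼-reflexive : ∀ {x y} → x ≡ y → x ∼ y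
    ∼-reflexive {x} refl = cong-mod (subst (m ∣_) (sym (ℤₚ.+-inverseʳ x)) (m ∣0))

    ∼-refl : ∀ {x} → x ∼ x
    ∼-refl = ∼-reflexive refl

    ∼-sym : ∀ {x y} → x ∼ y → y ∼ x
    ∼-sym {x} {y} (cong-mod h) = cong-mod (subst (m ∣_) (lemma x y) (∣m⇒∣-m h))
      where
      lemma : ∀ x y → - (x - y) ≡ y - x
      lemma = solve-∀

    ∼-trans : ∀ {x y z} → x ∼ y → y ∼ z → x ∼ z
    ∼-trans {x} {y} {z} (cong-mod h) (cong-mod k) =
      cong-mod (subst (m ∣_) (lemma x y z) (∣m∣n⇒∣m+n h k))
      where
      lemma : ∀ x y z → (x - y) + (y - z) ≡ x - z
      lemma = solve-∀

    ∼-+ : ∀ {x x′ y y′} → x ∼ x′ → y ∼ y′ → x + y ∼ x′ + y′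
    ∼-+ {x} {x′} {y} {y′} (cong-mod h) (cong-mod k) =
      cong-mod (subst (m ∣_) (lemma x x′ y y′) (∣m∣n⇒∣m+n h k))
      where
      lemma : ∀ x x′ y y′ → (x - x′) + (y - y′) ≡ (x + y) - (x′ + y′)
      lemma = solve-∀

    ∼-* : ∀ {x x′ y y′} → x ∼ x′ → y ∼ y′ → x * y ∼ x′ * y′
    ∼-* {x} {x′} {y} {y′} (cong-mod h) (cong-mod k) =
      cong-mod (subst (m ∣_) (lemma x x′ y y′) (∣m∣n⇒∣m+n (∣m⇒∣m*n y h) (∣n⇒∣m*n x′ k)))
      where
      lemma : ∀ x x′ y y′ → (x - x′) * y + x′ * (y - y′) ≡ x * y - x′ * y′
      lemma = solve-∀

    ∼-neg : ∀ {x y} → x ∼ y → - x ∼ - y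
    ∼-neg {x} {y} (cong-mod h) = cong-mod (subst (m ∣_) (lemma x y) (∣m⇒∣-m h))
      where
      lemma : ∀ x y → - (x - y) ≡ (- x) - (- y)
      lemma = solve-∀

    ∣⇒∼0 : ∀ {x} → m ∣ x → x ∼ + 0
    ∣⇒∼0 {x} h = cong-mod (subst (m ∣_) (sym (ℤₚ.+-identityʳ x)) h)

    ∼0⇒∣ : ∀ {x} → x ∼ + 0 → m ∣ x
    ∼0⇒∣ {x} (cong-mod h) = subst (m ∣_) (ℤₚ.+-identityʳ x) h

    sumBelow-∼ : ∀ n {f g : ℕ → ℤ} → (∀ k → k < n → f k ∼ g k) → sumBelow n f ∼ sumBelow n g
    sumBelow-∼ n h = cong-mod
      (subst (m ∣_) (sym (sumBelow-- n _ _)) (sumBelow-∣ n (λ k k<n → m∣x-y (h k k<n))))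

    record _≈_ (f g : Series) : Set where
      constructor mk
      field at : ∀ n → f n ∼ g n
    open _≈_ public

    ≗⇒≈ : ∀ {f g} → f ≗ g → f ≈ g
    ≗⇒≈ h = mk (λ n → ∼-reflexive (h n))

    ⊛-∼≤ : ∀ n {f f′ g g′} → (∀ k → k ≤ n → f k ∼ f′ k) → (∀ k → k ≤ n → g k ∼ g′ k) →
           (f ⊛ g) n ∼ (f′ ⊛ g′) n
    ⊛-∼≤ n p r = sumBelow-∼ (suc n) (λ { k (s≤s k≤n) → ∼-* (p k k≤n) (r _ (ℕₚ.m∸n≤m n k)) })

  module Exact = Mod (+ 0)

  exact-≡ : ∀ {f g} → f Exact.≈ g → f ≗ g
  exact-≡ {f} {g} h n = ℤₚ.i-j≡0⇒i≡j (f n) (g n) (0∣⇒≡0 (Exact.m∣x-y (Exact.at h n)))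

  weaken : ∀ {a b f g} → b ∣ a → Mod._≈_ a f g → Mod._≈_ b f g
  weaken b∣a h = Mod.mk (λ n → Mod.cong-mod (∣-trans b∣a (Mod.m∣x-y (Mod.at h n))))

  reduce : ∀ {m f g} → f Exact.≈ g → Mod._≈_ m f g
  reduce {m} = weaken (m ∣0)

open Convolution

-- The commutative ring of power series modulo m.

module SeriesRing where
  infixl 6 _+_ _-_
  infixl 7 _*_
  infix  8 -_
  infixr 8 _^_

  -- Opaque copies of the operations keep the ring solver from unfolding convolutions.
  opaque
    _+_ _*_ : Series → Series → Series
    _+_ = _⊕_
    _*_ = _⊛_

    -_ : Series → Series
    (- f) n = ℤ.- f n

  _-_ : Series → Series → Series
  f - g = f + (- g)

  _^_ : Series → ℕ → Series
  f ^ zero  = # 1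
  f ^ suc n = f * f ^ n

  opaque
    unfolding _+_ _*_ -_

    *≡⊛ : _*_ ≡ _⊛_
    *≡⊛ = ≡-refl

    coeff-* : ∀ f g n → (f * g) n ≡ (f ⊛ g) n
    coeff-* f g n = ≡-refl

    coeff-+ : ∀ f g n → (f + g) n ≡ f n ℤ.+ g n
    coeff-+ f g n = ≡-refl

    coeff-neg : ∀ f n → (- f) n ≡ ℤ.- f n
    coeff-neg f n = ≡-refl

    one⊖-≡ : ∀ f → (one ⊖ f) ≡ # 1 - f
    one⊖-≡ f = ≡-refl

    isCommutativeRing : ∀ m → IsCommutativeRing (Mod._≈_ m) _+_ _*_ -_ (# 0) (# 1)
    isCommutativeRing m = record
      { isRing = record
        { +-isAbelianGroup = record
          { isGroup = record
            { isMonoid = record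
              { isSemigroup = record
                { isMagma = record
                  { isEquivalence = record
                    { refl  = mk (λ n → ∼-refl)
                    ; sym   = λ p → mk (λ n → ∼-sym (at p n))
                    ; trans = λ p r → mk (λ n → ∼-trans (at p n) (at r n))
                    }
                  ; ∙-cong = λ p r → mk (λ n → ∼-+ (at p n) (at r n))
                  }
                ; assoc = λ f g h → ≗⇒≈ (λ n → ℤₚ.+-assoc (f n) (g n) (h n))
                }
              ; identity = (λ f → ≗⇒≈ (idˡ f)) , (λ f → ≗⇒≈ (λ n → ≡-trans (ℤₚ.+-comm (f n) _) (idˡ f n)))
              }
            ; inverse = (λ f → ≗⇒≈ (λ n → ≡-trans (ℤₚ.+-inverseˡ (f n)) (≡-sym (zero-const n))))
                      , (λ f → ≗⇒≈ (λ n → ≡-trans (ℤₚ.+-inverseʳ (f n)) (≡-sym (zero-const n))))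
            ; ⁻¹-cong = λ p → mk (λ n → ∼-neg (at p n))
            }
          ; comm = λ f g → ≗⇒≈ (λ n → ℤₚ.+-comm (f n) (g n))
          }
        ; *-cong = λ {f} {f′} {g} {g′} p r →
            mk (λ n → ⊛-∼≤ n {f} {f′} {g} {g′} (λ k _ → at p k) (λ k _ → at r k))
        ; *-assoc = λ f g h → ≗⇒≈ (⊛-assoc f g h)
        ; *-identity = (λ f → ≗⇒≈ (oneˡ f)) , (λ f → ≗⇒≈ (λ n → ≡-trans (⊛-comm f one n) (oneˡ f n)))
        ; distrib = (λ h f g → ≗⇒≈ (λ n → ≡-trans (⊛-comm h (f ⊕ g) n)
                       (≡-trans (⊛-distribʳ h f g n) (cong₂ ℤ._+_ (⊛-comm f h n) (⊛-comm g h n)))))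
                  , (λ h f g → ≗⇒≈ (⊛-distribʳ h f g))
        }
      ; *-comm = λ f g → ≗⇒≈ (⊛-comm f g)
      }
      where
      open Mod m
      zero-const : ∀ n → const (+ 0) n ≡ + 0
      zero-const zero    = ≡-refl
      zero-const (suc n) = ≡-refl
      idˡ : ∀ (f : Series) n → const (+ 0) n ℤ.+ f n ≡ f n
      idˡ f n = ≡-trans (cong (ℤ._+ f n) (zero-const n)) (ℤₚ.+-identityˡ (f n))
      oneˡ : ∀ (f : Series) n → (one ⊛ f) n ≡ f n
      oneˡ f n = ≡-trans (const-⊛ (+ 1) f n) (ℤₚ.*-identityˡ (f n))

    const-+ : ∀ m a b → Mod._≈_ m (const (a ℤ.+ b)) (const a + const b)
    const-+ m a b = Mod.≗⇒≈ m λ { zero → ≡-refl ; (suc n) → ≡-refl }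

    const-* : ∀ m a b → Mod._≈_ m (const (a ℤ.* b)) (const a * const b)
    const-* m a b = Mod.≗⇒≈ m λ { zero → ≡-sym (const-⊛ a (const b) 0)
                                ; (suc n) → ≡-sym (≡-trans (const-⊛ a (const b) (suc n)) (ℤₚ.*-zeroʳ a)) }

    const-neg : ∀ m a → Mod._≈_ m (const (ℤ.- a)) (- const a)
    const-neg m a = Mod.≗⇒≈ m λ { zero → ≡-refl ; (suc n) → ≡-refl }

  ring : ℤ → CommutativeRing 0ℓ 0ℓ
  ring m = record { isCommutativeRing = isCommutativeRing m }

  morphism : ∀ m → ℤ.+-*-rawRing -Raw-AlmostCommutative⟶ fromCommutativeRing (ring m)
  morphism m = record
    { ⟦_⟧ = const ; +-homo = const-+ m ; *-homo = const-* m ; -‿homo = const-neg m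
    ; 0-homo = Mod.≗⇒≈ m (λ _ → ≡-refl) ; 1-homo = Mod.≗⇒≈ m (λ _ → ≡-refl) }

  module Ring (m : ℤ) where
    open IntegerAlgebra (ring m) (morphism m) public hiding (_+_; _*_; -_; _-_; ι; _≈_; Carrier)
    open Mod m public hiding (_∼_)

    infixl 6 _⊞_
    infix  7 _⊡_

    -- To prove a ≈ b from hypotheses lᵢ ≈ rᵢ, exhibit a = b + Σ cᵢ (lᵢ - rᵢ).
    combine : ∀ {a b z} → a ≈ b + z → z ≈ # 0 → a ≈ b
    combine {b = b} h k = trans h (trans (+-cong refl k) (+-identityʳ b))

    _⊡_ : ∀ {l r} c → l ≈ r → c * (l - r) ≈ # 0
    _⊡_ {r = r} c h = trans (*-cong refl (trans (+-cong h refl) (-‿inverseʳ r))) (zeroʳ c)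

    _⊞_ : ∀ {y z} → y ≈ # 0 → z ≈ # 0 → y + z ≈ # 0
    h ⊞ k = trans (+-cong h k) (+-identityˡ (# 0))

    cancel : ∀ {u u′ a b} → u * u′ ≈ # 1 → u * a ≈ u * b → a ≈ b
    cancel {u} {u′} {a} {b} h k = combine
      (solve 4 (λ u u′ a b → a := b :+ ((b :- a) :* (u :* u′ :- :# 1) :+ u′ :* (u :* a :- u :* b))) refl u u′ a
        b)
      ((b - a) ⊡ h ⊞ u′ ⊡ k)

    pow-cong : ∀ n {f g} → f ≈ g → f ^ n ≈ g ^ n
    pow-cong zero    h = refl
    pow-cong (suc n) h = *-cong h (pow-cong n h)

-- Inverses, and substitution of a series without constant term.

module Substitution where
  open SeriesRing

  q^ : ℕ → Series
  q^ = qpow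

  q^-+ : ∀ m a b → let open Ring m in q^ (a ℕ.+ b) ≈ q^ a * q^ b
  q^-+ m a b = Ring.≗⇒≈ m λ n → ≡-sym (≡-trans (coeff-* (q^ a) (q^ b) n) (go a n))
    where
    go : ∀ a n → (q^ a ⊛ q^ b) n ≡ q^ (a ℕ.+ b) n
    go zero    n       = qpow-⊛-+ 0 (q^ b) n
    go (suc a) zero    = qpow-⊛-< (suc a) (q^ b) 0 (s≤s z≤n)
    go (suc a) (suc n) = ≡-trans (⊛-suc (q^ (suc a)) (q^ b) n)
      (≡-trans (cong₂ ℤ._+_ (ℤₚ.*-zeroˡ (q^ b (suc n))) (go a n)) (ℤₚ.+-identityˡ _))

  q^-^ : ∀ m a n → let open Ring m in q^ a ^ n ≈ q^ (n ℕ.* a)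
  q^-^ m a zero    = Ring.refl m
  q^-^ m a (suc n) = trans (*-cong refl (q^-^ m a n)) (sym (q^-+ m a (n ℕ.* a)))
    where open Ring m

  const0≡0 : ∀ n → const (+ 0) n ≡ + 0
  const0≡0 zero    = ≡-refl
  const0≡0 (suc n) = ≡-refl

  invUpTo-stable : ∀ f n k → k ≤ n → invUpTo f n k ≡ inv f k
  invUpTo-stable f zero    zero k≤n = ≡-refl
  invUpTo-stable f (suc n) k k≤1+n with k ≤ᵇ n in eq
  ... | true = invUpTo-stable f n k (ℕₚ.≤ᵇ⇒≤ k n (subst Bool.T (≡-sym eq) tt))
  ... | false with ℕₚ.m≤n⇒m<n∨m≡n k≤1+n
  ...   | inj₁ (s≤s k≤n) with () ← subst Bool.T eq (ℕₚ.≤⇒≤ᵇ k≤n)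
  ...   | inj₂ ≡-refl rewrite eq = ≡-refl

  inv-suc : ∀ f n → inv f (suc n) ≡ ℤ.- (tail f ⊛ inv f) n
  inv-suc f n with suc n ≤ᵇ n in eq
  ... | true with () ← ℕₚ.1+n≰n (ℕₚ.≤ᵇ⇒≤ (suc n) n (subst Bool.T (≡-sym eq) tt))
  ... | false with n ≡ᵇ n in eq′
  ...   | false with () ← subst Bool.T eq′ (ℕₚ.≡⇒≡ᵇ n n ≡-refl)
  ...   | true = cong ℤ.-_ (sumBelow-cong (suc n)
            (λ k _ → cong (f (suc k) ℤ.*_) (invUpTo-stable f n (n ℕ.∸ k) (ℕₚ.m∸n≤m n k))))

  ⊛-inv : ∀ f → f 0 ≡ + 1 → f ⊛ inv f ≗ one
  ⊛-inv f f0 zero    = ≡-trans (⊛-zero f (inv f)) (cong (ℤ._* + 1) f0)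
  ⊛-inv f f0 (suc n) = begin
    (f ⊛ inv f) (suc n)                                ≡⟨ ⊛-suc f (inv f) n ⟩
    f 0 ℤ.* inv f (suc n) ℤ.+ (tail f ⊛ inv f) n       ≡⟨ cong₂ (λ x y → x ℤ.* y ℤ.+ (tail f ⊛ inv f) n) f0
      (inv-suc f n) ⟩
    + 1 ℤ.* ℤ.- (tail f ⊛ inv f) n ℤ.+ (tail f ⊛ inv f) n ≡⟨ cong (ℤ._+ (tail f ⊛ inv f) n)
      (ℤₚ.*-identityˡ (ℤ.- (tail f ⊛ inv f) n)) ⟩
    ℤ.- (tail f ⊛ inv f) n ℤ.+ (tail f ⊛ inv f) n      ≡⟨ ℤₚ.+-inverseˡ ((tail f ⊛ inv f) n) ⟩
    + 0                                                ∎
    where open ≡-Reasoning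

  *-0 : ∀ {f g} → f 0 ≡ + 1 → g 0 ≡ + 1 → (f * g) 0 ≡ + 1
  *-0 {f} {g} p r = ≡-trans (coeff-* f g 0) (≡-trans (⊛-zero f g) (cong₂ ℤ._*_ p r))

  ^-0 : ∀ {f} n → f 0 ≡ + 1 → (f ^ n) 0 ≡ + 1
  ^-0 zero    p = ≡-refl
  ^-0 {f} (suc n) p = *-0 {f} {f ^ n} p (^-0 {f} n p)

  +-0 : ∀ {f g} → f 0 ≡ + 1 → g 0 ≡ + 0 → (f + g) 0 ≡ + 1
  +-0 {f} {g} p r = ≡-trans (coeff-+ f g 0) (cong₂ ℤ._+_ p r)

  *-0ˡ : ∀ {f} g → f 0 ≡ + 0 → (f * g) 0 ≡ + 0
  *-0ˡ {f} g p = ≡-trans (coeff-* f g 0) (≡-trans (⊛-zero f g) (≡-trans (cong (ℤ._* g 0) p) (ℤₚ.*-zeroˡ (g 0))))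

  *-0ʳ : ∀ f {g} → g 0 ≡ + 0 → (f * g) 0 ≡ + 0
  *-0ʳ f {g} p = ≡-trans (coeff-* f g 0) (≡-trans (⊛-zero f g) (≡-trans (cong (f 0 ℤ.*_) p) (ℤₚ.*-zeroʳ (f 0))))

  neg-0 : ∀ {f} → f 0 ≡ + 0 → (- f) 0 ≡ + 0
  neg-0 {f} p = ≡-trans (coeff-neg f 0) (cong ℤ.-_ p)

  neg-* : ∀ f g n → (- f * g) n ≡ ℤ.- (f * g) n
  neg-* f g n = ≡-trans (exact-≡ (solve 2 (λ f g → :- f :* g := :- (f :* g)) refl f g) n) (coeff-neg (f * g) n)
    where open Ring (+ 0)

  module SeriesMod (m : ℤ) where
    open Ring m public
    open Mod m public using (_∼_)

    *-inv : ∀ f → f 0 ≡ + 1 → f * inv f ≈ # 1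
    *-inv f f0 = ≗⇒≈ (λ n → ≡-trans (coeff-* f (inv f) n) (⊛-inv f f0 n))

    inv-unique : ∀ {f g} → f 0 ≡ + 1 → f * g ≈ # 1 → g ≈ inv f
    inv-unique {f} f0 h = cancel (*-inv f f0) (trans h (sym (*-inv f f0)))

    cancelˡ : ∀ {f g h} → f 0 ≡ + 1 → f * g ≈ f * h → g ≈ h
    cancelˡ {f} f0 = cancel (*-inv f f0)

    -- A family of series satisfying aᵢ = pᵢ + t a_{s i} with t(0) = 0 is determined by p and s.
    guarded : ∀ {I : Set} {t} → t 0 ≡ + 0 → (s : I → I) {p p′ a b : I → Series} → (∀ i → p i ≈ p′ i) →
              (∀ i → a i ≈ p i + t * a (s i)) → (∀ i → b i ≈ p′ i + t * b (s i)) → ∀ i → a i ≈ b i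
    guarded {I} {t} t0 s {p} {p′} {a} {b} p≈ ha hb i = mk (λ n → go n i n ℕₚ.≤-refl)
      where
      step : ∀ n i → (∀ k → k < n → a (s i) k ∼ b (s i) k) → a i n ∼ b i n
      tb : ∀ n i → (∀ k → k < n → a (s i) k ∼ b (s i) k) → (t * a (s i)) n ∼ (t * b (s i)) n
      tb zero    i h = ∼-reflexive (≡-trans (*-0ˡ {t} (a (s i)) t0) (≡-sym (*-0ˡ {t} (b (s i)) t0)))
      tb (suc n) i h =
        ∼-trans (∼-reflexive (first (a (s i))))
          (∼-trans (⊛-∼≤ n {tail t} {tail t} {a (s i)} {b (s i)} (λ _ _ → ∼-refl) (λ k k≤n → h k (s≤s k≤n)))
            (∼-sym (∼-reflexive (first (b (s i))))))
        where
        first : ∀ y → (t * y) (suc n) ≡ (tail t ⊛ y) n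
        first y = ≡-trans (coeff-* t y (suc n)) (≡-trans (⊛-suc t y n)
          (≡-trans (cong (λ z → z ℤ.* y (suc n) ℤ.+ (tail t ⊛ y) n) t0)
            (≡-trans (cong (ℤ._+ (tail t ⊛ y) n) (ℤₚ.*-zeroˡ (y (suc n)))) (ℤₚ.+-identityˡ _))))
      step n i h = ∼-trans (at (ha i) n) (∼-trans (∼-reflexive (coeff-+ (p i) _ n))
        (∼-trans (∼-+ (at (p≈ i) n) (tb n i h))
          (∼-sym (∼-trans (at (hb i) n) (∼-reflexive (coeff-+ (p′ i) _ n))))))
      go : ∀ n i k → k ≤ n → a i k ∼ b i k
      go zero    i zero z≤n = step 0 i (λ _ ())
      go (suc n) i k k≤1+n  = step k i (λ l l<k → go n (s i) l (ℕₚ.≤-pred (ℕₚ.≤-trans l<k k≤1+n)))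

    -- τ f = Σ f(k) tᵏ
    record IsSubst (t : Series) (τ : Series → Series) : Set where
      field
        t0     : t 0 ≡ + 0
        unfold : ∀ f → τ f ≈ const (f 0) + t * τ (tail f)

      -- An instance of `guarded` whose index carries the congruence of f and g along, because it
      -- passes to the tails.
      τ-cong : ∀ {f g} → f ≈ g → τ f ≈ τ g
      τ-cong {f} {g} h = guarded {I = Σ Series λ f → Σ Series λ g → f ≈ g} t0
        (λ { (f , g , h) → tail f , tail g , mk (λ n → at h (suc n)) })
        {λ { (f , _ , _) → const (f 0) }} {λ { (_ , g , _) → const (g 0) }}
        {λ { (f , _ , _) → τ f }} {λ { (_ , g , _) → τ g }}
        (λ { (f , g , h) → mk λ { zero → at h 0 ; (suc n) → ∼-refl } })
        (λ { (f , _ , _) → unfold f }) (λ { (_ , g , _) → unfold g }) (f , g , h)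

      τ-+ : ∀ f g → τ (f + g) ≈ τ f + τ g
      τ-+ f g = guarded {I = Series × Series} t0 (λ { (f , g) → tail f , tail g })
        {λ { (f , g) → const ((f + g) 0) }} {λ { (f , g) → const (f 0) + const (g 0) }}
        {λ { (f , g) → τ (f + g) }} {λ { (f , g) → τ f + τ g }}
        (λ { (f , g) → trans (reflexive (cong const (coeff-+ f g 0))) (const-+ m (f 0) (g 0)) })
        (λ { (f , g) → trans (unfold (f + g)) (+-cong refl (*-cong refl (τ-cong
               (≗⇒≈ (λ n → ≡-trans (coeff-+ f g (suc n)) (≡-sym (coeff-+ (tail f) (tail g) n))))))) })
        (λ { (f , g) → trans (+-cong (unfold f) (unfold g))
               (solve 5 (λ a b t x y → (a :+ t :* x) :+ (b :+ t :* y) := (a :+ b) :+ t :* (x :+ y)) refl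
                 (const (f 0)) (const (g 0)) t (τ (tail f)) (τ (tail g))) })
        (f , g)

      τ-scale : ∀ c f → τ (const c * f) ≈ const c * τ f
      τ-scale c = guarded t0 tail {λ f → const ((const c * f) 0)} {λ f → const c * const (f 0)}
        (λ f → trans (reflexive (cong const (≡-trans (coeff-* (const c) f 0) (const-⊛ c f 0))))
          (const-* m c (f 0)))
        (λ f → trans (unfold (const c * f)) (+-cong refl (*-cong refl (τ-cong
          (≗⇒≈ (λ n → ≡-trans (coeff-* (const c) f (suc n)) (≡-trans (const-⊛ c f (suc n))
            (≡-sym (≡-trans (coeff-* (const c) (tail f) n) (const-⊛ c (tail f) n))))))))))
        (λ f → trans (*-cong refl (unfold f))
          (solve 4 (λ c a t x → c :* (a :+ t :* x) := c :* a :+ t :* (c :* x)) refl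
            (const c) (const (f 0)) t (τ (tail f))))

      -- For fixed g both sides solve y(f) = f(0) τ g + t y(tail f), and `guarded` allows only one
      -- solution.
      τ-* : ∀ f g → τ (f * g) ≈ τ f * τ g
      τ-* f g = guarded t0 tail {λ f → const (f 0) * τ g} (λ _ → refl) left right f
        where
        tail-* : ∀ f → tail (f * g) ≈ const (f 0) * tail g + tail f * g
        tail-* f = ≗⇒≈ λ n → ≡-trans (coeff-* f g (suc n)) (≡-trans (⊛-suc f g n)
          (≡-sym (≡-trans (coeff-+ (const (f 0) * tail g) (tail f * g) n) (cong₂ ℤ._+_
            (≡-trans (coeff-* (const (f 0)) (tail g) n) (const-⊛ (f 0) (tail g) n)) (coeff-* (tail f) g n)))))
        head-* : ∀ f → const ((f * g) 0) ≈ const (f 0) * const (g 0)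
        head-* f = trans (reflexive (cong const (≡-trans (coeff-* f g 0) (⊛-zero f g)))) (const-* m (f 0) (g 0))
        left : ∀ f → τ (f * g) ≈ const (f 0) * τ g + t * τ (tail f * g)
        left f = trans (unfold (f * g)) (trans (+-cong (head-* f) (*-cong refl (trans (τ-cong (tail-* f))
          (trans (τ-+ (const (f 0) * tail g) (tail f * g)) (+-cong (τ-scale (f 0) (tail g)) refl)))))
          (trans (solve 5 (λ c d t x y → c :* d :+ t :* (c :* x :+ y) := c :* (d :+ t :* x) :+ t :* y) refl
                   (const (f 0)) (const (g 0)) t (τ (tail g)) (τ (tail f * g)))
            (+-cong (*-cong refl (sym (unfold g))) refl)))
        right : ∀ f → τ f * τ g ≈ const (f 0) * τ g + t * (τ (tail f) * τ g)
        right f = trans (*-cong (unfold f) refl)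
          (solve 4 (λ c t x y → (c :+ t :* x) :* y := c :* y :+ t :* (x :* y)) refl
            (const (f 0)) t (τ (tail f)) (τ g))

      τ-const : ∀ c → τ (const c) ≈ const c
      τ-const c = trans (unfold (const c)) (trans (+-cong refl (*-cong refl τ-zero))
        (solve 2 (λ c t → c :+ t :* :# 0 := c) refl (const c) t))
        where
        τ-zero : τ (tail (const c)) ≈ # 0
        τ-zero = guarded {I = ⊤} t0 (λ i → i) {λ _ → # 0} (λ _ → refl)
          (λ _ → trans (unfold (tail (const c))) refl)
          (λ _ → solve 1 (λ t → :# 0 := :# 0 :+ t :* :# 0) refl t) tt

      τ-neg : ∀ f → τ (- f) ≈ - τ f
      τ-neg f = trans (τ-cong (solve 1 (λ f → :- f := con (ℤ.- (+ 1)) :* f) refl f))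
        (trans (τ-scale (ℤ.- (+ 1)) f) (solve 1 (λ f → con (ℤ.- (+ 1)) :* f := :- f) refl (τ f)))

      τ-^ : ∀ f n → τ (f ^ n) ≈ τ f ^ n
      τ-^ f zero    = τ-const (+ 1)
      τ-^ f (suc n) = trans (τ-* f (f ^ n)) (*-cong refl (τ-^ f n))

      τ-q^ : ∀ n → τ (q^ n) ≈ t ^ n
      τ-q^ zero    = τ-const (+ 1)
      τ-q^ (suc n) = trans (unfold (q^ (suc n)))
        (trans (+-identityˡ (t * τ (q^ n))) (*-cong refl (τ-q^ n)))

  -- The series f(q^d); at d = 5 it is definitionally `dil5`.
  dil : (d : ℕ) .{{_ : NonZero d}} → Series → Series
  dil d f n = if (n % d) ≡ᵇ 0 then f (n / d) else + 0

  dil-0 : ∀ d .{{_ : NonZero d}} f → dil d f 0 ≡ f 0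
  dil-0 (suc d) f = ≡-refl

  dil-multiple : ∀ d .{{_ : NonZero d}} f n → dil d f (n ℕ.* d) ≡ f n
  dil-multiple d f n = cong₂ (λ r k → if r ≡ᵇ 0 then f k else + 0) (m*n%n≡0 n d) (m*n/n≡m n d)

  dil-unfold : ∀ d .{{_ : NonZero d}} f n → dil d f n ≡ (const (f 0) ⊕ (qpow d ⊛ dil d (tail f))) n
  dil-unfold d@(suc d′) f n with n ℕₚ.<? d
  ... | yes n<d = ≡-trans
    (cong₂ (λ r k → if r ≡ᵇ 0 then f k else + 0) (m<n⇒m%n≡m n<d) (m<n⇒m/n≡0 n<d))
    (≡-sym (≡-trans (cong (λ x → const (f 0) n ℤ.+ x) (qpow-⊛-< d (dil d (tail f)) n n<d)) (ℤₚ.+-identityʳ _)))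
  ... | no n≮d with ℕₚ.m≤n⇒∃[o]m+o≡n (ℕₚ.≮⇒≥ n≮d)
  ...   | k , ≡-refl = ≡-trans
    (cong₂ (λ r k → if r ≡ᵇ 0 then f k else + 0)
      (≡-trans (≡-sym (m≤n⇒[n∸m]%m≡n%m d≤d+k)) (cong (_% d) (ℕₚ.m+n∸m≡n d k)))
      (≡-trans (m/n≡1+[m∸n]/n d≤d+k) (cong (λ x → suc (x / d)) (ℕₚ.m+n∸m≡n d k))))
    (≡-sym (≡-trans (ℤₚ.+-identityˡ _) (qpow-⊛-+ d (dil d (tail f)) k)))
    where
    d≤d+k : d ≤ d ℕ.+ k
    d≤d+k = ℕₚ.m≤m+n d k

  -- The series f(-q). The recursion along `tail` makes it the substitution of t = -q.
  σ : Series → Series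
  σ f zero    = f 0
  σ f (suc n) = ℤ.- σ (tail f) n

  module Substitutions (m : ℤ) where
    open SeriesMod m

    dil-isSubst : ∀ d .{{_ : NonZero d}} → IsSubst (q^ d) (dil d)
    dil-isSubst d@(suc _) = record
      { t0 = ≡-refl
      ; unfold = λ f → ≗⇒≈ λ n → ≡-trans (dil-unfold d f n)
          (≡-sym (≡-trans (coeff-+ _ _ n) (cong (λ x → const (f 0) n ℤ.+ x) (coeff-* _ _ n)))) }

    σ-isSubst : IsSubst (- q^ 1) σ
    σ-isSubst = record { t0 = neg-0 {q^ 1} ≡-refl ; unfold = λ f → ≗⇒≈ (eq f) }
      where
      eq : ∀ f n → σ f n ≡ (const (f 0) + - q^ 1 * σ (tail f)) n
      eq f zero = ≡-sym (≡-trans (coeff-+ (const (f 0)) (- q^ 1 * σ (tail f)) 0)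
        (≡-trans (cong (λ x → f 0 ℤ.+ x) (*-0ˡ { - q^ 1} (σ (tail f)) (neg-0 {q^ 1} ≡-refl)))
          (ℤₚ.+-identityʳ (f 0))))
      eq f (suc n) = ≡-sym (≡-trans (coeff-+ (const (f 0)) (- q^ 1 * σ (tail f)) (suc n))
        (≡-trans (ℤₚ.+-identityˡ _)
        (≡-trans (neg-* (q^ 1) (σ (tail f)) (suc n))
          (cong ℤ.-_ (≡-trans (coeff-* (q^ 1) (σ (tail f)) (suc n)) (qpow-⊛-+ 1 (σ (tail f)) n))))))

    module Dil (d : ℕ) .{{nz : NonZero d}} = IsSubst (dil-isSubst d)
    module Sigma = IsSubst σ-isSubst

    dil-q^ : ∀ d .{{_ : NonZero d}} e → dil d (q^ e) ≈ q^ (e ℕ.* d)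
    dil-q^ d zero    = Dil.τ-const d (+ 1)
    dil-q^ d (suc e) = trans (Dil.unfold d (q^ (suc e)))
      (trans (+-identityˡ _) (trans (*-cong refl (dil-q^ d e)) (sym (q^-+ m d (e ℕ.* d)))))

    dil-injective : ∀ d .{{_ : NonZero d}} {f g} → dil d f ≈ dil d g → f ≈ g
    dil-injective d {f} {g} h = mk λ n →
      subst₂ _∼_ (dil-multiple d f n) (dil-multiple d g n) (at h (n ℕ.* d))

open Substitution

-- Lifting congruences, and the Frobenius congruence modulo 2 and 3.

module Congruences where
  open SeriesRing
  open import Data.Integer.Divisibility.Signed using (_∣_)

  ∃-quotient : ∀ {m f g} → Mod._≈_ m f g → ∃ λ h → f Exact.≈ (g + const m * h)
  ∃-quotient {m} {f} {g} p = h , Exact.≗⇒≈ eq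
    where
    h : Series
    h n = Signed._∣_.quotient (Mod.m∣x-y (Mod.at p n))
    add-sub : ∀ x y → y ℤ.+ (x ℤ.- y) ≡ x
    add-sub = solve-∀
    eq : f ≗ g + const m * h
    eq n = ≡-trans (≡-sym (add-sub (f n) (g n))) (≡-sym (≡-trans (coeff-+ g (const m * h) n)
      (cong (λ x → g n ℤ.+ x) (≡-trans (≡-trans (coeff-* (const m) h n) (const-⊛ m h n))
        (≡-trans (ℤₚ.*-comm m (h n)) (≡-sym (Signed._∣_.equality (Mod.m∣x-y (Mod.at p n)))))))))

  const-m≈0 : ∀ m → Mod._≈_ m (const m) (# 0)
  const-m≈0 m = Mod.mk λ { zero → Mod.∣⇒∼0 m (divides (+ 1) (≡-sym (ℤₚ.*-identityˡ m)))
                         ; (suc n) → Mod.∼-refl m }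

  double-mod-4 : ∀ {f g} → Mod._≈_ (+ 2) f g → Mod._≈_ (+ 4) (# 2 * f) (# 2 * g)
  double-mod-4 {f} {g} p with ∃-quotient p
  ... | h , eq = combine {z = # 2 * (f - (g + # 2 * h)) + h * (# 4 - # 0)}
        (solve 3 (λ f g h → :# 2 :* f := :# 2 :* g :+ (:# 2 :* (f :- (g :+ :# 2 :* h)) :+ h :* (:# 4 :- :# 0)))
          refl f g h)
        (# 2 ⊡ reduce eq ⊞ h ⊡ const-m≈0 (+ 4))
    where open Ring (+ 4)

  -- f = g + 2h gives f² = g² + 4(gh + h²). Together with `double-mod-4` this turns parities into
  -- information modulo 4.
  square-mod-4 : ∀ {f g} → Mod._≈_ (+ 2) f g → Mod._≈_ (+ 4) (f * f) (g * g)
  square-mod-4 {f} {g} p with ∃-quotient p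
  ... | h , eq = combine {z = (f + g + # 2 * h) * (f - (g + # 2 * h)) + (g * h + h * h) * (# 4 - # 0)}
        (solve 3 (λ f g h → f :* f :=
          g :* g :+ ((f :+ g :+ :# 2 :* h) :* (f :- (g :+ :# 2 :* h)) :+ (g :* h :+ h :* h) :* (:# 4 :- :# 0)))
          refl f g h)
        ((f + g + # 2 * h) ⊡ reduce eq ⊞ (g * h + h * h) ⊡ const-m≈0 (+ 4))
    where open Ring (+ 4)

  module Frobenius (p : ℕ) .{{_ : NonZero p}}
    (q₀ : q^ p 0 ≡ + 0)
    (fermat : ∀ c → Mod._≈_ (+ p) (const c ^ p) (const c))
    (dream : ∀ c t g → Mod._≈_ (+ p) ((c + t * g) ^ p) (c ^ p + t ^ p * g ^ p))
    (q^p : Mod._≈_ (+ p) (q^ 1 ^ p) (q^ p)) where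

    open SeriesMod (+ p)
    open Substitutions (+ p)

    split : ∀ f → f ≈ const (f 0) + q^ 1 * tail f
    split f = ≗⇒≈ λ { zero → ≡-sym (≡-trans (coeff-+ (const (f 0)) (q^ 1 * tail f) 0)
                        (≡-trans (cong (λ x → f 0 ℤ.+ x) (*-0ˡ {q^ 1} (tail f) ≡-refl)) (ℤₚ.+-identityʳ (f 0))))
                    ; (suc n) → ≡-sym (≡-trans (coeff-+ (const (f 0)) (q^ 1 * tail f) (suc n))
                      (≡-trans (ℤₚ.+-identityˡ _)
                        (≡-trans (coeff-* (q^ 1) (tail f) (suc n)) (qpow-⊛-+ 1 (tail f) n)))) }

    -- With the constant term split off, `dream` and `fermat` show that f ^ p obeys the recursion of
    -- f(q^p): the constant term plus q^p times the same expression for the tail.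
    frobenius : ∀ f → f ^ p ≈ dil p f
    frobenius = guarded q₀ tail {λ f → const (f 0)} (λ _ → refl)
      (λ f → trans (pow-cong p (split f)) (trans (dream (const (f 0)) (q^ 1) (tail f))
        (+-cong (fermat (f 0)) (*-cong q^p refl))))
      (Dil.unfold p)

  induction-ℤ : (P : ℤ → Set) → P (+ 0) → (∀ c → P c → P (c ℤ.+ + 1)) → (∀ c → P c → P (c ℤ.- + 1)) → ∀ c → P c
  induction-ℤ P z s d (+ zero)        = z
  induction-ℤ P z s d (+ suc n)       = subst P (cong +_ (ℕₚ.+-comm n 1)) (s (+ n) (induction-ℤ P z s d (+ n)))
  induction-ℤ P z s d -[1+ zero ]     = d (+ 0) z
  induction-ℤ P z s d -[1+ suc n ]    =
    subst P (cong -[1+_] (cong suc (ℕₚ.+-identityʳ n))) (d -[1+ n ] (induction-ℤ P z s d -[1+ n ]))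

  module _ where
    private
      module S₂ = SeriesMod (+ 2)
      module S₃ = SeriesMod (+ 3)

    dream₂ : ∀ c t g → (c + t * g) ^ 2 S₂.≈ c ^ 2 + t ^ 2 * g ^ 2
    dream₂ c t g = combine
      (solve 3 (λ c t g → (c :+ t :* g) :^ 2 := c :^ 2 :+ t :^ 2 :* g :^ 2 :+ c :* t :* g :* (:# 2 :- :# 0))
        refl c t g)
      ((c * t * g) ⊡ const-m≈0 (+ 2))
      where open S₂

    dream₃ : ∀ c t g → (c + t * g) ^ 3 S₃.≈ c ^ 3 + t ^ 3 * g ^ 3
    dream₃ c t g = combine
      (solve 3 (λ c t g → (c :+ t :* g) :^ 3 :=
        c :^ 3 :+ t :^ 3 :* g :^ 3 :+ (c :* t :* g :* (c :+ t :* g)) :* (:# 3 :- :# 0)) refl c t g)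
      ((c * t * g * (c + t * g)) ⊡ const-m≈0 (+ 3))
      where open S₃

    fermat₂ : ∀ c → const c ^ 2 S₂.≈ const c
    fermat₂ = induction-ℤ _
      (solve 0 (:# 0 :^ 2 := :# 0) refl)
      (λ c h → trans (pow-cong 2 (+-homo c (+ 1)))
        (trans (combine {z = # 1 * (const c ^ 2 - const c) + const c * (# 2 - # 0)}
         (solve 1 (λ c → (c :+ :# 1) :^ 2 := (c :+ :# 1) :+ (:# 1 :* (c :^ 2 :- c) :+ c :* (:# 2 :- :# 0))) refl
           (const c))
         (# 1 ⊡ h ⊞ const c ⊡ const-m≈0 (+ 2))) (sym (+-homo c (+ 1)))))
      (λ c h → trans (pow-cong 2 (+-homo c (ℤ.- + 1)))
        (trans (combine {z = # 1 * (const c ^ 2 - const c) + (# 1 - const c) * (# 2 - # 0)}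
         (solve 1 (λ c → (c :+ con (ℤ.- + 1)) :^ 2 :=
           (c :+ con (ℤ.- + 1)) :+ (:# 1 :* (c :^ 2 :- c) :+ (:# 1 :- c) :* (:# 2 :- :# 0))) refl (const c))
         (# 1 ⊡ h ⊞ (# 1 - const c) ⊡ const-m≈0 (+ 2))) (sym (+-homo c (ℤ.- + 1)))))
      where open S₂

    fermat₃ : ∀ c → const c ^ 3 S₃.≈ const c
    fermat₃ = induction-ℤ _
      (solve 0 (:# 0 :^ 3 := :# 0) refl)
      (λ c h → trans (pow-cong 3 (trans (+-homo c (+ 1)) (+-cong refl (sym (*-identityˡ _)))))
         (trans (dream₃ (const c) (# 1) (# 1))
           (trans (+-cong h (solve 0 (:# 1 :^ 3 :* :# 1 :^ 3 := :# 1) refl)) (sym (+-homo c (+ 1))))))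
      (λ c h → trans (pow-cong 3 (trans (+-homo c (ℤ.- + 1)) (+-cong refl (sym (*-identityˡ _)))))
         (trans (dream₃ (const c) (# 1) (const (ℤ.- + 1)))
           (trans (+-cong h (solve 0 (:# 1 :^ 3 :* con (ℤ.- + 1) :^ 3 := con (ℤ.- + 1)) refl))
           (sym (+-homo c (ℤ.- + 1))))))
      where open S₃

  frobenius₂ : ∀ f → Mod._≈_ (+ 2) (f ^ 2) (dil 2 f)
  frobenius₂ = Frobenius.frobenius 2 ≡-refl fermat₂ dream₂ (q^-^ (+ 2) 1 2)

  frobenius₃ : ∀ f → Mod._≈_ (+ 3) (f ^ 3) (dil 3 f)
  frobenius₃ = Frobenius.frobenius 3 ≡-refl fermat₃ dream₃ (q^-^ (+ 3) 1 3)

open Congruences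

-- Exponent classes modulo d.

module Projections where
  open SeriesRing
  open import Data.Integer.Divisibility.Signed using (_∣_)

  π : (d : ℕ) .{{_ : NonZero d}} → Series → Series
  π d f n = if (n % d) ≡ᵇ 0 then f n else + 0

  0%n≡0 : ∀ n .{{_ : NonZero n}} → 0 % n ≡ 0
  0%n≡0 (suc n) = ≡-refl

  %-+ˡ : ∀ {k r} d .{{_ : NonZero d}} l → k % d ≡ r → (k ℕ.+ l) % d ≡ (r ℕ.+ l % d) % d
  %-+ˡ {k} d l ≡-refl = %-distribˡ-+ k l d

  %-+0 : ∀ {k} d .{{_ : NonZero d}} l → k % d ≡ 0 → (k ℕ.+ l) % d ≡ l % d
  %-+0 {k} d l h = ≡-trans (%-+ˡ {k} d l h) (m%n%n≡m%n l d)

  module Support (m : ℤ) where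
    open SeriesMod m

    -- A grading by exponents modulo d, up to multiples of m: classes add under products, see
    -- `Supp-*`. The class r is compared with the reduced n % d, hence the reductions in the indices
    -- below.
    record Supp (d : ℕ) .{{_ : NonZero d}} (r : ℕ) (f : Series) : Set where
      constructor supp
      field off : ∀ n → n % d ≢ r → f n ∼ + 0
    open Supp public

    *-off : ∀ {f g : Series} n → (∀ k → k ≤ n → f k ℤ.* g (n ℕ.∸ k) ∼ + 0) → (f * g) n ∼ + 0
    *-off {f} {g} n h = ∼-trans (∼-reflexive (coeff-* f g n))
      (∼-trans (sumBelow-∼ (suc n) (λ { k (s≤s k≤n) → h k k≤n })) (∼-reflexive (sumBelow-zero (suc n))))

    ∼0-*ˡ : ∀ {x} y → x ∼ + 0 → x ℤ.* y ∼ + 0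
    ∼0-*ˡ y h = ∼-trans (∼-* h ∼-refl) (∼-reflexive (ℤₚ.*-zeroˡ y))

    ∼0-*ʳ : ∀ x {y} → y ∼ + 0 → x ℤ.* y ∼ + 0
    ∼0-*ʳ x h = ∼-trans (∼-* (∼-refl {x}) h) (∼-reflexive (ℤₚ.*-zeroʳ x))

    module _ {d : ℕ} .{{_ : NonZero d}} where

      Supp-cong : ∀ {r f g} → f ≈ g → Supp d r f → Supp d r g
      Supp-cong h s = supp λ n n≢r → ∼-trans (∼-sym (at h n)) (off s n n≢r)

      Supp-+ : ∀ {r f g} → Supp d r f → Supp d r g → Supp d r (f + g)
      Supp-+ {f = f} {g} s t = supp λ n n≢r → ∼-trans (∼-reflexive (coeff-+ f g n))
        (∼-+ (off s n n≢r) (off t n n≢r))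

      Supp-neg : ∀ {r f} → Supp d r f → Supp d r (- f)
      Supp-neg {f = f} s = supp λ n n≢r → ∼-trans (∼-reflexive (coeff-neg f n)) (∼-neg (off s n n≢r))

      Supp-* : ∀ {r s f g} → Supp d r f → Supp d s g → Supp d ((r ℕ.+ s) % d) (f * g)
      Supp-* {r} {s} {f} {g} p t = supp λ n n≢ → *-off {f} {g} n λ k k≤n → term n n≢ k k≤n
        where
        term : ∀ n → n % d ≢ (r ℕ.+ s) % d → ∀ k → k ≤ n → f k ℤ.* g (n ℕ.∸ k) ∼ + 0
        term n n≢ k k≤n with k % d ℕₚ.≟ r | (n ℕ.∸ k) % d ℕₚ.≟ s
        ... | no k≢r | _ = ∼0-*ˡ (g (n ℕ.∸ k)) (off p k k≢r)
        ... | yes _ | no l≢s = ∼0-*ʳ (f k) (off t (n ℕ.∸ k) l≢s)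
        ... | yes k≡r | yes l≡s = contradiction
          (≡-trans (cong (_% d) (≡-sym (ℕₚ.m+[n∸m]≡n k≤n)))
            (≡-trans (%-+ˡ {k} d (n ℕ.∸ k) k≡r) (cong (λ x → (r ℕ.+ x) % d) l≡s))) n≢

      Supp-const : ∀ c → Supp d 0 (const c)
      Supp-const c = supp λ { zero n≢0 → contradiction (0%n≡0 d) n≢0 ; (suc n) _ → ∼-refl }

      Supp-q^ : ∀ e → Supp d (e % d) (q^ e)
      Supp-q^ e = supp off-q^
        where
        off-q^ : ∀ n → n % d ≢ e % d → q^ e n ∼ + 0
        off-q^ n n≢e with n ≡ᵇ e in eq
        ... | false = ∼-refl
        ... | true = contradiction (cong (_% d) (ℕₚ.≡ᵇ⇒≡ n e (subst Bool.T (≡-sym eq) tt))) n≢e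

      Supp-^ : ∀ {r f} → Supp d r f → ∀ k → Supp d ((k ℕ.* r) % d) (f ^ k)
      Supp-^ s zero = subst (λ r → Supp d r (# 1)) (≡-sym (0%n≡0 d)) (Supp-const (+ 1))
      Supp-^ {r} {f} s (suc k) = subst (λ x → Supp d x (f ^ suc k))
        (≡-trans (%-distribˡ-+ r (k ℕ.* r % d) d)
          (≡-trans (cong (λ x → (r % d ℕ.+ x) % d) (m%n%n≡m%n (k ℕ.* r) d))
          (≡-sym (%-distribˡ-+ r (k ℕ.* r) d))))
        (Supp-* {f = f} {f ^ k} s (Supp-^ s k))

      Supp-dil : ∀ f → Supp d 0 (dil d f)
      Supp-dil f = supp off-dil
        where
        off-dil : ∀ n → n % d ≢ 0 → dil d f n ∼ + 0
        off-dil n n≢0 with n % d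
        ... | zero  = contradiction ≡-refl n≢0
        ... | suc _ = ∼-refl

      π-cong : ∀ {f g} → f ≈ g → π d f ≈ π d g
      π-cong {f} {g} h = mk eq
        where
        eq : ∀ n → π d f n ∼ π d g n
        eq n with (n % d) ≡ᵇ 0
        ... | true  = at h n
        ... | false = ∼-refl

      π-+ : ∀ f g → π d (f + g) ≈ π d f + π d g
      π-+ f g = mk λ n → ∼-trans (eq n) (∼-sym (∼-reflexive (coeff-+ (π d f) (π d g) n)))
        where
        eq : ∀ n → π d (f + g) n ∼ π d f n ℤ.+ π d g n
        eq n with (n % d) ≡ᵇ 0
        ... | true  = ∼-reflexive (coeff-+ f g n)
        ... | false = ∼-refl

      π-id : ∀ {f} → Supp d 0 f → π d f ≈ f
      π-id {f} s = mk eq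
        where
        eq : ∀ n → π d f n ∼ f n
        eq n with n % d in e
        ... | zero  = ∼-refl
        ... | suc _ = ∼-sym (off s n (λ h → contradiction (≡-trans (≡-sym e) h) λ ()))

      π-kill : ∀ {f} r → Supp d (suc r) f → π d f ≈ # 0
      π-kill {f} r s = mk λ n → ∼-trans (eq n) (∼-reflexive (≡-sym (const0≡0 n)))
        where
        eq : ∀ n → π d f n ∼ + 0
        eq n with n % d in e
        ... | zero  = off s n (λ h → contradiction (≡-trans (≡-sym e) h) λ ())
        ... | suc _ = ∼-refl

      Supp-π : ∀ f → Supp d 0 (π d f)
      Supp-π f = supp off-π
        where
        off-π : ∀ n → n % d ≢ 0 → π d f n ∼ + 0
        off-π n n≢0 with n % d
        ... | zero  = contradiction ≡-refl n≢0
        ... | suc _ = ∼-refl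

      -- If d divides k, then n and n - k lie in the same class, so a factor in q^d passes through
      -- the projection.
      π-* : ∀ {f} → Supp d 0 f → ∀ g → π d (f * g) ≈ f * π d g
      π-* {f} s g = mk λ n → ∼-trans (left n) (∼-trans (sumBelow-∼ (suc n) (λ { k (s≤s k≤n) → term n k k≤n }))
                                  (∼-sym (∼-reflexive (coeff-* f (π d g) n))))
        where
        left : ∀ n → π d (f * g) n ∼ sumBelow (suc n) (λ k → if (n % d) ≡ᵇ 0 then f k ℤ.* g (n ℕ.∸ k) else + 0)
        left n with (n % d) ≡ᵇ 0
        ... | true  = ∼-reflexive (coeff-* f g n)
        ... | false = ∼-sym (∼-reflexive (sumBelow-zero (suc n)))
        if-∼0 : ∀ b {x} → x ∼ + 0 → (if b then x else + 0) ∼ + 0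
        if-∼0 true  h = h
        if-∼0 false h = ∼-refl
        if-* : ∀ b x y → (if b then x ℤ.* y else + 0) ∼ x ℤ.* (if b then y else + 0)
        if-* true  x y = ∼-refl
        if-* false x y = ∼-sym (∼-reflexive (ℤₚ.*-zeroʳ x))
        term : ∀ n k → k ≤ n → (if (n % d) ≡ᵇ 0 then f k ℤ.* g (n ℕ.∸ k) else + 0) ∼ f k ℤ.* π d g (n ℕ.∸ k)
        term n k k≤n with k % d ℕₚ.≟ 0
        ... | no k≢0 = ∼-trans (if-∼0 ((n % d) ≡ᵇ 0) (∼0-*ˡ _ (off s k k≢0))) (∼-sym (∼0-*ˡ _ (off s k k≢0)))
        ... | yes k≡0 = subst (λ r → (if r ≡ᵇ 0 then f k ℤ.* g (n ℕ.∸ k) else + 0) ∼ f k ℤ.* π d g (n ℕ.∸ k))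
          (≡-sym (≡-trans (cong (_% d) (≡-sym (ℕₚ.m+[n∸m]≡n k≤n))) (%-+0 {k} d (n ℕ.∸ k) k≡0)))
          (if-* (((n ℕ.∸ k) % d) ≡ᵇ 0) (f k) (g (n ℕ.∸ k)))

      -- f * π d (inv f) = π d (f * inv f) = 1, so inv f equals its own projection.
      Supp-inv : ∀ {f} → f 0 ≡ + 1 → Supp d 0 f → Supp d 0 (inv f)
      Supp-inv {f} f0 s = Supp-cong
        (inv-unique f0 (trans (sym (π-* s (inv f))) (trans (π-cong (*-inv f f0)) (π-id (Supp-const (+ 1))))))
        (Supp-π (inv f))

    off-∣ : ∀ {d} .{{_ : NonZero d}} {r f} → Supp d r f → ∀ n → n % d ≢ r → m ∣ f n
    off-∣ s n n≢r = ∼0⇒∣ (off s n n≢r)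

open Projections

-- Infinite products, their splitting into classes, and their norms under q ↦ -q.

module InfiniteProducts where
  open SeriesRing

  open SeriesMod (+ 0)
  open Substitutions (+ 0)

  ∏ : ℕ → (ℕ → Series) → Series
  ∏ zero    F = # 1
  ∏ (suc n) F = ∏ n F * F n

  prodBelow≡∏ : ∀ n F → prodBelow n F ≡ ∏ n F
  prodBelow≡∏ zero    F = ≡-refl
  prodBelow≡∏ (suc n) F = ≡-trans (cong (_⊛ F n) (prodBelow≡∏ n F)) (cong (λ op → op (∏ n F) (F n)) (≡-sym *≡⊛))

  ∏-cong : ∀ n {F G} → (∀ k → k < n → F k ≈ G k) → ∏ n F ≈ ∏ n G
  ∏-cong zero    h = refl
  ∏-cong (suc n) h = *-cong (∏-cong n (λ k k<n → h k (ℕₚ.m<n⇒m<1+n k<n))) (h n ℕₚ.≤-refl)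

  ∏-* : ∀ n F G → ∏ n (λ k → F k * G k) ≈ ∏ n F * ∏ n G
  ∏-* zero    F G = solve 0 (:# 1 := :# 1 :* :# 1) refl
  ∏-* (suc n) F G = trans (*-cong (∏-* n F G) refl)
    (solve 4 (λ a b c d → a :* b :* (c :* d) := a :* c :* (b :* d)) refl (∏ n F) (∏ n G) (F n) (G n))

  ∏-one : ∀ n → ∏ n (λ _ → # 1) ≈ # 1
  ∏-one zero    = refl
  ∏-one (suc n) = trans (*-identityʳ _) (∏-one n)

  ∏-+ : ∀ m n F → ∏ (m ℕ.+ n) F ≈ ∏ m F * ∏ n (λ i → F (m ℕ.+ i))
  ∏-+ m zero    F = trans (reflexive (cong (λ k → ∏ k F) (ℕₚ.+-identityʳ m))) (sym (*-identityʳ _))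
  ∏-+ m (suc n) F = trans (reflexive (cong (λ k → ∏ k F) (ℕₚ.+-suc m n)))
    (trans (*-cong (∏-+ m n F) refl) (*-assoc _ _ _))

  ∏-block : ∀ M d F → ∏ (M ℕ.* d) F ≈ ∏ M (λ k → ∏ d (λ i → F (k ℕ.* d ℕ.+ i)))
  ∏-block zero    d F = refl
  ∏-block (suc M) d F = trans (reflexive (cong (λ k → ∏ k F) (ℕₚ.+-comm d (M ℕ.* d))))
    (trans (∏-+ (M ℕ.* d) d F) (*-cong (∏-block M d F) refl))

  ∏-swap : ∀ M d (G : ℕ → ℕ → Series) → ∏ M (λ k → ∏ d (G k)) ≈ ∏ d (λ i → ∏ M (λ k → G k i))
  ∏-swap zero    d G = sym (∏-one d)
  ∏-swap (suc M) d G = trans (*-cong (∏-swap M d G) refl) (sym (∏-* d (λ i → ∏ M (λ k → G k i)) (G M)))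

  infix 4 _≡[≤_]_

  _≡[≤_]_ : Series → ℕ → Series → Set
  f ≡[≤ N ] g = ∀ n → n ≤ N → f n ≡ g n

  *-≡≤ : ∀ {N f f′ g g′} → f ≡[≤ N ] f′ → g ≡[≤ N ] g′ → (f * g) ≡[≤ N ] (f′ * g′)
  *-≡≤ {N} {f} {f′} {g} {g′} p r n n≤N = ≡-trans (coeff-* f g n)
    (≡-trans (⊛-cong≤ n {f} {f′} {g} {g′} (λ k k≤n → p k (ℕₚ.≤-trans k≤n n≤N))
      (λ k k≤n → r k (ℕₚ.≤-trans k≤n n≤N)))
      (≡-sym (coeff-* f′ g′ n)))

  ∏-≡≤ : ∀ {N} d {F G : ℕ → Series} → (∀ i → F i ≡[≤ N ] G i) → ∏ d F ≡[≤ N ] ∏ d G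
  ∏-≡≤ zero    h n _ = ≡-refl
  ∏-≡≤ {N} (suc d) {F} {G} h = *-≡≤ {N} {∏ d F} {∏ d G} (∏-≡≤ d h) (h d)

  Admissible : (ℕ → Series) → Set
  Admissible F = ∀ k → F k ≡[≤ k ] # 1

  ∏-stable : ∀ {F} → Admissible F → ∀ n M → n ≤ M → ∏ M F n ≡ infProd F n
  ∏-stable {F} adm n M n≤M with ℕₚ.m≤n⇒∃[o]m+o≡n n≤M
  ... | j , ≡-refl = ≡-trans (≡-trans (go j) (≡-sym (step n ℕₚ.≤-refl)))
                       (≡-sym (cong (λ f → f n) (prodBelow≡∏ (suc n) F)))
    where
    step : ∀ M → n ≤ M → ∏ (suc M) F n ≡ ∏ M F n
    step M n≤M = ≡-trans (*-≡≤ {M} {∏ M F} {∏ M F} {F M} {# 1} (λ _ _ → ≡-refl) (adm M) n n≤M)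
      (exact-≡ (*-identityʳ (∏ M F)) n)
    go : ∀ j → ∏ (n ℕ.+ j) F n ≡ ∏ n F n
    go zero    = cong (λ k → ∏ k F n) (ℕₚ.+-identityʳ n)
    go (suc j) = ≡-trans (cong (λ k → ∏ k F n) (ℕₚ.+-suc n j)) (≡-trans (step (n ℕ.+ j) (ℕₚ.m≤m+n n j)) (go j))

  infProd-≡≤ : ∀ {F} → Admissible F → ∀ M → infProd F ≡[≤ M ] ∏ M F
  infProd-≡≤ adm M n n≤M = ≡-sym (∏-stable adm n M n≤M)

  infProd-cong : ∀ {F G} → (∀ k → F k ≈ G k) → infProd F ≈ infProd G
  infProd-cong {F} {G} h = ≗⇒≈ λ n → ≡-trans (cong (λ f → f n) (prodBelow≡∏ (suc n) F))
    (≡-trans (exact-≡ (∏-cong (suc n) (λ k _ → h k)) n) (≡-sym (cong (λ f → f n) (prodBelow≡∏ (suc n) G))))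

  infProd-* : ∀ {F G} → Admissible F → Admissible G → infProd (λ k → F k * G k) ≈ infProd F * infProd G
  infProd-* {F} {G} aF aG = ≗⇒≈ λ n → ≡-trans (cong (λ f → f n) (prodBelow≡∏ (suc n) _))
    (≡-trans (exact-≡ (∏-* (suc n) F G) n)
      (*-≡≤ {n} {∏ (suc n) F} {infProd F} {∏ (suc n) G} {infProd G}
        (λ k k≤n → ∏-stable aF k (suc n) (ℕₚ.m≤n⇒m≤1+n k≤n))
        (λ k k≤n → ∏-stable aG k (suc n) (ℕₚ.m≤n⇒m≤1+n k≤n)) n ℕₚ.≤-refl))

  -- For coefficient n the first n d factors are arranged in n rows of length d and multiplied by
  -- columns; each column then has n factors, enough for its own coefficient n.
  infProd-split : ∀ d .{{_ : NonZero d}} {F} → Admissible F →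
                  infProd F ≈ ∏ d (λ i → infProd (λ k → F (k ℕ.* d ℕ.+ i)))
  infProd-split d {F} adm = ≗⇒≈ λ n →
    ≡-trans (≡-sym (∏-stable adm n (n ℕ.* d) (n≤nd n)))
      (≡-trans (exact-≡ (trans (∏-block n d F) (∏-swap n d (λ k i → F (k ℕ.* d ℕ.+ i)))) n)
        (∏-≡≤ {n} d (λ i k k≤n → ∏-stable (adm′ i) k n k≤n) n ℕₚ.≤-refl))
    where
    n≤nd : ∀ n → n ≤ n ℕ.* d
    n≤nd n = ℕₚ.m≤m*n n d
    adm′ : ∀ i → Admissible (λ k → F (k ℕ.* d ℕ.+ i))
    adm′ i k n n≤k = adm (k ℕ.* d ℕ.+ i) n (ℕₚ.≤-trans n≤k (ℕₚ.≤-trans (n≤nd k) (ℕₚ.m≤m+n (k ℕ.* d) i)))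

  -- Substitutions commute with finite products; locality lets a finite truncation stand for
  -- `infProd`, one coefficient at a time.
  Local : (Series → Series) → Set
  Local τ = ∀ {f g} N → f ≡[≤ N ] g → τ f ≡[≤ N ] τ g

  dil-local : ∀ d .{{_ : NonZero d}} → Local (dil d)
  dil-local d {f} {g} N h n n≤N with (n % d) ≡ᵇ 0
  ... | true  = h (n / d) (ℕₚ.≤-trans (m/n≤m n d) n≤N)
  ... | false = ≡-refl

  σ-local : Local σ
  σ-local {f} {g} N h n n≤N = go f g n (λ k k≤n → h k (ℕₚ.≤-trans k≤n n≤N))
    where
    go : ∀ f g n → f ≡[≤ n ] g → σ f n ≡ σ g n
    go f g zero    h = h 0 z≤n
    go f g (suc n) h = cong ℤ.-_ (go (tail f) (tail g) n (λ k k≤n → h (suc k) (s≤s k≤n)))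

  module _ {t τ} (S : IsSubst t τ) where
    open IsSubst S

    τ-∏ : ∀ n F → τ (∏ n F) ≈ ∏ n (λ k → τ (F k))
    τ-∏ zero    F = τ-const (+ 1)
    τ-∏ (suc n) F = trans (τ-* (∏ n F) (F n)) (*-cong (τ-∏ n F) refl)

    τ-infProd : Local τ → ∀ {F} → Admissible F → τ (infProd F) ≈ infProd (λ k → τ (F k))
    τ-infProd loc {F} adm = ≗⇒≈ λ n →
      ≡-trans (loc (suc n) (infProd-≡≤ adm (suc n)) n (ℕₚ.n≤1+n n))
        (≡-trans (exact-≡ (τ-∏ (suc n) F) n) (≡-sym (cong (λ f → f n) (prodBelow≡∏ (suc n) _))))

    τ-admissible : Local τ → ∀ {F} → Admissible F → Admissible (λ k → τ (F k))
    τ-admissible loc adm k n n≤k = ≡-trans (loc k (adm k) n n≤k) (exact-≡ (τ-const (+ 1)) n)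

  factor : ℕ → Series
  factor e = # 1 - q^ e

  factor-≡≤ : ∀ {N} e → N < e → factor e ≡[≤ N ] # 1
  factor-≡≤ {N} e N<e n n≤N = ≡-trans (coeff-+ (# 1) (- q^ e) n)
    (≡-trans (cong (λ x → const (+ 1) n ℤ.+ x) (≡-trans (coeff-neg (q^ e) n) (cong ℤ.-_ vanish)))
      (ℤₚ.+-identityʳ _))
    where
    vanish : q^ e n ≡ + 0
    vanish with n ≡ᵇ e in eq
    ... | false = ≡-refl
    ... | true  = contradiction (≡-sym (ℕₚ.≡ᵇ⇒≡ n e (subst Bool.T (≡-sym eq) tt)))
      (ℕₚ.>⇒≢ (ℕₚ.≤-<-trans n≤N N<e))

  pochFactor-admissible : ∀ a b .{{_ : NonZero a}} .{{_ : NonZero b}} →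
    Admissible (λ k → factor (a ℕ.+ b ℕ.* k))
  pochFactor-admissible a@(suc a′) b@(suc _) k = factor-≡≤ {k} (a ℕ.+ b ℕ.* k)
    (s≤s (ℕₚ.≤-trans (ℕₚ.m≤m+n k _) (ℕₚ.m≤n+m (b ℕ.* k) a′)))

  poch≈ : ∀ a b → poch a b ≈ infProd (λ k → factor (a ℕ.+ b ℕ.* k))
  poch≈ a b = infProd-cong (λ k → reflexive (one⊖-≡ (q^ (a ℕ.+ b ℕ.* k))))

  poch-0 : ∀ a b .{{_ : NonZero a}} .{{_ : NonZero b}} → poch a b 0 ≡ + 1
  poch-0 a b = ≡-trans (exact-≡ (poch≈ a b) 0) (≡-sym (∏-stable (pochFactor-admissible a b) 0 0 z≤n))

  dil-poch : ∀ d a b .{{_ : NonZero d}} .{{_ : NonZero a}} .{{_ : NonZero b}} → dil d (poch a b)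
    ≈ poch (a ℕ.* d) (b ℕ.* d)
  dil-poch d a b = trans (Dil.τ-cong d (poch≈ a b))
    (trans (τ-infProd (dil-isSubst d) (dil-local d) (pochFactor-admissible a b))
    (trans (infProd-cong factors) (sym (poch≈ (a ℕ.* d) (b ℕ.* d)))))
    where
    exponent : ∀ a b k d → (a ℕ.+ b ℕ.* k) ℕ.* d ≡ a ℕ.* d ℕ.+ b ℕ.* d ℕ.* k
    exponent = solve-∀ℕ
    factors : ∀ k → dil d (factor (a ℕ.+ b ℕ.* k)) ≈ factor (a ℕ.* d ℕ.+ b ℕ.* d ℕ.* k)
    factors k = trans (Dil.τ-+ d _ _) (+-cong (Dil.τ-const d (+ 1)) (trans (Dil.τ-neg d _)
      (-‿cong (trans (dil-q^ d (a ℕ.+ b ℕ.* k)) (reflexive (cong q^ (exponent a b k d)))))))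

  poch-split : ∀ d a b .{{_ : NonZero d}} .{{_ : NonZero a}} .{{_ : NonZero b}} →
               poch a b ≈ ∏ d (λ i → poch (a ℕ.+ b ℕ.* i) (b ℕ.* d))
  poch-split d a b = trans (poch≈ a b) (trans (infProd-split d (pochFactor-admissible a b))
    (∏-cong d (λ i _ → trans (infProd-cong (λ k → reflexive (cong factor (exponent a b i k d))))
      (sym (poch≈ (a ℕ.+ b ℕ.* i) (b ℕ.* d))))))
    where
    exponent : ∀ a b i k d → a ℕ.+ b ℕ.* (k ℕ.* d ℕ.+ i) ≡ a ℕ.+ b ℕ.* i ℕ.+ b ℕ.* d ℕ.* k
    exponent = solve-∀ℕ

  σ-dil2 : ∀ f → σ (dil 2 f) ≈ dil 2 f
  σ-dil2 = guarded {t = q^ 2} ≡-refl tail {λ f → const (f 0)} (λ _ → refl)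
    (λ f → trans (Sigma.τ-cong (Dil.unfold 2 f)) (trans (Sigma.τ-+ (const (f 0)) _)
      (+-cong (Sigma.τ-const (f 0)) (trans (Sigma.τ-* (q^ 2) _)
        (*-cong (trans (Sigma.τ-q^ 2)
          (trans (solve 1 (λ q → (:- q) :^ 2 := q :* q) refl (q^ 1)) (sym (q^-+ (+ 0) 1 1)))) refl)))))
    (Dil.unfold 2)

  σ-odd-q^ : ∀ j → σ (q^ (suc (j ℕ.* 2))) ≈ - q^ (suc (j ℕ.* 2))
  σ-odd-q^ j = trans (Sigma.τ-cong (q^-+ (+ 0) 1 (j ℕ.* 2))) (trans (Sigma.τ-* (q^ 1) _)
    (trans (*-cong (trans (Sigma.τ-q^ 1) (*-identityʳ _))
      (trans (Sigma.τ-cong (sym (dil-q^ 2 j))) (trans (σ-dil2 (q^ j)) (dil-q^ 2 j))))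
      (trans (solve 2 (λ q x → :- q :* x := :- (q :* x)) refl (q^ 1) (q^ (j ℕ.* 2)))
        (-‿cong (sym (q^-+ (+ 0) 1 (j ℕ.* 2)))))))

  -- ∏ (1 - q^e) (1 + q^e) = ∏ (1 - q^2e) over odd exponents e
  poch-odd-norm : ∀ a b .{{_ : NonZero b}} → poch (suc (a ℕ.* 2)) (b ℕ.* 2) * σ (poch (suc (a ℕ.* 2)) (b ℕ.* 2))
    ≈ dil 2 (poch (suc (a ℕ.* 2)) (b ℕ.* 2))
  poch-odd-norm a b@(suc _) =
    trans (*-cong poch≈ₒ (trans (Sigma.τ-cong poch≈ₒ) (τ-infProd σ-isSubst σ-local adm)))
    (trans (sym (infProd-* adm (τ-admissible σ-isSubst σ-local adm)))
      (trans (infProd-cong factors)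
        (sym (trans (Dil.τ-cong 2 poch≈ₒ) (τ-infProd (dil-isSubst 2) (dil-local 2) adm)))))
    where
    poch≈ₒ : poch (suc (a ℕ.* 2)) (b ℕ.* 2) ≈ infProd (λ k → factor (suc (a ℕ.* 2) ℕ.+ b ℕ.* 2 ℕ.* k))
    poch≈ₒ = poch≈ (suc (a ℕ.* 2)) (b ℕ.* 2)
    e : ℕ → ℕ
    e k = suc (a ℕ.* 2) ℕ.+ b ℕ.* 2 ℕ.* k
    adm : Admissible (λ k → factor (e k))
    adm = pochFactor-admissible (suc (a ℕ.* 2)) (b ℕ.* 2)
    odd : ∀ a b k → suc (a ℕ.* 2) ℕ.+ b ℕ.* 2 ℕ.* k ≡ suc ((a ℕ.+ b ℕ.* k) ℕ.* 2)
    odd = solve-∀ℕ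
    σ-q^e : ∀ k → σ (q^ (e k)) ≈ - q^ (e k)
    σ-q^e k = subst (λ n → σ (q^ n) ≈ - q^ n) (≡-sym (odd a b k)) (σ-odd-q^ (a ℕ.+ b ℕ.* k))
    double : ∀ n → n ℕ.* 2 ≡ n ℕ.+ n
    double = solve-∀ℕ
    factors : ∀ k → factor (e k) * σ (factor (e k)) ≈ dil 2 (factor (e k))
    factors k = trans
      (*-cong refl (trans (Sigma.τ-+ (# 1) (- q^ (e k)))
        (+-cong (Sigma.τ-const (+ 1)) (trans (Sigma.τ-neg (q^ (e k))) (-‿cong (σ-q^e k))))))
      (trans (solve 1 (λ x → (:# 1 :- x) :* (:# 1 :+ :- (:- x)) := :# 1 :- x :* x) refl (q^ (e k)))
        (sym (trans (Dil.τ-+ 2 (# 1) (- q^ (e k))) (+-cong (Dil.τ-const 2 (+ 1)) (trans (Dil.τ-neg 2 (q^ (e k)))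
          (-‿cong (trans (dil-q^ 2 (e k))
            (trans (reflexive (cong q^ (double (e k)))) (q^-+ (+ 0) (e k) (e k))))))))))

  -- From f = o c(q²) follows f(q) f(-q) = o(q) o(-q) c(q²)² = o(q²) c(q²)², and o(q²) =
  -- f(q²)/c(q⁴).
  norm₂ : ∀ {f o c} → f ≈ o * dil 2 c → o * σ o ≈ dil 2 o → f * σ f * dil 2 (dil 2 c) ≈ dil 2 f * dil 2 c ^ 2
  norm₂ {f} {o} {c} hf ho = trans
    (*-cong (*-cong hf (trans (Sigma.τ-cong hf) (trans (Sigma.τ-* o (dil 2 c)) (*-cong refl (σ-dil2 c))))) refl)
    (trans (solve 4 (λ o s c c′ → o :* c :* (s :* c) :* c′ := o :* s :* c′ :* c :^ 2) refl o (σ o) (dil 2 c)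
      (dil 2 (dil 2 c)))
      (*-cong (trans (*-cong ho refl) (trans (sym (Dil.τ-* 2 o (dil 2 c))) (Dil.τ-cong 2 (sym hf)))) refl))

open InfiniteProducts

-- Gaussian binomial coefficients and the finite q-binomial theorem.

module QBinomials where
  open SeriesRing

  open SeriesMod (+ 0)

  ^-+ : ∀ f m n → f ^ (m ℕ.+ n) ≈ f ^ m * f ^ n
  ^-+ f zero    n = sym (*-identityˡ (f ^ n))
  ^-+ f (suc m) n = trans (*-cong refl (^-+ f m n)) (sym (*-assoc f (f ^ m) (f ^ n)))

  ^-distrib-* : ∀ f g n → (f * g) ^ n ≈ f ^ n * g ^ n
  ^-distrib-* f g zero    = sym (*-identityˡ (# 1))
  ^-distrib-* f g (suc n) = trans (*-cong refl (^-distrib-* f g n))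
    (solve 4 (λ f g x y → f :* g :* (x :* y) := f :* x :* (g :* y)) refl f g (f ^ n) (g ^ n))

  ^-^ : ∀ f m n → (f ^ m) ^ n ≈ f ^ (n ℕ.* m)
  ^-^ f m zero    = refl
  ^-^ f m (suc n) = trans (*-cong refl (^-^ f m n)) (sym (^-+ f m (n ℕ.* m)))

  ∏-head : ∀ n F → ∏ (suc n) F ≈ F 0 * ∏ n (λ k → F (suc k))
  ∏-head n F = trans (∏-+ 1 n F) (*-cong (*-identityˡ (F 0)) refl)

  ∏-scale : ∀ n c F → ∏ n (λ k → c * F k) ≈ c ^ n * ∏ n F
  ∏-scale zero    c F = sym (*-identityˡ (# 1))
  ∏-scale (suc n) c F = trans (*-cong (∏-scale n c F) refl)
    (solve 4 (λ x p c f → x :* p :* (c :* f) := c :* x :* (p :* f)) refl (c ^ n) (∏ n F) c (F n))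

  -- Σ_{j + l = n} H j l
  diag : ℕ → (ℕ → ℕ → Series) → Series
  diag zero    H = H 0 0
  diag (suc n) H = H 0 (suc n) + diag n (λ j l → H (suc j) l)

  diag-last : ∀ n H → diag (suc n) H ≈ diag n (λ j l → H j (suc l)) + H (suc n) 0
  diag-last zero    H = refl
  diag-last (suc n) H = trans (+-cong refl (diag-last n (λ j l → H (suc j) l))) (sym (+-assoc _ _ _))

  diag-+ : ∀ n G H → diag n (λ j l → G j l + H j l) ≈ diag n G + diag n H
  diag-+ zero    G H = refl
  diag-+ (suc n) G H = trans (+-cong refl (diag-+ n _ _))
    (solve 4 (λ a b c d → a :+ b :+ (c :+ d) := a :+ c :+ (b :+ d)) refl (G 0 (suc n)) (H 0 (suc n)) _ _)

  diag-*ˡ : ∀ n c H → diag n (λ j l → c * H j l) ≈ c * diag n H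
  diag-*ˡ zero    c H = refl
  diag-*ˡ (suc n) c H = trans (+-cong refl (diag-*ˡ n c _)) (sym (distribˡ c _ _))

  diag-cong : ∀ n {G H} → (∀ j l → G j l ≈ H j l) → diag n G ≈ diag n H
  diag-cong zero    h = h 0 0
  diag-cong (suc n) h = +-cong (h 0 (suc n)) (diag-cong n (λ j l → h (suc j) l))

  module _ (W U V : ℕ → ℕ → Series)
           (left  : ∀ l → W 0 (suc l) ≈ U 0 l)
           (right : ∀ j → W (suc j) 0 ≈ V j 0)
           (inner : ∀ j l → W (suc j) (suc l) ≈ V j (suc l) + U (suc j) l) where

    -- An index pair on diagonal n + 1 arises from diagonal n by raising l, which contributes U, or
    -- by raising j, which contributes V; the two end points arise in one way only.
    diag-pascal : ∀ n → diag (suc n) W ≈ diag n U + diag n V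
    diag-pascal zero = +-cong (left 0) (right 0)
    diag-pascal (suc n) = trans
      (+-cong (left (suc n)) (trans (diag-last n (λ j l → W (suc j) l))
        (+-cong (trans (diag-cong n inner) (diag-+ n _ _)) (right (suc n)))))
      (trans (solve 4 (λ a b c d → a :+ (b :+ c :+ d) := a :+ c :+ (b :+ d)) refl (U 0 (suc n))
        (diag n (λ j l → V j (suc l))) (diag n (λ j l → U (suc j) l)) (V (suc n) 0))
        (+-cong refl (sym (diag-last n V))))

  -- The number n(n - 1)/2, by recursion to avoid division.
  tri : ℕ → ℕ
  tri zero    = 0
  tri (suc n) = tri n ℕ.+ n

  tri-+ : ∀ m n → tri (m ℕ.+ n) ≡ tri m ℕ.+ tri n ℕ.+ m ℕ.* n
  tri-+ m zero = ≡-trans (cong tri (ℕₚ.+-identityʳ m)) (lemma (tri m) m)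
    where
    lemma : ∀ t m → t ≡ t ℕ.+ 0 ℕ.+ m ℕ.* 0
    lemma = solve-∀ℕ
  tri-+ m (suc n) = ≡-trans (cong tri (ℕₚ.+-suc m n))
    (≡-trans (cong (ℕ._+ (m ℕ.+ n)) (tri-+ m n)) (lemma (tri m) (tri n) m n))
    where
    lemma : ∀ s t m n → s ℕ.+ t ℕ.+ m ℕ.* n ℕ.+ (m ℕ.+ n) ≡ s ℕ.+ (t ℕ.+ n) ℕ.+ m ℕ.* suc n
    lemma = solve-∀ℕ

  2tri : ∀ n → tri n ℕ.+ tri n ℕ.+ n ≡ n ℕ.* n
  2tri zero    = ≡-refl
  2tri (suc n) = ≡-trans (lemma (tri n) n) (≡-trans (cong (λ x → x ℕ.+ n ℕ.+ n ℕ.+ 1) (2tri n)) (lemma′ n))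
    where
    lemma : ∀ t n → t ℕ.+ n ℕ.+ (t ℕ.+ n) ℕ.+ suc n ≡ t ℕ.+ t ℕ.+ n ℕ.+ n ℕ.+ n ℕ.+ 1
    lemma = solve-∀ℕ
    lemma′ : ∀ n → n ℕ.* n ℕ.+ n ℕ.+ n ℕ.+ 1 ≡ suc n ℕ.* suc n
    lemma′ = solve-∀ℕ

  module QBinomial (Q : Series) (Q0 : Q 0 ≡ + 0) where

    pochQ : ℕ → Series
    pochQ n = ∏ n (λ k → # 1 - Q ^ suc k)

    1-Q^-0 : ∀ k → (# 1 - Q ^ suc k) 0 ≡ + 1
    1-Q^-0 k = +-0 {# 1} ≡-refl (neg-0 {Q ^ suc k} (*-0ˡ {Q} (Q ^ k) Q0))

    pochQ-0 : ∀ n → pochQ n 0 ≡ + 1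
    pochQ-0 zero    = ≡-refl
    pochQ-0 (suc n) = *-0 {pochQ n} (pochQ-0 n) (1-Q^-0 n)

    -- The Gaussian binomial coefficient of i + l over i in base Q, indexed by both parts to suit
    -- `diag`.
    h : ℕ → ℕ → Series
    h i l = pochQ (i ℕ.+ l) * inv (pochQ i * pochQ l)

    h-spec : ∀ i l → pochQ i * pochQ l * h i l ≈ pochQ (i ℕ.+ l)
    h-spec i l = trans (solve 3 (λ a b c → a :* (b :* c) := b :* (a :* c)) refl (pochQ i * pochQ l)
      (pochQ (i ℕ.+ l)) (inv (pochQ i * pochQ l)))
      (trans (*-cong refl (*-inv _ (*-0 {pochQ i} (pochQ-0 i) (pochQ-0 l)))) (*-identityʳ _))

    h-0ˡ : ∀ l → h 0 l ≈ # 1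
    h-0ˡ l = cancelˡ {pochQ 0 * pochQ l} (*-0 {pochQ 0} ≡-refl (pochQ-0 l))
      (trans (h-spec 0 l) (solve 1 (λ x → x := :# 1 :* x :* :# 1) refl (pochQ l)))

    h-0ʳ : ∀ i → h i 0 ≈ # 1
    h-0ʳ i = cancelˡ {pochQ i * pochQ 0} (*-0 {pochQ i} (pochQ-0 i) ≡-refl)
      (trans (h-spec i 0) (trans (reflexive (cong pochQ (ℕₚ.+-identityʳ i)))
        (solve 1 (λ x → x := x :* :# 1 :* :# 1) refl (pochQ i))))

    -- Cleared of denominators, this is 1 - Q^(i+l+2) = (1 - Q^(i+1)) + Q^(i+1) (1 - Q^(l+1)).
    h-pascal : ∀ i l → h (suc i) (suc l) ≈ h i (suc l) + Q ^ suc i * h (suc i) l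
    h-pascal i l = cancelˡ {pochQ (suc i) * pochQ (suc l)}
      (*-0 {pochQ (suc i)} (pochQ-0 (suc i)) (pochQ-0 (suc l)))
      (combine
        (solve 9 (λ A B x y T z H H₁ H₂ →
            A :* (:# 1 :- x) :* (B :* (:# 1 :- y)) :* H :=
            A :* (:# 1 :- x) :* (B :* (:# 1 :- y)) :* (H₁ :+ x :* H₂) :+
            (:# 1 :* (A :* (:# 1 :- x) :* (B :* (:# 1 :- y)) :* H :- T :* (:# 1 :- z))
             :+ (x :- :# 1) :* (A :* (B :* (:# 1 :- y)) :* H₁ :- T)
             :+ (:- x) :* (:# 1 :- y) :* (A :* (:# 1 :- x) :* B :* H₂ :- T)
             :+ (:- T) :* (z :- x :* y)))
          refl (pochQ i) (pochQ l) (Q ^ suc i) (Q ^ suc l) T (Q ^ suc (i ℕ.+ suc l)) (h (suc i) (suc l))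
            (h i (suc l)) (h (suc i) l))
        (# 1 ⊡ h-spec (suc i) (suc l) ⊞ (Q ^ suc i - # 1) ⊡ h-spec i (suc l)
          ⊞ (- Q ^ suc i * (# 1 - Q ^ suc l)) ⊡ trans (h-spec (suc i) l)
            (reflexive (cong pochQ (≡-sym (ℕₚ.+-suc i l))))
          ⊞ (- T) ⊡ ^-+ Q (suc i) (suc l)))
      where
      T = pochQ (i ℕ.+ suc l)

    term : Series → Series → ℕ → ℕ → Series
    term x y j l = h j l * (Q ^ tri j * (- y) ^ j * x ^ l)

    -- The factor k = 0 is split off and the remaining product is the one for n with y Q in place of
    -- y; the two terms of x - y then produce the two halves of Pascal's rule.
    q-binomial : ∀ n x y → ∏ n (λ k → x - y * Q ^ k) ≈ diag n (term x y)
    q-binomial zero    x y = sym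
      (trans (*-cong (h-0ˡ 0) refl) (solve 0 (:# 1 :* (:# 1 :* :# 1 :* :# 1) := :# 1) refl))
    q-binomial (suc n) x y = trans (∏-head n _) (trans
      (*-cong refl (trans (∏-cong n
        (λ k _ → solve 4 (λ x y Q P → x :- y :* (Q :* P) := x :- y :* Q :* P) refl x y Q (Q ^ k)))
        (q-binomial n x (y * Q))))
      (trans (solve 3 (λ x y D → (x :- y :* :# 1) :* D := x :* D :+ (:- y) :* D) refl x y _)
        (trans (+-cong (sym (diag-*ˡ n x _)) (sym (diag-*ˡ n (- y) _)))
          (sym (diag-pascal (term x y) (λ j l → x * term x (y * Q) j l)
            (λ j l → - y * term x (y * Q) j l) left right inner n)))))
      where
      -yQ^ : ∀ j → (- (y * Q)) ^ j ≈ (- y) ^ j * Q ^ j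
      -yQ^ j = trans (pow-cong j (solve 2 (λ y Q → :- (y :* Q) := :- y :* Q) refl y Q)) (^-distrib-* (- y) Q j)
      left : ∀ l → term x y 0 (suc l) ≈ x * term x (y * Q) 0 l
      left l = trans (*-cong (trans (h-0ˡ (suc l)) (sym (h-0ˡ l))) refl)
        (solve 3 (λ H x X → H :* (:# 1 :* :# 1 :* (x :* X)) := x :* (H :* (:# 1 :* :# 1 :* X))) refl (h 0 l) x
          (x ^ l))
      right : ∀ j → term x y (suc j) 0 ≈ - y * term x (y * Q) j 0
      right j = trans (*-cong (trans (h-0ʳ (suc j)) (sym (h-0ʳ j)))
        (*-cong (*-cong (^-+ Q (tri j) j) refl) refl))
        (trans (solve 5 (λ H T J y Y → H :* (T :* J :* (:- y :* Y) :* :# 1)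
          := :- y :* (H :* (T :* (Y :* J) :* :# 1))) refl (h j 0) (Q ^ tri j) (Q ^ j) y ((- y) ^ j))
          (*-cong refl (*-cong refl (*-cong (*-cong refl (sym (-yQ^ j))) refl))))
      inner : ∀ j l → term x y (suc j) (suc l) ≈ - y * term x (y * Q) j (suc l) + x * term x (y * Q) (suc j) l
      inner j l = trans (*-cong (h-pascal j l) (*-cong (*-cong (^-+ Q (tri j) j) refl) refl))
        (trans (solve 9 (λ H₁ H₂ q T J y Y x X →
            (H₁ :+ q :* H₂) :* (T :* J :* (:- y :* Y) :* (x :* X)) :=
            :- y :* (H₁ :* (T :* (Y :* J) :* (x :* X))) :+ x :* (H₂ :* (T :* J :* ((:- y :* Y) :* q) :* X)))
            refl (h j (suc l)) (h (suc j) l) (Q ^ suc j) (Q ^ tri j) (Q ^ j) y ((- y) ^ j) x (x ^ l))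
          (+-cong (*-cong refl (*-cong refl (*-cong (*-cong refl (sym (-yQ^ j))) refl)))
            (*-cong refl (*-cong refl (*-cong (*-cong (sym (^-+ Q (tri j) j)) (sym (-yQ^ (suc j)))) refl)))))

open QBinomials

-- The Jacobi triple product.

module JacobiTripleProduct where
  open SeriesRing

  open SeriesMod (+ 0)

  ≈⇒≡≤ : ∀ {N f g} → f ≈ g → f ≡[≤ N ] g
  ≈⇒≡≤ h n _ = exact-≡ h n

  ≡≤-trans : ∀ {N f g h} → f ≡[≤ N ] g → g ≡[≤ N ] h → f ≡[≤ N ] h
  ≡≤-trans p r n n≤N = ≡-trans (p n n≤N) (r n n≤N)

  ≡≤-sym : ∀ {N f g} → f ≡[≤ N ] g → g ≡[≤ N ] f
  ≡≤-sym p n n≤N = ≡-sym (p n n≤N)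

  ≡≤-weaken : ∀ {M N f g} → M ≤ N → f ≡[≤ N ] g → f ≡[≤ M ] g
  ≡≤-weaken M≤N p n n≤M = p n (ℕₚ.≤-trans n≤M M≤N)

  +-≡≤ : ∀ {N f f′ g g′} → f ≡[≤ N ] f′ → g ≡[≤ N ] g′ → (f + g) ≡[≤ N ] (f′ + g′)
  +-≡≤ {N} {f} {f′} {g} {g′} p r n n≤N =
    ≡-trans (coeff-+ f g n) (≡-trans (cong₂ ℤ._+_ (p n n≤N) (r n n≤N)) (≡-sym (coeff-+ f′ g′ n)))

  inv-≡≤ : ∀ {N f g} → f ≡[≤ N ] g → inv f ≡[≤ N ] inv g
  inv-≡≤ {N} {f} {g} h n n≤N = go n n ℕₚ.≤-refl n≤N
    where
    go : ∀ m n → n ≤ m → n ≤ N → inv f n ≡ inv g n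
    go m zero _ _ = ≡-refl
    go (suc m) (suc n) (s≤s n≤m) n<N = ≡-trans (inv-suc f n) (≡-trans (cong ℤ.-_
      (⊛-cong≤ n {tail f} {tail g} {inv f} {inv g} (λ k k≤n → h (suc k) (ℕₚ.≤-trans (s≤s k≤n) n<N))
        (λ k k≤n → go m k (ℕₚ.≤-trans k≤n n≤m) (ℕₚ.≤-trans k≤n (ℕₚ.<⇒≤ n<N))))) (≡-sym (inv-suc g n)))

  coeff-q^* : ∀ k f n → (q^ k * f) (k ℕ.+ n) ≡ f n
  coeff-q^* k f n = ≡-trans (coeff-* (q^ k) f (k ℕ.+ n)) (qpow-⊛-+ k f n)

  coeff-q^*-< : ∀ k f n → n < k → (q^ k * f) n ≡ + 0
  coeff-q^*-< k f n n<k = ≡-trans (coeff-* (q^ k) f n) (qpow-⊛-< k f n n<k)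

  shift-≡≤ : ∀ k {r f g} → f ≡[≤ r ] g → (q^ k * f) ≡[≤ k ℕ.+ r ] (q^ k * g)
  shift-≡≤ k {r} {f} {g} h n n≤k+r with n ℕₚ.<? k
  ... | yes n<k = ≡-trans (coeff-q^*-< k f n n<k) (≡-sym (coeff-q^*-< k g n n<k))
  ... | no n≮k with ℕₚ.m≤n⇒∃[o]m+o≡n (ℕₚ.≮⇒≥ n≮k)
  ...   | j , ≡-refl = ≡-trans (coeff-q^* k f j)
    (≡-trans (h j (ℕₚ.+-cancelˡ-≤ k j r n≤k+r)) (≡-sym (coeff-q^* k g j)))

  alt : ℕ → ℤ
  alt zero    = + 1
  alt (suc n) = ℤ.- alt n

  alt² : ∀ n → alt n ℤ.* alt n ≡ + 1
  alt² zero    = ≡-refl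
  alt² (suc n) = ≡-trans (neg-sq (alt n)) (alt² n)
    where
    neg-sq : ∀ x → ℤ.- x ℤ.* ℤ.- x ≡ x ℤ.* x
    neg-sq x = ≡-trans (≡-sym (ℤₚ.neg-distribˡ-* x (ℤ.- x)))
      (≡-trans (cong ℤ.-_ (≡-sym (ℤₚ.neg-distribʳ-* x x))) (ℤₚ.neg-involutive (x ℤ.* x)))

  sgn : ℤ → ℤ
  sgn z = alt ∣ z ∣

  bilateral : ℕ → (ℤ → Series) → Series
  bilateral zero    g = g (+ 0)
  bilateral (suc n) g = bilateral n g + (g (+ suc n) + g -[1+ n ])

  bilateral-*ˡ : ∀ n c g → bilateral n (λ z → c * g z) ≈ c * bilateral n g
  bilateral-*ˡ zero    c g = refl
  bilateral-*ˡ (suc n) c g = trans (+-cong (bilateral-*ˡ n c g) refl)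
    (solve 4 (λ c x y z → c :* x :+ (c :* y :+ c :* z) := c :* (x :+ (y :+ z))) refl c (bilateral n g)
      (g (+ suc n)) (g -[1+ n ]))

  module _ {N D : ℕ} (G : ℕ → ℕ → Series) (g : ℤ → Series)
           (pos : ∀ n r → n ℕ.+ r ≡ N → G (N ℕ.+ n) r ≡[≤ D ] g (+ n))
           (neg : ∀ n r → suc n ℕ.+ r ≡ N → G r (N ℕ.+ suc n) ≡[≤ D ] g -[1+ n ]) where

    -- The 2N + 1 terms are read from the middle (N, N) outwards: raising j and lowering l by n
    -- gives the term of index n, the reverse gives the one of index -n. The proof peels off both
    -- ends at once.
    diag-center : diag (N ℕ.+ N) G ≡[≤ D ] bilateral N g
    diag-center = go N 0 (ℕₚ.+-identityʳ N)
      where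
      go : ∀ r s → r ℕ.+ s ≡ N → diag (r ℕ.+ r) (λ j l → G (s ℕ.+ j) (s ℕ.+ l)) ≡[≤ D ] bilateral r g
      go zero s ≡-refl = subst (λ x → G (s ℕ.+ 0) x ≡[≤ D ] g (+ 0)) (≡-sym (ℕₚ.+-identityʳ s)) (pos 0 s ≡-refl)
      go (suc r) s eq = ≡≤-trans (≈⇒≡≤ peel)
        (≡≤-trans (+-≡≤ {g = H 0 (suc (suc (r ℕ.+ r))) + H (suc (suc (r ℕ.+ r))) 0}
          (go r (suc s) (≡-trans (ℕₚ.+-suc r s) eq))
          (≡≤-trans (+-≡≤ {D} {H 0 (suc (suc (r ℕ.+ r)))} {g -[1+ r ]} first last) (≈⇒≡≤ (+-comm _ _))))
            (λ _ _ → ≡-refl))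
        where
        H : ℕ → ℕ → Series
        H j l = G (s ℕ.+ j) (s ℕ.+ l)
        peel : diag (suc r ℕ.+ suc r) H ≈ diag (r ℕ.+ r) (λ j l → G (suc s ℕ.+ j) (suc s ℕ.+ l))
          + (H 0 (suc (suc (r ℕ.+ r))) + H (suc (suc (r ℕ.+ r))) 0)
        peel = trans (reflexive (cong (λ x → diag (suc x) H) (ℕₚ.+-suc r r)))
          (trans (+-cong refl (trans (diag-last (r ℕ.+ r) (λ j l → H (suc j) l))
              (+-cong (diag-cong (r ℕ.+ r) (λ j l → reflexive (cong₂ G (ℕₚ.+-suc s j) (ℕₚ.+-suc s l)))) refl)))
            (solve 3 (λ a b c → a :+ (b :+ c) := b :+ (a :+ c)) refl (H 0 (suc (suc (r ℕ.+ r)))) _ _))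
        index : s ℕ.+ suc (suc (r ℕ.+ r)) ≡ N ℕ.+ suc r
        index = ≡-trans (lemma r s) (cong (ℕ._+ suc r) eq)
          where
          lemma : ∀ r s → s ℕ.+ suc (suc (r ℕ.+ r)) ≡ suc r ℕ.+ s ℕ.+ suc r
          lemma = solve-∀ℕ
        first : H 0 (suc (suc (r ℕ.+ r))) ≡[≤ D ] g -[1+ r ]
        first = subst₂ (λ x y → G x y ≡[≤ D ] g -[1+ r ]) (≡-sym (ℕₚ.+-identityʳ s)) (≡-sym index) (neg r s eq)
        last : H (suc (suc (r ℕ.+ r))) 0 ≡[≤ D ] g (+ suc r)
        last = subst₂ (λ x y → G x y ≡[≤ D ] g (+ suc r)) (≡-sym index) (≡-sym (ℕₚ.+-identityʳ s))
          (pos (suc r) s eq)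

  -- The identity (q^a; q^b) (q^c; q^b) (q^b; q^b) = Σ (-1)^z q^(a z + b z(z - 1)/2) over z in ℤ,
  -- where b = a + c. The parameters are a - 1 and c - 1, which keeps a and c positive. Precision N
  -- is reached from the q-binomial theorem with 2N factors.
  module TripleProduct (a′ c′ : ℕ) where
    a c b : ℕ
    a = suc a′
    c = suc c′
    b = a ℕ.+ c

    Q : Series
    Q = q^ b

    open QBinomial Q ≡-refl

    -- The exponent a z + b z(z - 1)/2; at z = -m it equals m c + b m(m - 1)/2, which stays within
    -- ℕ.
    expo : ℤ → ℕ
    expo (+ n)    = n ℕ.* a ℕ.+ tri n ℕ.* b
    expo -[1+ n ] = suc n ℕ.* c ℕ.+ tri (suc n) ℕ.* b

    thetaTerm : ℤ → Series
    thetaTerm z = const (sgn z) * q^ (expo z)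

    Q^ : ∀ n → Q ^ n ≈ q^ (n ℕ.* b)
    Q^ = q^-^ (+ 0) b

    -q^^ : ∀ e n → (- q^ e) ^ n ≈ const (alt n) * q^ (n ℕ.* e)
    -q^^ e zero    = sym (*-identityˡ (# 1))
    -q^^ e (suc n) = trans (*-cong refl (-q^^ e n))
      (trans (solve 3 (λ q s x → :- q :* (s :* x) := :- s :* (q :* x)) refl (q^ e) (const (alt n))
        (q^ (n ℕ.* e)))
        (*-cong (sym (-‿homo (alt n))) (sym (q^-+ (+ 0) e (n ℕ.* e)))))

    -q^^-Q^ : ∀ e n t → (- q^ e) ^ n * Q ^ t ≈ const (alt n) * q^ (n ℕ.* e ℕ.+ t ℕ.* b)
    -q^^-Q^ e n t = trans (*-cong (-q^^ e n) (Q^ t)) (trans (*-assoc _ _ _)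
      (*-cong refl (sym (q^-+ (+ 0) (n ℕ.* e) (t ℕ.* b)))))

    pochQ-≡≤ : ∀ n → pochQ n ≡[≤ n ] poch b b
    pochQ-≡≤ n = ≡≤-trans (≈⇒≡≤
      (∏-cong n (λ k _ → +-cong refl
      (-‿cong (trans (Q^ (suc k)) (reflexive (cong (λ x → q^ (b ℕ.+ x)) (ℕₚ.*-comm k b))))))))
      (≡≤-trans (λ k k≤n → ∏-stable (pochFactor-admissible b b) k n k≤n) (≈⇒≡≤ (sym (poch≈ b b))))

    -- The three finite products in `h` agree with E = (Q; Q)_∞ up to q^s, so there `h` is E/(E E) =
    -- 1/E.
    h-≡≤ : ∀ {s} j l → s ≤ j → s ≤ l → (poch b b * h j l) ≡[≤ s ] # 1
    h-≡≤ {s} j l s≤j s≤l = ≡≤-trans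
      (*-≡≤ {f = E} {E} {h j l} {E * inv (E * E)} (λ _ _ → ≡-refl)
        (*-≡≤ {f = pochQ (j ℕ.+ l)} {E} {inv (pochQ j * pochQ l)} {inv (E * E)}
          (near (ℕₚ.≤-trans s≤j (ℕₚ.m≤m+n j l)))
          (inv-≡≤ (*-≡≤ {f = pochQ j} {E} {pochQ l} {E} (near s≤j) (near s≤l)))))
      (≈⇒≡≤ (trans (sym (*-assoc _ _ _)) (*-inv (E * E) (*-0 {E} {E} (poch-0 b b) (poch-0 b b)))))
      where
      E = poch b b
      near : ∀ {n} → s ≤ n → pochQ n ≡[≤ s ] E
      near {n} s≤n = ≡≤-weaken s≤n (pochQ-≡≤ n)

    module _ (N : ℕ) where
      -- What factors out of ∏ (Q^N - q^a Q^k) over k < 2N. The factors with k < N give (-q^a)^N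
      -- Q^(tri N) and leave ∏ (1 - q^(c + b k)); those with k ≥ N give Q^(N N) and leave ∏ (1 -
      -- q^(a + b k)).
      scale : Series
      scale = (- q^ a) ^ N * Q ^ (tri N ℕ.+ N ℕ.* N)

      β : ℕ
      β = N ℕ.* a ℕ.+ (tri N ℕ.+ N ℕ.* N) ℕ.* b

      scale≈ : scale ≈ const (alt N) * q^ β
      scale≈ = -q^^-Q^ a N (tri N ℕ.+ N ℕ.* N)

      productᴺ : Series
      productᴺ = ∏ N (λ k → factor (c ℕ.+ b ℕ.* k)) * ∏ N (λ k → factor (a ℕ.+ b ℕ.* k))

      mono : ℕ → ℕ → Series
      mono j l = Q ^ tri j * (- q^ a) ^ j * (Q ^ N) ^ l

      lower : ∀ n → ∏ n (λ k → Q ^ n - q^ a * Q ^ k) ≈ (- q^ a) ^ n * Q ^ tri n * ∏ n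
        (λ k → factor (c ℕ.+ b ℕ.* k))
      lower zero = solve 0 (:# 1 := :# 1 :* :# 1 :* :# 1) refl
      lower (suc n) = trans (∏-head n _) (trans
        (*-cong step (trans (∏-cong n
          (λ k _ → solve 4 (λ Q X a Y → Q :* X :- a :* (Q :* Y) := Q :* (X :- a :* Y)) refl Q (Q ^ n) (q^ a)
          (Q ^ k)))
          (trans (∏-scale n Q _) (*-cong refl (lower n)))))
        (trans (solve 6 (λ a F Qn A T P → :- a :* F :* (Qn :* (A :* T :* P))
          := :- a :* A :* (T :* Qn) :* (P :* F)) refl
            (q^ a) (factor (c ℕ.+ b ℕ.* n)) (Q ^ n) ((- q^ a) ^ n) (Q ^ tri n)
              (∏ n (λ k → factor (c ℕ.+ b ℕ.* k))))
          (*-cong (*-cong refl (sym (^-+ Q (tri n) n))) refl)))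
        where
        step : Q * Q ^ n - q^ a * # 1 ≈ - q^ a * factor (c ℕ.+ b ℕ.* n)
        step = trans (+-cong (trans (Q^ (suc n))
          (trans (reflexive (cong q^ (exponent a c n))) (q^-+ (+ 0) a (c ℕ.+ b ℕ.* n)))) refl)
          (solve 2 (λ a x → a :* x :- a :* :# 1 := :- a :* (:# 1 :- x)) refl (q^ a) (q^ (c ℕ.+ b ℕ.* n)))
          where
          exponent : ∀ a c n → suc n ℕ.* (a ℕ.+ c) ≡ a ℕ.+ (c ℕ.+ (a ℕ.+ c) ℕ.* n)
          exponent = solve-∀ℕ

      finite : ∏ (N ℕ.+ N) (λ k → Q ^ N - q^ a * Q ^ k) ≈ scale * productᴺ
      finite = trans (∏-+ N N _) (trans (*-cong (lower N)
          (trans (∏-cong N (λ k _ → upper k)) (trans (∏-scale N (Q ^ N) _) (*-cong (^-^ Q N N) refl))))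
        (trans (solve 5 (λ A T P M P′ → A :* T :* P :* (M :* P′) := A :* (T :* M) :* (P :* P′)) refl
          ((- q^ a) ^ N) (Q ^ tri N) _ (Q ^ (N ℕ.* N)) _)
          (*-cong (*-cong refl (sym (^-+ Q (tri N) (N ℕ.* N)))) refl)))
        where
        upper : ∀ k → Q ^ N - q^ a * Q ^ (N ℕ.+ k) ≈ Q ^ N * factor (a ℕ.+ b ℕ.* k)
        upper k = trans (+-cong refl (-‿cong (*-cong refl (^-+ Q N k))))
          (trans (solve 3 (λ X a Y → X :- a :* (X :* Y) := X :* (:# 1 :- a :* Y)) refl (Q ^ N) (q^ a) (Q ^ k))
            (*-cong refl (+-cong refl
              (-‿cong (trans (*-cong refl (trans (Q^ k) (reflexive (cong q^ (ℕₚ.*-comm k b)))))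
              (sym (q^-+ (+ 0) a (b ℕ.* k))))))))

      mono-pos : ∀ n r → n ℕ.+ r ≡ N → mono (N ℕ.+ n) r ≈ scale * thetaTerm (+ n)
      mono-pos n r eq = trans
        (*-cong (*-cong refl (^-+ (- q^ a) N n)) (^-^ Q N r))
        (trans (solve 4 (λ T A A′ M → T :* (A :* A′) :* M := A :* A′ :* (T :* M)) refl (Q ^ tri (N ℕ.+ n))
          ((- q^ a) ^ N) ((- q^ a) ^ n) (Q ^ (r ℕ.* N)))
          (trans (*-cong refl (trans (sym (^-+ Q (tri (N ℕ.+ n)) (r ℕ.* N)))
            (trans (reflexive (cong (Q ^_) index)) (^-+ Q (tri N ℕ.+ N ℕ.* N) (tri n)))))
            (trans (solve 4 (λ A A′ S T → A :* A′ :* (S :* T) := A :* S :* (A′ :* T)) refl ((- q^ a) ^ N)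
              ((- q^ a) ^ n) _ (Q ^ tri n))
              (*-cong refl (-q^^-Q^ a n (tri n))))))
        where
        lemma : ∀ T t n r → T ℕ.+ t ℕ.+ (n ℕ.+ r) ℕ.* n ℕ.+ r ℕ.* (n ℕ.+ r) ≡ T ℕ.+ (n ℕ.+ r) ℕ.* (n ℕ.+ r)
          ℕ.+ t
        lemma = solve-∀ℕ
        index : tri (N ℕ.+ n) ℕ.+ r ℕ.* N ≡ tri N ℕ.+ N ℕ.* N ℕ.+ tri n
        index = ≡-trans (cong (ℕ._+ r ℕ.* N) (tri-+ N n))
          (subst (λ N → tri N ℕ.+ tri n ℕ.+ N ℕ.* n ℕ.+ r ℕ.* N ≡ tri N ℕ.+ N ℕ.* N ℕ.+ tri n) eq
            (lemma (tri (n ℕ.+ r)) (tri n) n r))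

      -- Only r of the N factors -q^a of `scale` are present here; the other N - r, along with as
      -- many factors -q^c for the theta term, come from Q = (-q^a)(-q^c).
      mono-neg : ∀ n r → suc n ℕ.+ r ≡ N → mono r (N ℕ.+ suc n) ≈ scale * thetaTerm -[1+ n ]
      mono-neg n′ r eq = trans (*-cong (*-comm _ _) (^-^ Q N (N ℕ.+ n)))
        (trans (*-assoc _ _ _)
        (trans (*-cong refl (trans (sym (^-+ Q (tri r) ((N ℕ.+ n) ℕ.* N)))
          (trans (reflexive (cong (Q ^_) index))
          (trans (^-+ Q n _) (*-cong refl (^-+ Q (tri N ℕ.+ N ℕ.* N) (tri n)))))))
          (trans (*-cong refl (*-cong (trans (pow-cong n Q≈) (^-distrib-* (- q^ a) (- q^ c) n)) refl))
            (trans (solve 5 (λ A A′ C S T → A :* (A′ :* C :* (S :* T)) := A′ :* A :* S :* (C :* T)) refl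
              ((- q^ a) ^ r) ((- q^ a) ^ n) ((- q^ c) ^ n) _ (Q ^ tri n))
              (*-cong (*-cong (trans (sym (^-+ (- q^ a) n r)) (reflexive (cong ((- q^ a) ^_) eq))) refl)
                (-q^^-Q^ c n (tri n)))))))
        where
        n : ℕ
        n = suc n′
        Q≈ : Q ≈ - q^ a * - q^ c
        Q≈ = trans (q^-+ (+ 0) a c) (solve 2 (λ x y → x :* y := :- x :* :- y) refl (q^ a) (q^ c))
        lemma : ∀ R t n r → t ℕ.+ t ℕ.+ n ≡ n ℕ.* n →
                R ℕ.+ (n ℕ.+ r ℕ.+ n) ℕ.* (n ℕ.+ r) ≡ n
                  ℕ.+ (t ℕ.+ R ℕ.+ n ℕ.* r ℕ.+ (n ℕ.+ r) ℕ.* (n ℕ.+ r) ℕ.+ t)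
        lemma R t n r e = ≡-trans (expand₁ R n r)
          (≡-trans (cong (λ x → R ℕ.+ x ℕ.+ n ℕ.* r ℕ.+ (n ℕ.+ r) ℕ.* (n ℕ.+ r)) (≡-sym e)) (expand₂ R t n r))
          where
          expand₁ : ∀ R n r → R ℕ.+ (n ℕ.+ r ℕ.+ n) ℕ.* (n ℕ.+ r) ≡ R ℕ.+ n ℕ.* n ℕ.+ n ℕ.* r
            ℕ.+ (n ℕ.+ r) ℕ.* (n ℕ.+ r)
          expand₁ = solve-∀ℕ
          expand₂ : ∀ R t n r → R ℕ.+ (t ℕ.+ t ℕ.+ n) ℕ.+ n ℕ.* r ℕ.+ (n ℕ.+ r) ℕ.* (n ℕ.+ r) ≡ n
            ℕ.+ (t ℕ.+ R ℕ.+ n ℕ.* r ℕ.+ (n ℕ.+ r) ℕ.* (n ℕ.+ r) ℕ.+ t)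
          expand₂ = solve-∀ℕ
        index : tri r ℕ.+ (N ℕ.+ n) ℕ.* N ≡ n ℕ.+ (tri N ℕ.+ N ℕ.* N ℕ.+ tri n)
        index = subst (λ N → tri r ℕ.+ (N ℕ.+ n) ℕ.* N ≡ n ℕ.+ (tri N ℕ.+ N ℕ.* N ℕ.+ tri n)) eq
          (≡-trans (lemma (tri r) (tri n) n r (2tri n))
            (cong (λ x → n ℕ.+ (x ℕ.+ (n ℕ.+ r) ℕ.* (n ℕ.+ r) ℕ.+ tri n)) (≡-sym (tri-+ n r))))

      -- scale ~ q^β and thetaTerm ± n is divisible by q^n, while h is close to 1/E up to q^(N - n).
      absorb : ∀ {n r z} j l {e′} → n ℕ.+ r ≡ N → r ≤ j → r ≤ l → expo z ≡ n ℕ.+ e′ → mono j l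
        ≈ scale * thetaTerm z →
               (poch b b * (h j l * mono j l)) ≡[≤ β ℕ.+ N ] (scale * thetaTerm z)
      absorb {n} {r} {z} j l {e′} n+r≡N r≤j r≤l e≡ mono≈ = ≡≤-trans
        (≈⇒≡≤ (trans (*-cong refl (*-cong refl (trans mono≈ low)))
          (solve 4 (λ E h q w → E :* (h :* (q :* w)) := q :* (E :* h :* w)) refl (poch b b) (h j l)
          (q^ (β ℕ.+ n)) w)))
        (≡≤-trans (subst (λ k → (q^ (β ℕ.+ n) * (poch b b * h j l * w)) ≡[≤ k ] (q^ (β ℕ.+ n) * (# 1 * w)))
            (≡-trans (ℕₚ.+-assoc β n r) (cong (β ℕ.+_) n+r≡N))
            (shift-≡≤ (β ℕ.+ n) (*-≡≤ {f = poch b b * h j l} {# 1} {w} {w} (h-≡≤ j l r≤j r≤l)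
              (λ _ _ → ≡-refl))))
          (≈⇒≡≤ (trans (*-cong refl (*-identityˡ w)) (sym low))))
        where
        w : Series
        w = const (alt N) * const (sgn z) * q^ e′
        low : scale * thetaTerm z ≈ q^ (β ℕ.+ n) * w
        low = trans (*-cong scale≈ (*-cong refl (trans (reflexive (cong q^ e≡)) (q^-+ (+ 0) n e′))))
          (trans (solve 5 (λ s q s′ x y → s :* q :* (s′ :* (x :* y)) := q :* x :* (s :* s′ :* y)) refl
            (const (alt N)) (q^ β) (const (sgn z)) (q^ n) (q^ e′))
            (*-cong (sym (q^-+ (+ 0) β n)) refl))

      expo-pos : ∀ n → expo (+ n) ≡ n ℕ.+ (n ℕ.* a′ ℕ.+ tri n ℕ.* b)
      expo-pos n = lemma n a′ (tri n ℕ.* b)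
        where
        lemma : ∀ n a t → n ℕ.* suc a ℕ.+ t ≡ n ℕ.+ (n ℕ.* a ℕ.+ t)
        lemma = solve-∀ℕ

      expo-neg : ∀ n → expo -[1+ n ] ≡ suc n ℕ.+ (suc n ℕ.* c′ ℕ.+ tri (suc n) ℕ.* b)
      expo-neg n = lemma n c′ (tri (suc n) ℕ.* b)
        where
        lemma : ∀ n a t → suc n ℕ.* suc a ℕ.+ t ≡ suc n ℕ.+ (suc n ℕ.* a ℕ.+ t)
        lemma = solve-∀ℕ

      scaled : (scale * (poch b b * productᴺ)) ≡[≤ β ℕ.+ N ] (scale * bilateral N thetaTerm)
      scaled = ≡≤-trans
        (≈⇒≡≤ (trans (solve 3 (λ scale E P → scale :* (E :* P) := E :* (scale :* P)) refl scale
          (poch b b) productᴺ)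
          (trans (*-cong refl (trans (sym finite) (q-binomial (N ℕ.+ N) (Q ^ N) (q^ a))))
            (sym (diag-*ˡ (N ℕ.+ N) (poch b b) _)))))
        (≡≤-trans (diag-center (λ j l → poch b b * (h j l * mono j l)) (λ z → scale * thetaTerm z)
            (λ n r eq → absorb {n} {r} {+ n} (N ℕ.+ n) r eq (ℕₚ.≤-trans (r≤N n r eq) (ℕₚ.m≤m+n N n)) ℕₚ.≤-refl
              (expo-pos n) (mono-pos n r eq))
            (λ n r eq → absorb {suc n} {r} { -[1+ n ]} r (N ℕ.+ suc n) eq ℕₚ.≤-refl
              (ℕₚ.≤-trans (r≤N (suc n) r eq) (ℕₚ.m≤m+n N (suc n))) (expo-neg n) (mono-neg n r eq)))
          (≈⇒≡≤ (bilateral-*ˡ N scale thetaTerm)))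
        where
        r≤N : ∀ n r → n ℕ.+ r ≡ N → r ≤ N
        r≤N n r eq = subst (r ≤_) eq (ℕₚ.m≤n+m r n)

      -- As `scale` is ±q^β, dividing by it is a sign and a shift of the coefficients by β;
      -- precision β + N thus becomes precision N.
      unscale : ∀ f n → (const (alt N) * (scale * f)) (β ℕ.+ n) ≡ f n
      unscale f n = ≡-trans (exact-≡ (trans (*-cong refl (*-cong scale≈ refl))
          (trans (solve 3 (λ s q f → s :* (s :* q :* f) := s :* s :* (q :* f)) refl (const (alt N)) (q^ β) f)
            (trans (*-cong (trans (sym (*-homo (alt N) (alt N))) (reflexive (cong const (alt² N)))) refl)
              (*-identityˡ _)))) (β ℕ.+ n))
        (coeff-q^* β f n)

      jacobi : (poch b b * (poch c b * poch a b)) ≡[≤ N ] bilateral N thetaTerm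
      jacobi = ≡≤-trans
        (*-≡≤ {f = poch b b} {poch b b} {poch c b * poch a b} {productᴺ} (λ _ _ → ≡-refl)
          (*-≡≤ {f = poch c b} {g = poch a b} (near c b) (near a b)))
        (λ n n≤N → ≡-trans (≡-sym (unscale (poch b b * productᴺ) n))
          (≡-trans (*-≡≤ {β ℕ.+ N} {const (alt N)} {const (alt N)} (λ _ _ → ≡-refl) scaled (β ℕ.+ n)
            (ℕₚ.+-monoʳ-≤ β n≤N))
            (unscale (bilateral N thetaTerm) n)))
        where
        near : ∀ a b .{{_ : NonZero a}} .{{_ : NonZero b}} → poch a b ≡[≤ N ] ∏ N (λ k → factor (a ℕ.+ b ℕ.* k))
        near a b = ≡≤-trans (≈⇒≡≤ (poch≈ a b)) (infProd-≡≤ (pochFactor-admissible a b) N)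

open JacobiTripleProduct

-- Symmetric finite sums over ℤ.

module SumsOverℤ where
  open import Data.Integer using (_+_; _*_; -_; _-_)
  open import Relation.Binary.PropositionalEquality using (refl; sym; trans)

  sumℤ : ℕ → (ℤ → ℤ) → ℤ
  sumℤ zero    f = f (+ 0)
  sumℤ (suc K) f = sumℤ K f + (f (+ suc K) + f -[1+ K ])

  sumℤ-cong : ∀ K {f g : ℤ → ℤ} → (∀ z → ∣ z ∣ ≤ K → f z ≡ g z) → sumℤ K f ≡ sumℤ K g
  sumℤ-cong zero    h = h (+ 0) z≤n
  sumℤ-cong (suc K) h = cong₂ _+_ (sumℤ-cong K (λ z z≤K → h z (ℕₚ.m≤n⇒m≤1+n z≤K)))
    (cong₂ _+_ (h (+ suc K) ℕₚ.≤-refl) (h -[1+ K ] ℕₚ.≤-refl))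

  sumℤ-zero : ∀ K → sumℤ K (λ _ → + 0) ≡ + 0
  sumℤ-zero zero    = refl
  sumℤ-zero (suc K) = trans (ℤₚ.+-identityʳ _) (sumℤ-zero K)

  sumℤ-+ : ∀ K (f g : ℤ → ℤ) → sumℤ K (λ z → f z + g z) ≡ sumℤ K f + sumℤ K g
  sumℤ-+ zero    f g = refl
  sumℤ-+ (suc K) f g = trans (cong (_+ (f (+ suc K) + g (+ suc K) + (f -[1+ K ] + g -[1+ K ]))) (sumℤ-+ K f g))
    (lemma (sumℤ K f) (sumℤ K g) (f (+ suc K)) (g (+ suc K)) (f -[1+ K ]) (g -[1+ K ]))
    where
    lemma : ∀ a b c d e f → a + b + (c + d + (e + f)) ≡ a + (c + e) + (b + (d + f))
    lemma = solve-∀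

  sumℤ-neg : ∀ K (f : ℤ → ℤ) → sumℤ K (λ z → - f z) ≡ - sumℤ K f
  sumℤ-neg zero    f = refl
  sumℤ-neg (suc K) f = trans (cong (_+ (- f (+ suc K) + - f -[1+ K ])) (sumℤ-neg K f))
    (lemma (sumℤ K f) (f (+ suc K)) (f -[1+ K ]))
    where
    lemma : ∀ a b c → - a + (- b + - c) ≡ - (a + (b + c))
    lemma = solve-∀

  sumℤ-swap : ∀ K L (F : ℤ → ℤ → ℤ) → sumℤ K (λ m → sumℤ L (F m)) ≡ sumℤ L (λ n → sumℤ K (λ m → F m n))
  sumℤ-swap zero    L F = refl
  sumℤ-swap (suc K) L F = trans
    (cong₂ _+_ (sumℤ-swap K L F) (sym (sumℤ-+ L (F (+ suc K)) (F -[1+ K ]))))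
    (sym (sumℤ-+ L (λ n → sumℤ K (λ m → F m n)) (λ n → F (+ suc K) n + F -[1+ K ] n)))

  sumℤ-reflect : ∀ K (f : ℤ → ℤ) → sumℤ K (λ z → f (- z)) ≡ sumℤ K f
  sumℤ-reflect zero    f = refl
  sumℤ-reflect (suc K) f = cong₂ _+_ (sumℤ-reflect K f) (ℤₚ.+-comm (f -[1+ K ]) (f (+ suc K)))

  Bounded : ℕ → (ℤ → ℤ) → Set
  Bounded K f = ∀ z → K < ∣ z ∣ → f z ≡ + 0

  sumℤ-extend : ∀ {K f} → Bounded K f → ∀ j → sumℤ (j ℕ.+ K) f ≡ sumℤ K f
  sumℤ-extend bd zero    = refl
  sumℤ-extend {K} {f} bd (suc j) = trans
    (cong₂ (λ x y → sumℤ (j ℕ.+ K) f + (x + y)) (bd (+ suc (j ℕ.+ K)) (s≤s (ℕₚ.m≤n+m K j)))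
      (bd -[1+ j ℕ.+ K ] (s≤s (ℕₚ.m≤n+m K j))))
    (trans (ℤₚ.+-identityʳ _) (sumℤ-extend bd j))

  sumℤ-enlarge : ∀ {K L f} → Bounded K f → K ≤ L → sumℤ L f ≡ sumℤ K f
  sumℤ-enlarge {K} {L} {f} bd K≤L =
    subst (λ n → sumℤ n f ≡ sumℤ K f) (ℕₚ.m∸n+n≡m K≤L) (sumℤ-extend bd (L ℕ.∸ K))

  -- Moving the window from -K to K by one step drops the value at -K and gains the value at K + 1.
  sumℤ-shift₁ : ∀ K (f : ℤ → ℤ) → sumℤ K (λ z → f (z + + 1)) + f (- + K) ≡ sumℤ K f + f (+ suc K)
  sumℤ-shift₁ zero    f = ℤₚ.+-comm (f (+ 1)) (f (+ 0))
  sumℤ-shift₁ (suc K) f = begin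
    sumℤ K (λ z → f (z + + 1)) + (f (+ suc K + + 1) + f (-[1+ K ] + + 1)) + f -[1+ K ]
      ≡⟨ cong₂ (λ x y → sumℤ K (λ z → f (z + + 1)) + (f x + f y) + f -[1+ K ]) (cong +_ (ℕₚ.+-comm (suc K) 1))
        (cancel K) ⟩
    sumℤ K (λ z → f (z + + 1)) + (f (+ suc (suc K)) + f (- + K)) + f -[1+ K ]
      ≡⟨ lemma₁ (sumℤ K (λ z → f (z + + 1))) (f (+ suc (suc K))) (f (- + K)) (f -[1+ K ]) ⟩
    sumℤ K (λ z → f (z + + 1)) + f (- + K) + f -[1+ K ] + f (+ suc (suc K))
      ≡⟨ cong (λ x → x + f -[1+ K ] + f (+ suc (suc K))) (sumℤ-shift₁ K f) ⟩
    sumℤ K f + f (+ suc K) + f -[1+ K ] + f (+ suc (suc K))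
      ≡⟨ cong (_+ f (+ suc (suc K))) (ℤₚ.+-assoc (sumℤ K f) (f (+ suc K)) (f -[1+ K ])) ⟩
    sumℤ K f + (f (+ suc K) + f -[1+ K ]) + f (+ suc (suc K)) ∎
    where
    open ≡-Reasoning
    cancel : ∀ K → -[1+ K ] + + 1 ≡ - + K
    cancel zero    = refl
    cancel (suc K) = refl
    lemma₁ : ∀ a b c d → a + (b + c) + d ≡ a + c + d + b
    lemma₁ = solve-∀

  ∣z∣≤∣z+1∣+1 : ∀ z → ∣ z ∣ ≤ suc ∣ z + + 1 ∣
  ∣z∣≤∣z+1∣+1 (+ n)          = ℕₚ.m≤n⇒m≤1+n (ℕₚ.m≤m+n n 1)
  ∣z∣≤∣z+1∣+1 -[1+ zero ]    = s≤s z≤n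
  ∣z∣≤∣z+1∣+1 -[1+ suc n ]   = ℕₚ.≤-refl

  Bounded-shift₁ : ∀ {K f} → Bounded K f → Bounded (suc K) (λ z → f (z + + 1))
  Bounded-shift₁ bd z h = bd (z + + 1) (ℕₚ.≤-pred (ℕₚ.<-≤-trans h (∣z∣≤∣z+1∣+1 z)))

  sumℤ-translate₁ : ∀ {K f} → Bounded K f → sumℤ (suc K) (λ z → f (z + + 1)) ≡ sumℤ K f
  sumℤ-translate₁ {K} {f} bd = begin
    sumℤ (suc K) (λ z → f (z + + 1))                    ≡⟨ ℤₚ.+-identityʳ _ ⟨
    sumℤ (suc K) (λ z → f (z + + 1)) + + 0              ≡⟨ cong (λ x → sumℤ (suc K) (λ z → f (z + + 1)) + x)
      (bd -[1+ K ] ℕₚ.≤-refl) ⟨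
    sumℤ (suc K) (λ z → f (z + + 1)) + f -[1+ K ]       ≡⟨ sumℤ-shift₁ (suc K) f ⟩
    sumℤ (suc K) f + f (+ suc (suc K))                  ≡⟨ cong₂ _+_ (sumℤ-extend bd 1)
      (bd (+ suc (suc K)) (s≤s (ℕₚ.n≤1+n K))) ⟩
    sumℤ K f + + 0                                      ≡⟨ ℤₚ.+-identityʳ _ ⟩
    sumℤ K f                                            ∎
    where open ≡-Reasoning

  Bounded-reflect : ∀ {K f} → Bounded K f → Bounded K (λ z → f (- z))
  Bounded-reflect bd z K<z = bd (- z) (subst (_ <_) (sym (ℤₚ.∣-i∣≡∣i∣ z)) K<z)

  sumℤ-translate⁺ : ∀ {K} n {f} → Bounded K f → sumℤ (n ℕ.+ K) (λ z → f (z + + n)) ≡ sumℤ K f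
  sumℤ-translate⁺ {K} zero {f} bd = sumℤ-cong K (λ z _ → cong f (ℤₚ.+-identityʳ z))
  sumℤ-translate⁺ {K} (suc n) {f} bd = begin
    sumℤ (suc (n ℕ.+ K)) (λ z → f (z + + suc n))       ≡⟨ cong (λ k → sumℤ k (λ z → f (z + + suc n)))
      (ℕₚ.+-suc n K) ⟨
    sumℤ (n ℕ.+ suc K) (λ z → f (z + + suc n))         ≡⟨ sumℤ-cong (n ℕ.+ suc K)
      (λ z _ → cong f (assoc z (+ n))) ⟩
    sumℤ (n ℕ.+ suc K) (λ z → f (z + + n + + 1))       ≡⟨ sumℤ-translate⁺ n (Bounded-shift₁ bd) ⟩
    sumℤ (suc K) (λ z → f (z + + 1))                   ≡⟨ sumℤ-translate₁ bd ⟩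
    sumℤ K f                                           ∎
    where
    open ≡-Reasoning
    assoc : ∀ z n → z + (+ 1 + n) ≡ z + n + + 1
    assoc = solve-∀

  Bounded-translate : ∀ {K f} c → Bounded K f → Bounded (∣ c ∣ ℕ.+ K) (λ z → f (z + c))
  Bounded-translate {K} {f} c bd z h = bd (z + c) (ℕₚ.+-cancelˡ-< (∣ c ∣) K (∣ z + c ∣) (ℕₚ.<-≤-trans h z≤))
    where
    lemma : ∀ z c → - c + (z + c) ≡ z
    lemma = solve-∀
    z≤ : ∣ z ∣ ≤ ∣ c ∣ ℕ.+ ∣ z + c ∣
    z≤ = ℕₚ.≤-trans (ℕₚ.≤-reflexive (cong ∣_∣ (sym (lemma z c))))
      (ℕₚ.≤-trans (ℤₚ.∣i+j∣≤∣i∣+∣j∣ (- c) (z + c)) (ℕₚ.≤-reflexive (cong (ℕ._+ ∣ z + c ∣) (ℤₚ.∣-i∣≡∣i∣ c))))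

  sumℤ-translate : ∀ {K L f} c → Bounded K f → ∣ c ∣ ℕ.+ K ≤ L → sumℤ L (λ z → f (z + c)) ≡ sumℤ K f
  sumℤ-translate {K} {L} {f} c bd le = trans (sumℤ-enlarge (Bounded-translate c bd) le) (go c)
    where
    neg-+ : ∀ z c → - (z + c) ≡ - z + - c
    neg-+ = solve-∀
    go : ∀ c → sumℤ (∣ c ∣ ℕ.+ K) (λ z → f (z + c)) ≡ sumℤ K f
    go (+ n)    = sumℤ-translate⁺ n bd
    go -[1+ n ] = begin
      sumℤ (suc n ℕ.+ K) (λ z → f (z + -[1+ n ]))         ≡⟨ sumℤ-reflect (suc n ℕ.+ K) _ ⟨
      sumℤ (suc n ℕ.+ K) (λ z → f (- z + -[1+ n ]))       ≡⟨ sumℤ-cong (suc n ℕ.+ K)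
        (λ z _ → cong f (sym (neg-+ z (+ suc n)))) ⟩
      sumℤ (suc n ℕ.+ K) (λ z → f (- (z + + suc n)))      ≡⟨ sumℤ-translate⁺ (suc n) (Bounded-reflect bd) ⟩
      sumℤ K (λ z → f (- z))                              ≡⟨ sumℤ-reflect K f ⟩
      sumℤ K f                                            ∎
      where open ≡-Reasoning

  -- The reflection z ↦ c - z rearranges the sum and changes its sign, so the sum is its own
  -- negative.
  sumℤ-odd : ∀ {K f} c → Bounded K f → (∀ z → f (c - z) ≡ - f z) → sumℤ K f ≡ + 0
  sumℤ-odd {K} {f} c bd odd = self-neg (begin
    sumℤ K f                                          ≡⟨ sumℤ-translate c bd ℕₚ.≤-refl ⟨
    sumℤ (∣ c ∣ ℕ.+ K) (λ z → f (z + c))              ≡⟨ sumℤ-reflect (∣ c ∣ ℕ.+ K) _ ⟨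
    sumℤ (∣ c ∣ ℕ.+ K) (λ z → f (- z + c))            ≡⟨ sumℤ-cong (∣ c ∣ ℕ.+ K)
      (λ z _ → trans (cong f (ℤₚ.+-comm (- z) c)) (odd z)) ⟩
    sumℤ (∣ c ∣ ℕ.+ K) (λ z → - f z)                  ≡⟨ sumℤ-neg (∣ c ∣ ℕ.+ K) f ⟩
    - sumℤ (∣ c ∣ ℕ.+ K) f                            ≡⟨ cong -_ (sumℤ-extend bd ∣ c ∣) ⟩
    - sumℤ K f                                        ∎)
    where
    open ≡-Reasoning
    self-neg : ∀ {x} → x ≡ - x → x ≡ + 0
    self-neg {+ zero}   _  = refl
    self-neg {+ suc n}  ()
    self-neg { -[1+ n ]} ()

  -- With the residues taken as -2, ..., 2 the window of radius 5K + 2 is exactly the set of all 5s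
  -- + c with |s| ≤ K, so no boundary terms arise.
  sumℤ-split₅ : ∀ K (f : ℤ → ℤ) → sumℤ (K ℕ.* 5 ℕ.+ 2) f ≡
    sumℤ K (λ s → f (+ 5 * s)) + sumℤ K (λ s → f (+ 5 * s + + 1)) + sumℤ K (λ s → f (+ 5 * s + -[1+ 0 ]))
    + sumℤ K (λ s → f (+ 5 * s + + 2)) + sumℤ K (λ s → f (+ 5 * s + -[1+ 1 ]))
  sumℤ-split₅ zero f = lemma (f (+ 0)) (f (+ 1)) (f -[1+ 0 ]) (f (+ 2)) (f -[1+ 1 ])
    where
    lemma : ∀ a b c d e → a + (b + c) + (d + e) ≡ a + b + c + d + e
    lemma = solve-∀
  sumℤ-split₅ (suc K) f = trans
    (cong (λ S → S + (f (+ suc N) + f (- + suc N)) + (f (+ suc (suc N)) + f (- + suc (suc N)))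
        + (f (+ suc (suc (suc N))) + f (- + suc (suc (suc N))))
          + (f (+ suc (suc (suc (suc N)))) + f (- + suc (suc (suc (suc N)))))
        + (f (+ suc (suc (suc (suc (suc N))))) + f (- + suc (suc (suc (suc (suc N))))))) (sumℤ-split₅ K f))
    (trans (cong₂ _+_ (cong₂ _+_ (cong₂ _+_ (cong₂ _+_ (cong (λ y → S₀ + S₁ + S₋₁ + S₂ + S₋₂ + y)
        (cong₂ _+_ (at 1 -[1+ 1 ] (e₁ (+ K))) (at⁻ 1 (+ 2) (e₁⁻ (+ K)))))
        (cong₂ _+_ (at 2 -[1+ 0 ] (e₂ (+ K))) (at⁻ 2 (+ 1) (e₂⁻ (+ K)))))
        (cong₂ _+_ (at₀ (e₃ (+ K))) (at₀⁻ (e₃⁻ (+ K)))))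
        (cong₂ _+_ (at 4 (+ 1) (e₄ (+ K))) (at⁻ 4 -[1+ 0 ] (e₄⁻ (+ K)))))
        (cong₂ _+_ (at 5 (+ 2) (e₅ (+ K))) (at⁻ 5 -[1+ 1 ] (e₅⁻ (+ K)))))
      (lemma S₀ S₁ S₋₁ S₂ S₋₂
        (f (+ 5 * + suc K + -[1+ 1 ])) (f (+ 5 * -[1+ K ] + + 2)) (f (+ 5 * + suc K + -[1+ 0 ]))
          (f (+ 5 * -[1+ K ] + + 1)) (f (+ 5 * + suc K))
        (f (+ 5 * -[1+ K ])) (f (+ 5 * + suc K + + 1)) (f (+ 5 * -[1+ K ] + -[1+ 0 ])) (f (+ 5 * + suc K + + 2))
          (f (+ 5 * -[1+ K ] + -[1+ 1 ]))))
    where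
    N = K ℕ.* 5 ℕ.+ 2
    S₀ = sumℤ K (λ s → f (+ 5 * s))
    S₁ = sumℤ K (λ s → f (+ 5 * s + + 1))
    S₋₁ = sumℤ K (λ s → f (+ 5 * s + -[1+ 0 ]))
    S₂ = sumℤ K (λ s → f (+ 5 * s + + 2))
    S₋₂ = sumℤ K (λ s → f (+ 5 * s + -[1+ 1 ]))
    +N : + N ≡ + K * + 5 + + 2
    +N = cong (_+ + 2) (ℤₚ.pos-* K 5)
    at : ∀ i c → (+ i + (+ K * + 5 + + 2) ≡ + 5 * (+ 1 + + K) + c) → f (+ (i ℕ.+ N)) ≡ f (+ 5 * + suc K + c)
    at i c e = cong f (trans (cong (λ x → + i + x) +N) e)
    at⁻ : ∀ i c → (- (+ i + (+ K * + 5 + + 2)) ≡ + 5 * - (+ 1 + + K) + c) → f (- + (i ℕ.+ N))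
      ≡ f (+ 5 * - + suc K + c)
    at⁻ i c e = cong f (trans (cong (λ x → - (+ i + x)) +N) e)
    at₀ : (+ 3 + (+ K * + 5 + + 2) ≡ + 5 * (+ 1 + + K)) → f (+ (3 ℕ.+ N)) ≡ f (+ 5 * + suc K)
    at₀ e = cong f (trans (cong (λ x → + 3 + x) +N) e)
    at₀⁻ : (- (+ 3 + (+ K * + 5 + + 2)) ≡ + 5 * - (+ 1 + + K)) → f (- + (3 ℕ.+ N)) ≡ f (+ 5 * - + suc K)
    at₀⁻ e = cong f (trans (cong (λ x → - (+ 3 + x)) +N) e)
    e₁ : ∀ k → + 1 + (k * + 5 + + 2) ≡ + 5 * (+ 1 + k) + -[1+ 1 ]
    e₁ = solve-∀
    e₁⁻ : ∀ k → - (+ 1 + (k * + 5 + + 2)) ≡ + 5 * - (+ 1 + k) + + 2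
    e₁⁻ = solve-∀
    e₂ : ∀ k → + 2 + (k * + 5 + + 2) ≡ + 5 * (+ 1 + k) + -[1+ 0 ]
    e₂ = solve-∀
    e₂⁻ : ∀ k → - (+ 2 + (k * + 5 + + 2)) ≡ + 5 * - (+ 1 + k) + + 1
    e₂⁻ = solve-∀
    e₃ : ∀ k → + 3 + (k * + 5 + + 2) ≡ + 5 * (+ 1 + k)
    e₃ = solve-∀
    e₃⁻ : ∀ k → - (+ 3 + (k * + 5 + + 2)) ≡ + 5 * - (+ 1 + k)
    e₃⁻ = solve-∀
    e₄ : ∀ k → + 4 + (k * + 5 + + 2) ≡ + 5 * (+ 1 + k) + + 1
    e₄ = solve-∀
    e₄⁻ : ∀ k → - (+ 4 + (k * + 5 + + 2)) ≡ + 5 * - (+ 1 + k) + -[1+ 0 ]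
    e₄⁻ = solve-∀
    e₅ : ∀ k → + 5 + (k * + 5 + + 2) ≡ + 5 * (+ 1 + k) + + 2
    e₅ = solve-∀
    e₅⁻ : ∀ k → - (+ 5 + (k * + 5 + + 2)) ≡ + 5 * - (+ 1 + k) + -[1+ 1 ]
    e₅⁻ = solve-∀
    lemma : ∀ s₀ s₁ s₋₁ s₂ s₋₂ a b c d e f g h i j →
      s₀ + s₁ + s₋₁ + s₂ + s₋₂ + (a + b) + (c + d) + (e + f) + (g + h) + (i + j) ≡
      s₀ + (e + f) + (s₁ + (g + d)) + (s₋₁ + (c + h)) + (s₂ + (i + b)) + (s₋₂ + (a + j))
    lemma = solve-∀

  sgn-+1 : ∀ z → sgn (z + + 1) ≡ - sgn z
  sgn-+1 (+ n)        = cong alt (ℕₚ.+-comm n 1)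
  sgn-+1 -[1+ zero ]  = refl
  sgn-+1 -[1+ suc n ] = sym (ℤₚ.neg-involutive (- alt n))

  sgn-neg : ∀ z → sgn (- z) ≡ sgn z
  sgn-neg z = cong alt (ℤₚ.∣-i∣≡∣i∣ z)

  sgn-+ : ∀ x y → sgn (x + y) ≡ sgn x * sgn y
  sgn-+ x = induction-ℤ (λ y → sgn (x + y) ≡ sgn x * sgn y)
    (trans (cong sgn (ℤₚ.+-identityʳ x)) (sym (ℤₚ.*-identityʳ (sgn x))))
    (λ y h → trans (cong sgn (sym (ℤₚ.+-assoc x y (+ 1)))) (trans (sgn-+1 (x + y))
      (trans (cong -_ h) (trans (ℤₚ.neg-distribʳ-* (sgn x) (sgn y)) (cong (sgn x *_) (sym (sgn-+1 y)))))))
    (λ y h → trans (back (x + (y - + 1))) (trans (cong (λ z → - sgn z) (lemma x y)) (trans (cong -_ h)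
      (trans (ℤₚ.neg-distribʳ-* (sgn x) (sgn y))
        (cong (sgn x *_) (sym (trans (back (y - + 1)) (cong (λ z → - sgn z) (lemma′ y)))))))))
    where
    back : ∀ z → sgn z ≡ - sgn (z + + 1)
    back z = sym (trans (cong -_ (sgn-+1 z)) (ℤₚ.neg-involutive (sgn z)))
    lemma : ∀ x y → x + (y - + 1) + + 1 ≡ x + y
    lemma = solve-∀
    lemma′ : ∀ y → y - + 1 + + 1 ≡ y
    lemma′ = solve-∀

  sgn-double : ∀ z → sgn (z + z) ≡ + 1
  sgn-double z = trans (sgn-+ z z) (alt² ∣ z ∣)

  δ : ℤ → ℤ → ℤ
  δ x y with x ℤₚ.≟ y
  ... | yes _ = + 1
  ... | no  _ = + 0

  -- Both exponents are doubled in view of theta series, whose doubled exponents are polynomials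
  -- with integer coefficients.
  qpow-δ : ∀ e d → qpow e d ≡ δ (+ (e ℕ.+ e)) (+ (d ℕ.+ d))
  qpow-δ e d with d ℕ.≡ᵇ e in eq | + (e ℕ.+ e) ℤₚ.≟ + (d ℕ.+ d)
  ... | true  | yes _ = refl
  ... | false | no  _ = refl
  ... | true  | no e≢d = contradiction (cong (λ x → + (x ℕ.+ x)) (sym (ℕₚ.≡ᵇ⇒≡ d e (subst Bool.T (sym eq) _))))
    e≢d
  ... | false | yes e≡d = contradiction (subst Bool.T eq (ℕₚ.≡⇒≡ᵇ d e (halve (ℤₚ.+-injective (sym e≡d)))))
    (λ ())
    where
    halve : ∀ {m n} → m ℕ.+ m ≡ n ℕ.+ n → m ≡ n
    halve {m} {n} h = ℕₚ.*-cancelʳ-≡ m n 2 (trans (twice m) (trans h (sym (twice n))))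
      where
      twice : ∀ n → n ℕ.* 2 ≡ n ℕ.+ n
      twice = solve-∀ℕ

open SumsOverℤ

-- Two theta series, and the coefficients of their products.

module ThetaSeries where
  open SeriesRing

  open SeriesMod (+ 0)
  open Substitutions (+ 0)

  coeff-bilateral : ∀ K g n → bilateral K g n ≡ sumℤ K (λ z → g z n)
  coeff-bilateral zero    g n = ≡-refl
  coeff-bilateral (suc K) g n = ≡-trans (coeff-+ (bilateral K g) _ n)
    (cong₂ ℤ._+_ (coeff-bilateral K g n) (coeff-+ (g (+ suc K)) (g -[1+ K ]) n))

  bilateral-cong : ∀ K {g g′} → (∀ z → g z ≈ g′ z) → bilateral K g ≈ bilateral K g′
  bilateral-cong zero    h = h (+ 0)
  bilateral-cong (suc K) h = +-cong (bilateral-cong K h) (+-cong (h (+ suc K)) (h -[1+ K ]))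

  bilateral-* : ∀ K L g g′ → bilateral K g * bilateral L g′ ≈ bilateral K (λ m → bilateral L (λ n → g m * g′ n))
  bilateral-* K L g g′ = trans (*-comm _ _) (trans (sym (bilateral-*ˡ K (bilateral L g′) g))
    (bilateral-cong K (λ m → trans (*-comm (bilateral L g′) (g m)) (sym (bilateral-*ˡ L (g m) g′)))))

  dil-bilateral : ∀ K g → dil 5 (bilateral K g) ≈ bilateral K (λ z → dil 5 (g z))
  dil-bilateral zero    g = refl
  dil-bilateral (suc K) g =
    trans (Dil.τ-+ 5 (bilateral K g) _) (+-cong (dil-bilateral K g) (Dil.τ-+ 5 (g (+ suc K)) (g -[1+ K ])))

  -- The pairs (a, c) are (1, 4) and (2, 3), both with b = 5.
  module T₁ = TripleProduct 0 3
  module T₂ = TripleProduct 1 2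

  θ₁ θ₂ : Series
  θ₁ = poch 5 5 * (poch 4 5 * poch 1 5)
  θ₂ = poch 5 5 * (poch 3 5 * poch 2 5)

  X₁ X₂ : ℤ → ℤ
  X₁ z = + 5 ℤ.* (z ℤ.* z) ℤ.- + 3 ℤ.* z
  X₂ z = + 5 ℤ.* (z ℤ.* z) ℤ.- z

  double-expo : ∀ a c n → + ((n ℕ.* a ℕ.+ tri n ℕ.* (a ℕ.+ c)) ℕ.+ (n ℕ.* a ℕ.+ tri n ℕ.* (a ℕ.+ c)))
                ≡ (+ a ℤ.+ + c) ℤ.* (+ n ℤ.* + n) ℤ.+ (+ a ℤ.- + c) ℤ.* + n
  double-expo a c n = ≡-trans (≡-sym (ℤₚ.+-identityʳ _)) (≡-trans solve₁ solve₂)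
    where
    E = n ℕ.* a ℕ.+ tri n ℕ.* (a ℕ.+ c)
    ℕ-eq : ∀ n t a c → (n ℕ.* a ℕ.+ t ℕ.* (a ℕ.+ c)) ℕ.+ (n ℕ.* a ℕ.+ t ℕ.* (a ℕ.+ c)) ℕ.+ n ℕ.* c ≡ n ℕ.* a
      ℕ.+ (t ℕ.+ t ℕ.+ n) ℕ.* (a ℕ.+ c)
    ℕ-eq = solve-∀ℕ
    eq : E ℕ.+ E ℕ.+ n ℕ.* c ≡ n ℕ.* a ℕ.+ n ℕ.* n ℕ.* (a ℕ.+ c)
    eq = ≡-trans (ℕ-eq n (tri n) a c) (cong (λ x → n ℕ.* a ℕ.+ x ℕ.* (a ℕ.+ c)) (2tri n))
    add-sub : ∀ x y → x ℤ.+ + 0 ≡ x ℤ.+ y ℤ.- y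
    add-sub = solve-∀
    solve₁ : + (E ℕ.+ E) ℤ.+ + 0 ≡ + (n ℕ.* a ℕ.+ n ℕ.* n ℕ.* (a ℕ.+ c)) ℤ.- + (n ℕ.* c)
    solve₁ = ≡-trans (add-sub (+ (E ℕ.+ E)) (+ (n ℕ.* c))) (cong (λ x → + x ℤ.- + (n ℕ.* c)) eq)
    lemma : ∀ a c n → n ℤ.* a ℤ.+ n ℤ.* n ℤ.* (a ℤ.+ c) ℤ.- n ℤ.* c ≡ (a ℤ.+ c) ℤ.* (n ℤ.* n)
      ℤ.+ (a ℤ.- c) ℤ.* n
    lemma = solve-∀
    solve₂ : + (n ℕ.* a ℕ.+ n ℕ.* n ℕ.* (a ℕ.+ c)) ℤ.- + (n ℕ.* c) ≡ (+ a ℤ.+ + c) ℤ.* (+ n ℤ.* + n)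
      ℤ.+ (+ a ℤ.- + c) ℤ.* + n
    solve₂ = ≡-trans (cong₂ ℤ._-_
      (cong₂ ℤ._+_ (ℤₚ.pos-* n a)
      (≡-trans (ℤₚ.pos-* (n ℕ.* n) (a ℕ.+ c)) (cong (ℤ._* + (a ℕ.+ c)) (ℤₚ.pos-* n n)))) (ℤₚ.pos-* n c))
      (lemma (+ a) (+ c) (+ n))

  2expo₁ : ∀ z → + (T₁.expo z ℕ.+ T₁.expo z) ≡ X₁ z
  2expo₁ (+ n)    = ≡-trans (double-expo 1 4 n) (lemma (+ n))
    where
    lemma : ∀ n → + 5 ℤ.* (n ℤ.* n) ℤ.+ -[1+ 2 ] ℤ.* n ≡ + 5 ℤ.* (n ℤ.* n) ℤ.- + 3 ℤ.* n
    lemma = solve-∀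
  2expo₁ -[1+ n ] = ≡-trans (double-expo 4 1 (suc n)) (lemma (+ suc n))
    where
    lemma : ∀ n → + 5 ℤ.* (n ℤ.* n) ℤ.+ + 3 ℤ.* n ≡ + 5 ℤ.* (ℤ.- n ℤ.* ℤ.- n) ℤ.- + 3 ℤ.* ℤ.- n
    lemma = solve-∀

  2expo₂ : ∀ z → + (T₂.expo z ℕ.+ T₂.expo z) ≡ X₂ z
  2expo₂ (+ n)    = ≡-trans (double-expo 2 3 n) (lemma (+ n))
    where
    lemma : ∀ n → + 5 ℤ.* (n ℤ.* n) ℤ.+ -[1+ 0 ] ℤ.* n ≡ + 5 ℤ.* (n ℤ.* n) ℤ.- n
    lemma = solve-∀
  2expo₂ -[1+ n ] = ≡-trans (double-expo 3 2 (suc n)) (lemma (+ suc n))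
    where
    lemma : ∀ n → + 5 ℤ.* (n ℤ.* n) ℤ.+ + 1 ℤ.* n ≡ + 5 ℤ.* (ℤ.- n ℤ.* ℤ.- n) ℤ.- ℤ.- n
    lemma = solve-∀

  -- X is twice the exponent, which makes it a polynomial in z.
  record IsTheta (Θ : Series) (X : ℤ → ℤ) : Set where
    field
      expo     : ℤ → ℕ
      2expo    : ∀ z → + (expo z ℕ.+ expo z) ≡ X z
      ∣z∣≤expo : ∀ z → ∣ z ∣ ≤ expo z
      expand   : ∀ K → Θ ≡[≤ K ] bilateral K (λ z → const (sgn z) * q^ (expo z))

  θ₁-isTheta : IsTheta θ₁ X₁
  θ₁-isTheta = record { expo = T₁.expo ; 2expo = 2expo₁ ; expand = T₁.jacobi ; ∣z∣≤expo = bound }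
    where
    bound : ∀ z → ∣ z ∣ ≤ T₁.expo z
    bound (+ n)    = subst (n ≤_) (≡-sym (T₁.expo-pos 0 n)) (ℕₚ.m≤m+n n _)
    bound -[1+ n ] = subst (suc n ≤_) (≡-sym (T₁.expo-neg 0 n)) (ℕₚ.m≤m+n (suc n) _)

  θ₂-isTheta : IsTheta θ₂ X₂
  θ₂-isTheta = record { expo = T₂.expo ; 2expo = 2expo₂ ; expand = T₂.jacobi ; ∣z∣≤expo = bound }
    where
    bound : ∀ z → ∣ z ∣ ≤ T₂.expo z
    bound (+ n)    = subst (n ≤_) (≡-sym (T₂.expo-pos 0 n)) (ℕₚ.m≤m+n n _)
    bound -[1+ n ] = subst (suc n ≤_) (≡-sym (T₂.expo-neg 0 n)) (ℕₚ.m≤m+n (suc n) _)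

  module _ {Θ Θ′ X X′} (I : IsTheta Θ X) (I′ : IsTheta Θ′ X′) where
    private
      module I  = IsTheta I
      module I′ = IsTheta I′

    monomial : ℤ → ℤ → Series
    monomial m n = const (sgn m ℤ.* sgn n) * q^ (I.expo m ℕ.+ I′.expo n)

    theta-* : ∀ d K L → d ≤ K → d ≤ L → (Θ * Θ′) ≡[≤ d ] bilateral K (λ m → bilateral L (monomial m))
    theta-* d K L d≤K d≤L = ≡≤-trans
      (*-≡≤ {f = Θ} {g = Θ′} (≡≤-weaken d≤K (I.expand K)) (≡≤-weaken d≤L (I′.expand L)))
      (≈⇒≡≤ (trans (bilateral-* K L _ _) (bilateral-cong K (λ m → bilateral-cong L (λ n →
        trans (solve 4 (λ s x s′ y → s :* x :* (s′ :* y) := s :* s′ :* (x :* y)) refl (const (sgn m))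
          (q^ (I.expo m)) (const (sgn n)) (q^ (I′.expo n)))
          (*-cong (sym (*-homo (sgn m) (sgn n))) (sym (q^-+ (+ 0) (I.expo m) (I′.expo n)))))))))

    coeff-monomial : ∀ s e d → (const s * q^ e) d ≡ s ℤ.* δ (+ (e ℕ.+ e)) (+ (d ℕ.+ d))
    coeff-monomial s e d = ≡-trans (coeff-* (const s) (q^ e) d)
      (≡-trans (const-⊛ s (q^ e) d) (cong (s ℤ.*_) (qpow-δ e d)))

    coeff-theta-* : ∀ d K L → d ≤ K → d ≤ L → (Θ * Θ′) d ≡
      sumℤ K (λ m → sumℤ L (λ n → sgn m ℤ.* sgn n ℤ.* δ (X m ℤ.+ X′ n) (+ (d ℕ.+ d))))
    coeff-theta-* d K L d≤K d≤L = ≡-trans (theta-* d K L d≤K d≤L d ℕₚ.≤-refl)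
      (≡-trans (coeff-bilateral K _ d)
        (sumℤ-cong K (λ m _ → ≡-trans (coeff-bilateral L _ d) (sumℤ-cong L (λ n _ →
        ≡-trans (coeff-monomial (sgn m ℤ.* sgn n) (I.expo m ℕ.+ I′.expo n) d)
          (cong (λ x → sgn m ℤ.* sgn n ℤ.* δ x (+ (d ℕ.+ d))) (exponent m n)))))))
      where
      rearrange : ∀ a b → (a ℕ.+ b) ℕ.+ (a ℕ.+ b) ≡ (a ℕ.+ a) ℕ.+ (b ℕ.+ b)
      rearrange = solve-∀ℕ
      exponent : ∀ m n → + ((I.expo m ℕ.+ I′.expo n) ℕ.+ (I.expo m ℕ.+ I′.expo n)) ≡ X m ℤ.+ X′ n
      exponent m n = ≡-trans (cong +_ (rearrange (I.expo m) (I′.expo n))) (cong₂ ℤ._+_ (I.2expo m) (I′.2expo n))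

    -- The windows K and L are free above d, since the cosets below are summed with windows d, 3d
    -- and 3d + 1.
    coeff-shifted-dil : ∀ k d K L → d ≤ K → d ≤ L → (q^ k * dil 5 (Θ * Θ′)) d ≡
      sumℤ K (λ m → sumℤ L (λ n → sgn m ℤ.* sgn n ℤ.* δ (+ 5 ℤ.* (X m ℤ.+ X′ n) ℤ.+ (+ k ℤ.+ + k))
        (+ (d ℕ.+ d))))
    coeff-shifted-dil k d K L d≤K d≤L = ≡-trans
      (*-≡≤ {f = q^ k} {q^ k} {dil 5 (Θ * Θ′)} (λ _ _ → ≡-refl)
        (dil-local 5 d (theta-* d K L d≤K d≤L)) d ℕₚ.≤-refl)
      (≡-trans (exact-≡ expand d)
        (≡-trans (coeff-bilateral K _ d)
        (sumℤ-cong K (λ m _ → ≡-trans (coeff-bilateral L _ d) (sumℤ-cong L (λ n _ →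
        ≡-trans (coeff-monomial (sgn m ℤ.* sgn n) (k ℕ.+ (I.expo m ℕ.+ I′.expo n) ℕ.* 5) d)
          (cong (λ x → sgn m ℤ.* sgn n ℤ.* δ x (+ (d ℕ.+ d))) (exponent m n))))))))
      where
      expand : q^ k * dil 5 (bilateral K (λ m → bilateral L (monomial m))) ≈
               bilateral K (λ m → bilateral L
                 (λ n → const (sgn m ℤ.* sgn n) * q^ (k ℕ.+ (I.expo m ℕ.+ I′.expo n) ℕ.* 5)))
      expand = trans (*-cong refl
        (trans (dil-bilateral K _) (bilateral-cong K (λ m → dil-bilateral L (monomial m)))))
        (trans (sym (bilateral-*ˡ K (q^ k) _))
          (bilateral-cong K (λ m → trans (sym (bilateral-*ˡ L (q^ k) _)) (bilateral-cong L (λ n →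
          trans (*-cong refl (trans (Dil.τ-scale 5 (sgn m ℤ.* sgn n) _) (*-cong refl (dil-q^ 5 _))))
            (trans (solve 3 (λ k s x → k :* (s :* x) := s :* (k :* x)) refl (q^ k) (const (sgn m ℤ.* sgn n)) _)
              (*-cong refl (sym (q^-+ (+ 0) k _)))))))))
      rearrange : ∀ k a b → (k ℕ.+ (a ℕ.+ b) ℕ.* 5) ℕ.+ (k ℕ.+ (a ℕ.+ b) ℕ.* 5)
        ≡ 5 ℕ.* ((a ℕ.+ a) ℕ.+ (b ℕ.+ b)) ℕ.+ (k ℕ.+ k)
      rearrange = solve-∀ℕ
      exponent : ∀ m n → + ((k ℕ.+ (I.expo m ℕ.+ I′.expo n) ℕ.* 5) ℕ.+ (k ℕ.+ (I.expo m ℕ.+ I′.expo n) ℕ.* 5))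
        ≡ + 5 ℤ.* (X m ℤ.+ X′ n) ℤ.+ (+ k ℤ.+ + k)
      exponent m n = ≡-trans (cong +_ (rearrange k (I.expo m) (I′.expo n)))
        (cong (ℤ._+ (+ k ℤ.+ + k))
          (≡-trans (ℤₚ.pos-* 5 ((I.expo m ℕ.+ I.expo m) ℕ.+ (I′.expo n ℕ.+ I′.expo n)))
          (cong (+ 5 ℤ.*_) (cong₂ ℤ._+_ (I.2expo m) (I′.2expo n)))))

    δ-bounded : ∀ d m n → (d < ∣ m ∣ → δ (X m ℤ.+ X′ n) (+ (d ℕ.+ d)) ≡ + 0)
    δ-bounded d m n d<m with (X m ℤ.+ X′ n) ℤₚ.≟ + (d ℕ.+ d)
    ... | no _ = ≡-refl
    ... | yes eq = contradiction (ℤₚ.+-injective (≡-trans (cong₂ ℤ._+_ (I.2expo m) (I′.2expo n)) eq))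
      (ℕₚ.>⇒≢ (ℕₚ.<-≤-trans (ℕₚ.+-mono-<-≤ (ℕₚ.<-≤-trans d<m (I.∣z∣≤expo m))
        (ℕₚ.<⇒≤ (ℕₚ.<-≤-trans d<m (I.∣z∣≤expo m)))) (ℕₚ.m≤m+n _ _)))

    δ-boundedʳ : ∀ d m n → (d < ∣ n ∣ → δ (X m ℤ.+ X′ n) (+ (d ℕ.+ d)) ≡ + 0)
    δ-boundedʳ d m n d<n with (X m ℤ.+ X′ n) ℤₚ.≟ + (d ℕ.+ d)
    ... | no _ = ≡-refl
    ... | yes eq = contradiction (ℤₚ.+-injective (≡-trans (cong₂ ℤ._+_ (I.2expo m) (I′.2expo n)) eq))
      (ℕₚ.>⇒≢ (ℕₚ.<-≤-trans (ℕₚ.+-mono-<-≤ (ℕₚ.<-≤-trans d<n (I′.∣z∣≤expo n))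
        (ℕₚ.<⇒≤ (ℕₚ.<-≤-trans d<n (I′.∣z∣≤expo n))))
        (ℕₚ.m≤n+m (I′.expo n ℕ.+ I′.expo n) (I.expo m ℕ.+ I.expo m))))

open ThetaSeries

-- The five-dissection of θ₁ θ₂.

module FiveDissection where
  open SeriesRing using (coeff-+; coeff-neg) renaming (_*_ to _·_; _-_ to _⊟_)
  open import Data.Integer using (_+_; _*_; -_; _-_)
  open import Relation.Binary.PropositionalEquality using (refl; sym; trans)

  ∣z+z∣≤ : ∀ {K} z → ∣ z ∣ ≤ K → ∣ z + z ∣ ≤ K ℕ.+ K
  ∣z+z∣≤ z z≤K = ℕₚ.≤-trans (ℤₚ.∣i+j∣≤∣i∣+∣j∣ z z) (ℕₚ.+-mono-≤ z≤K z≤K)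

  ∣-z-z∣≤ : ∀ {K} z → ∣ z ∣ ≤ K → ∣ - (z + z) ∣ ≤ K ℕ.+ K
  ∣-z-z∣≤ {K} z z≤K = subst (_≤ K ℕ.+ K) (sym (ℤₚ.∣-i∣≡∣i∣ (z + z))) (∣z+z∣≤ z z≤K)

  -- The lattice ℤ² is the union of the cosets (m , n) = (t - 2s , 2t + s + c), |c| ≤ 2, of a sublattice
  -- of index 5 on which the quadratic form X₁ m + X₂ n is five times a form of the same shape.
  module Dissection (d : ℕ) where
    D₂ : ℤ
    D₂ = + (d ℕ.+ d)

    F : ℤ → ℤ → ℤ
    F m n = sgn m * sgn n * δ (X₁ m + X₂ n) D₂

    F-off₁ : ∀ m n → d < ∣ m ∣ → F m n ≡ + 0
    F-off₁ m n h = trans (cong (λ x → sgn m * sgn n * x) (δ-bounded θ₁-isTheta θ₂-isTheta d m n h))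
      (ℤₚ.*-zeroʳ (sgn m * sgn n))

    F-off₂ : ∀ m n → d < ∣ n ∣ → F m n ≡ + 0
    F-off₂ m n h = trans (cong (λ x → sgn m * sgn n * x) (δ-boundedʳ θ₁-isTheta θ₂-isTheta d m n h))
      (ℤₚ.*-zeroʳ (sgn m * sgn n))

    -- On a coset t = m + 2s, so |m| ≤ d and |s| ≤ d give |t| ≤ 3d.
    L : ℕ
    L = d ℕ.+ d ℕ.+ d

    -- In the row of m the residue c and the quotient s describe n through n - 2m = 5s + c; `H` then
    -- replaces m by t = m + 2s.
    G : ℤ → ℤ → ℤ → ℤ
    G c m s = F m (+ 5 * s + c + (m + m))

    H : ℤ → ℤ → ℤ → ℤ
    H c s t = G c (t + - (s + s)) s

    coset : ℤ → ℤ
    coset c = sumℤ d (λ s → sumℤ L (H c s))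

    H-bounded : ∀ c s → ∣ s ∣ ≤ d → Bounded L (H c s)
    H-bounded c s s≤d z L<z =
      Bounded-translate {f = λ m → G c m s} (- (s + s)) (λ m → F-off₁ m (+ 5 * s + c + (m + m))) z
      (ℕₚ.≤-<-trans (ℕₚ.+-monoˡ-≤ d (∣-z-z∣≤ s s≤d)) L<z)

    rows : ∀ m → ∣ m ∣ ≤ d → sumℤ d (F m) ≡
      sumℤ d (G (+ 0) m) + sumℤ d (G (+ 1) m) + sumℤ d (G -[1+ 0 ] m) + sumℤ d (G (+ 2) m)
        + sumℤ d (G -[1+ 1 ] m)
    rows m m≤d = begin
      sumℤ d (F m)                                    ≡⟨ sumℤ-translate (m + m) (λ n → F-off₂ m n) bound ⟨
      sumℤ (d ℕ.* 5 ℕ.+ 2) (λ n → F m (n + (m + m)))  ≡⟨ sumℤ-split₅ d (λ n → F m (n + (m + m))) ⟩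
      _                                               ≡⟨ cong
        (λ x → x + sumℤ d (G (+ 1) m) + sumℤ d (G -[1+ 0 ] m) + sumℤ d (G (+ 2) m) + sumℤ d (G -[1+ 1 ] m))
                                                           (sumℤ-cong d (λ s _ → cong (λ x → F m (x + (m + m)))
                                                             (sym (ℤₚ.+-identityʳ (+ 5 * s))))) ⟩
      _                                               ∎
      where
      open ≡-Reasoning
      3d≤5d+2 : ∀ d → d ℕ.+ d ℕ.+ d ℕ.+ (d ℕ.+ d ℕ.+ 2) ≡ d ℕ.* 5 ℕ.+ 2
      3d≤5d+2 = solve-∀ℕ
      bound : ∣ m + m ∣ ℕ.+ d ≤ d ℕ.* 5 ℕ.+ 2
      bound = ℕₚ.≤-trans (ℕₚ.+-monoˡ-≤ d (∣z+z∣≤ m m≤d)) (subst (L ≤_) (3d≤5d+2 d) (ℕₚ.m≤m+n L _))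

    column : ∀ c → sumℤ d (λ m → sumℤ d (G c m)) ≡ coset c
    column c = trans (sumℤ-swap d d (G c)) (sumℤ-cong d (λ s s≤d →
      sym (sumℤ-translate {f = λ m → G c m s} (- (s + s)) (λ m → F-off₁ m (+ 5 * s + c + (m + m)))
        (ℕₚ.+-monoˡ-≤ d (∣-z-z∣≤ s s≤d)))))

    cosets : sumℤ d (λ m → sumℤ d (F m)) ≡ coset (+ 0) + coset (+ 1) + coset -[1+ 0 ] + coset (+ 2)
      + coset -[1+ 1 ]
    cosets = trans (sumℤ-cong d rows)
      (trans (add₅ (λ m → sumℤ d (G (+ 0) m)) (λ m → sumℤ d (G (+ 1) m)) (λ m → sumℤ d (G -[1+ 0 ] m))
        (λ m → sumℤ d (G (+ 2) m)) (λ m → sumℤ d (G -[1+ 1 ] m)))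
        (cong₂ _+_ (cong₂ _+_ (cong₂ _+_ (cong₂ _+_ (column (+ 0)) (column (+ 1))) (column -[1+ 0 ]))
          (column (+ 2))) (column -[1+ 1 ])))
      where
      add₅ : ∀ (f g h i j : ℤ → ℤ) → sumℤ d (λ m → f m + g m + h m + i m + j m) ≡ sumℤ d f + sumℤ d g + sumℤ d h
        + sumℤ d i + sumℤ d j
      add₅ f g h i j = trans (sumℤ-+ d _ j) (cong (_+ sumℤ d j) (trans (sumℤ-+ d _ i) (cong (_+ sumℤ d i)
        (trans (sumℤ-+ d _ h) (cong (_+ sumℤ d h) (sumℤ-+ d f g))))))

    form : ℤ → ℤ → ℤ → ℤ
    form c s t = X₁ (t + - (s + s)) + X₂ (+ 5 * s + c + (t + - (s + s) + (t + - (s + s))))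

    H≡ : ∀ c s t → H c s t ≡ sgn c * (sgn s * sgn t) * δ (form c s t) D₂
    H≡ c s t = cong (_* δ (form c s t) D₂) (begin
      sgn (t + - (s + s)) * sgn (+ 5 * s + c + (t + - (s + s) + (t + - (s + s))))
        ≡⟨ cong₂ _*_ (sgn-+ t (- (s + s)))
          (trans (cong sgn (lemma s c t))
          (trans (sgn-+ (s + c) (t + t)) (cong₂ _*_ (sgn-+ s c) (sgn-double t)))) ⟩
      sgn t * sgn (- (s + s)) * (sgn s * sgn c * + 1)
        ≡⟨ cong (λ x → sgn t * x * (sgn s * sgn c * + 1)) (trans (sgn-neg (s + s)) (sgn-double s)) ⟩
      sgn t * + 1 * (sgn s * sgn c * + 1)
        ≡⟨ lemma′ (sgn t) (sgn s) (sgn c) ⟩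
      sgn c * (sgn s * sgn t) ∎)
      where
      open ≡-Reasoning
      lemma : ∀ s c t → + 5 * s + c + (t + - (s + s) + (t + - (s + s))) ≡ (s + c) + (t + t)
      lemma = solve-∀
      lemma′ : ∀ t s c → t * + 1 * (s * c * + 1) ≡ c * (s * t)
      lemma′ = solve-∀

    minus : ∀ x y → -[1+ 0 ] * x * y ≡ - (x * y)
    minus = solve-∀

    coset-0 : coset (+ 0) ≡ (q^ 0 · dil 5 (θ₂ · θ₂)) d
    coset-0 = begin
      coset (+ 0)
        ≡⟨ sumℤ-cong d (λ s _ → sumℤ-cong L
          (λ t _ → trans (H≡ (+ 0) s t)
          (cong₂ (λ x y → x * δ y D₂) (trans (ℤₚ.*-identityˡ _) (cong (_* sgn t) (sym (sgn-neg s))))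
          (poly s t)))) ⟩
      sumℤ d (λ s → sumℤ L (λ t → sgn (- s) * sgn t * δ (+ 5 * (X₂ (- s) + X₂ t) + (+ 0 + + 0)) D₂))
        ≡⟨ sumℤ-reflect d (λ s → sumℤ L (λ t → sgn s * sgn t * δ (+ 5 * (X₂ s + X₂ t) + (+ 0 + + 0)) D₂)) ⟩
      _ ≡⟨ coeff-shifted-dil θ₂-isTheta θ₂-isTheta 0 d d L ℕₚ.≤-refl (ℕₚ.m≤n+m d (d ℕ.+ d)) ⟨
      (q^ 0 · dil 5 (θ₂ · θ₂)) d ∎
      where
      open ≡-Reasoning
      poly : ∀ s t → let m = t + - (s + s) ; n = + 5 * s + + 0 + (m + m) in
        + 5 * (m * m) - + 3 * m + (+ 5 * (n * n) - n) ≡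
        + 5 * (+ 5 * (- s * - s) - - s + (+ 5 * (t * t) - t)) + (+ 0 + + 0)
      poly = solve-∀

    coset-1 : coset (+ 1) ≡ - (q^ 2 · dil 5 (θ₁ · θ₁)) d
    coset-1 = begin
      coset (+ 1)
        ≡⟨ sumℤ-cong d (λ s _ → sumℤ-cong L (λ t _ → trans (H≡ (+ 1) s t)
             (trans (minus (sgn s * sgn t) _)
               (cong₂ (λ x y → - (x * δ y D₂)) (cong₂ _*_ (sym (sgn-neg s)) (sym (sgn-neg t))) (poly s t))))) ⟩
      sumℤ d (λ s → sumℤ L (λ t → - (f (- s) (- t))))
        ≡⟨ sumℤ-cong d (λ s _ → trans (sumℤ-neg L (λ t → f (- s) (- t))) (cong -_ (sumℤ-reflect L (f (- s))))) ⟩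
      sumℤ d (λ s → - sumℤ L (f (- s)))
        ≡⟨ trans (sumℤ-neg d _) (cong -_ (sumℤ-reflect d (λ s → sumℤ L (f s)))) ⟩
      - sumℤ d (λ s → sumℤ L (f s))
        ≡⟨ cong -_ (coeff-shifted-dil θ₁-isTheta θ₁-isTheta 2 d d L ℕₚ.≤-refl (ℕₚ.m≤n+m d (d ℕ.+ d))) ⟨
      - (q^ 2 · dil 5 (θ₁ · θ₁)) d ∎
      where
      open ≡-Reasoning
      f : ℤ → ℤ → ℤ
      f s t = sgn s * sgn t * δ (+ 5 * (X₁ s + X₁ t) + (+ 2 + + 2)) D₂
      poly : ∀ s t → let m = t + - (s + s) ; n = + 5 * s + + 1 + (m + m) in
        + 5 * (m * m) - + 3 * m + (+ 5 * (n * n) - n) ≡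
        + 5 * (+ 5 * (- s * - s) - + 3 * - s + (+ 5 * (- t * - t) - + 3 * - t)) + (+ 2 + + 2)
      poly = solve-∀

    -- Here the form is centred only after replacing t by t + 1: it becomes 5(X₁(s) + X₂(-t)) + 2.
    -- The sign comes from sgn (t + 1) = - sgn t, and the window for t grows by one.
    coset-₋2 : coset -[1+ 1 ] ≡ - (q^ 1 · dil 5 (θ₁ · θ₂)) d
    coset-₋2 = begin
      coset -[1+ 1 ]
        ≡⟨ sumℤ-cong d (λ s s≤d → sym (sumℤ-translate₁ (H-bounded -[1+ 1 ] s s≤d))) ⟩
      sumℤ d (λ s → sumℤ (suc L) (λ t → H -[1+ 1 ] s (t + + 1)))
        ≡⟨ sumℤ-cong d (λ s _ → sumℤ-cong (suc L) (λ t _ → trans (H≡ -[1+ 1 ] s (t + + 1))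
             (trans (cong (λ x → + 1 * (sgn s * x) * δ (form -[1+ 1 ] s (t + + 1)) D₂) (sgn-+1 t))
               (trans (signs (sgn s) (sgn t) _)
                 (cong₂ (λ x y → - (sgn s * x * δ y D₂)) (sym (sgn-neg t)) (poly s t)))))) ⟩
      sumℤ d (λ s → sumℤ (suc L) (λ t → - f s (- t)))
        ≡⟨ sumℤ-cong d (λ s _ → trans (sumℤ-neg (suc L) (λ t → f s (- t)))
          (cong -_ (sumℤ-reflect (suc L) (f s)))) ⟩
      sumℤ d (λ s → - sumℤ (suc L) (f s))
        ≡⟨ sumℤ-neg d _ ⟩
      - sumℤ d (λ s → sumℤ (suc L) (f s))
        ≡⟨ cong -_ (coeff-shifted-dil θ₁-isTheta θ₂-isTheta 1 d d (suc L) ℕₚ.≤-refl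
          (ℕₚ.m≤n⇒m≤1+n (ℕₚ.m≤n+m d (d ℕ.+ d)))) ⟨
      - (q^ 1 · dil 5 (θ₁ · θ₂)) d ∎
      where
      open ≡-Reasoning
      f : ℤ → ℤ → ℤ
      f s t = sgn s * sgn t * δ (+ 5 * (X₁ s + X₂ t) + (+ 1 + + 1)) D₂
      signs : ∀ s t x → + 1 * (s * - t) * x ≡ - (s * t * x)
      signs = solve-∀
      poly : ∀ s t → let m = t + + 1 + - (s + s) ; n = + 5 * s + -[1+ 1 ] + (m + m) in
        + 5 * (m * m) - + 3 * m + (+ 5 * (n * n) - n) ≡
        + 5 * (+ 5 * (s * s) - + 3 * s + (+ 5 * (- t * - t) - - t)) + (+ 1 + + 1)
      poly = solve-∀

    -- On the two remaining cosets a reflection preserves the form and changes the sign.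
    coset-₋1 : coset -[1+ 0 ] ≡ + 0
    coset-₋1 = trans (sumℤ-cong d (λ s s≤d → sumℤ-odd (+ 1) (H-bounded -[1+ 0 ] s s≤d) (odd s))) (sumℤ-zero d)
      where
      poly : ∀ s t → let m = + 1 - t + - (s + s) ; n = + 5 * s + -[1+ 0 ] + (m + m)
                         m′ = t + - (s + s) ; n′ = + 5 * s + -[1+ 0 ] + (m′ + m′) in
        + 5 * (m * m) - + 3 * m + (+ 5 * (n * n) - n) ≡ + 5 * (m′ * m′) - + 3 * m′ + (+ 5 * (n′ * n′) - n′)
      poly = solve-∀
      signs : ∀ s t x → -[1+ 0 ] * (s * (-[1+ 0 ] * t)) * x ≡ - (-[1+ 0 ] * (s * t) * x)
      signs = solve-∀
      odd : ∀ s t → H -[1+ 0 ] s (+ 1 - t) ≡ - H -[1+ 0 ] s t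
      odd s t = trans (H≡ -[1+ 0 ] s (+ 1 - t))
        (trans (cong₂ (λ x y → -[1+ 0 ] * (sgn s * x) * δ y D₂)
          (trans (sgn-+ (+ 1) (- t)) (cong (-[1+ 0 ] *_) (sgn-neg t))) (poly s t))
          (trans (signs (sgn s) (sgn t) _) (cong -_ (sym (H≡ -[1+ 0 ] s t)))))

    coset-2 : coset (+ 2) ≡ + 0
    coset-2 = trans (sumℤ-swap d L (H (+ 2)))
      (trans (sumℤ-cong L (λ t _ → sumℤ-odd -[1+ 0 ] (bounded t) (odd t))) (sumℤ-zero L))
      where
      poly : ∀ s t → let m = t + - (-[1+ 0 ] - s + (-[1+ 0 ] - s)) ; n = + 5 * (-[1+ 0 ] - s) + + 2 + (m + m)
                         m′ = t + - (s + s) ; n′ = + 5 * s + + 2 + (m′ + m′) in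
        + 5 * (m * m) - + 3 * m + (+ 5 * (n * n) - n) ≡ + 5 * (m′ * m′) - + 3 * m′ + (+ 5 * (n′ * n′) - n′)
      poly = solve-∀
      signs : ∀ s t x → + 1 * (-[1+ 0 ] * s * t) * x ≡ - (+ 1 * (s * t) * x)
      signs = solve-∀
      odd : ∀ t s → H (+ 2) (-[1+ 0 ] - s) t ≡ - H (+ 2) s t
      odd t s = trans (H≡ (+ 2) (-[1+ 0 ] - s) t)
        (trans (cong₂ (λ x y → + 1 * (x * sgn t) * δ y D₂)
          (trans (sgn-+ -[1+ 0 ] (- s)) (cong (-[1+ 0 ] *_) (sgn-neg s))) (poly s t))
          (trans (signs (sgn s) (sgn t) _) (cong -_ (sym (H≡ (+ 2) s t)))))
      -- Since 5s = n - 2m - 2, having |m| and |n| at most d would force 5|s| ≤ 3d + 2, which is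
      -- less than 5(d + 1).
      bounded : ∀ t → Bounded d (λ s → H (+ 2) s t)
      bounded t s d<s with d ℕₚ.<? ∣ m ∣ | d ℕₚ.<? ∣ n ∣
        where
        m = t + - (s + s)
        n = + 5 * s + + 2 + (m + m)
      ... | yes d<m | _ = F-off₁ (t + - (s + s)) (+ 5 * s + + 2 + (t + - (s + s) + (t + - (s + s)))) d<m
      ... | no _ | yes d<n = F-off₂ (t + - (s + s)) (+ 5 * s + + 2 + (t + - (s + s) + (t + - (s + s)))) d<n
      ... | no d≮m | no d≮n = contradiction
        (ℕₚ.≤-trans (ℕₚ.*-monoʳ-≤ 5 d<s)
        (ℕₚ.≤-trans ∣5s∣ (ℕₚ.≤-trans (ℕₚ.+-mono-≤ (ℕₚ.+-mono-≤ (ℕₚ.≮⇒≥ d≮n) (∣z+z∣≤ m (ℕₚ.≮⇒≥ d≮m))) ℕₚ.≤-refl)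
        (ℕₚ.m≤m+n _ (d ℕ.+ d ℕ.+ 2)))))
                                  (ℕₚ.<⇒≱ (ℕₚ.≤-reflexive (lemma d)))
        where
        m = t + - (s + s)
        n = + 5 * s + + 2 + (m + m)
        lemma : ∀ d → suc (d ℕ.+ (d ℕ.+ d) ℕ.+ 2 ℕ.+ (d ℕ.+ d ℕ.+ 2)) ≡ 5 ℕ.* suc d
        lemma = solve-∀ℕ
        solve-s : ∀ s m → + 5 * s ≡ (+ 5 * s + + 2 + (m + m)) + - (m + m) + -[1+ 1 ]
        solve-s = solve-∀
        ∣5s∣ : 5 ℕ.* ∣ s ∣ ≤ ∣ n ∣ ℕ.+ ∣ m + m ∣ ℕ.+ 2
        ∣5s∣ = ℕₚ.≤-trans (ℕₚ.≤-reflexive (trans (sym (ℤₚ.abs-* (+ 5) s)) (cong ∣_∣ (solve-s s m))))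
          (ℕₚ.≤-trans (ℤₚ.∣i+j∣≤∣i∣+∣j∣ (n + - (m + m)) -[1+ 1 ]) (ℕₚ.+-monoˡ-≤ 2
            (ℕₚ.≤-trans (ℤₚ.∣i+j∣≤∣i∣+∣j∣ n (- (m + m)))
              (ℕₚ.≤-reflexive (cong (∣ n ∣ ℕ.+_) (ℤₚ.∣-i∣≡∣i∣ (m + m)))))))

    coeff-dissection : (θ₁ · θ₂) d ≡
      (q^ 0 · dil 5 (θ₂ · θ₂)) d + - (q^ 1 · dil 5 (θ₁ · θ₂)) d + - (q^ 2 · dil 5 (θ₁ · θ₁)) d
    coeff-dissection = begin
      (θ₁ · θ₂) d                      ≡⟨ coeff-theta-* θ₁-isTheta θ₂-isTheta d d d ℕₚ.≤-refl ℕₚ.≤-refl ⟩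
      sumℤ d (λ m → sumℤ d (F m))          ≡⟨ cosets ⟩
      coset (+ 0) + coset (+ 1) + coset -[1+ 0 ] + coset (+ 2) + coset -[1+ 1 ]
        ≡⟨ cong₂ _+_ (cong₂ _+_ (cong₂ _+_ (cong₂ _+_ coset-0 coset-1) coset-₋1) coset-2) coset-₋2 ⟩
      _                                    ≡⟨ lemma ((q^ 0 · dil 5 (θ₂ · θ₂)) d) ((q^ 1 · dil 5 (θ₁ · θ₂)) d)
        ((q^ 2 · dil 5 (θ₁ · θ₁)) d) ⟩
      _                                    ∎
      where
      open ≡-Reasoning
      lemma : ∀ a b c → a + - c + + 0 + + 0 + - b ≡ a + - b + - c
      lemma = solve-∀

  -- Divided by θ₁ θ₂ at q⁵ the right side is 1/R(q⁵) - q - q² R(q⁵), because R = θ₁/θ₂.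
  dissection : Mod._≈_ (+ 0) (θ₁ · θ₂)
    (q^ 0 · dil 5 (θ₂ · θ₂) ⊟ q^ 1 · dil 5 (θ₁ · θ₂) ⊟ q^ 2 · dil 5 (θ₁ · θ₁))
  dissection = Mod.≗⇒≈ (+ 0) λ d → trans (Dissection.coeff-dissection d)
    (sym (trans (coeff-+ _ _ d)
      (cong₂ _+_ (trans (coeff-+ _ _ d) (cong (λ x → (q^ 0 · dil 5 (θ₂ · θ₂)) d + x) (coeff-neg _ d)))
      (coeff-neg _ d))))

open FiveDissection

-- Logarithmic derivatives, and the norm over the fifth roots of unity.

module LogarithmicDerivatives where
  open SeriesRing

  open SeriesMod (+ 0)
  open Substitutions (+ 0)
  open Support (+ 0)

  -- The derivation q d/dq, which unlike d/dq leaves every exponent where it is, whence `Supp-𝐃`.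
  𝐃 : Series → Series
  𝐃 f n = + n ℤ.* f n

  𝐃-cong : ∀ {f g} → f ≈ g → 𝐃 f ≈ 𝐃 g
  𝐃-cong h = ≗⇒≈ λ n → cong (+ n ℤ.*_) (exact-≡ h n)

  𝐃-+ : ∀ f g → 𝐃 (f + g) ≈ 𝐃 f + 𝐃 g
  𝐃-+ f g = ≗⇒≈ λ n → ≡-trans (cong (+ n ℤ.*_) (coeff-+ f g n))
    (≡-trans (ℤₚ.*-distribˡ-+ (+ n) (f n) (g n)) (≡-sym (coeff-+ (𝐃 f) (𝐃 g) n)))

  𝐃-neg : ∀ f → 𝐃 (- f) ≈ - 𝐃 f
  𝐃-neg f = ≗⇒≈ λ n → ≡-trans (cong (+ n ℤ.*_) (coeff-neg f n))
    (≡-trans (≡-sym (ℤₚ.neg-distribʳ-* (+ n) (f n))) (≡-sym (coeff-neg (𝐃 f) n)))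

  𝐃-* : ∀ f g → 𝐃 (f * g) ≈ 𝐃 f * g + f * 𝐃 g
  𝐃-* f g = ≗⇒≈ λ n → ≡-trans (cong (+ n ℤ.*_) (coeff-* f g n)) (≡-trans (≡-sym (sumBelow-*ˡ (suc n) (+ n) _))
    (≡-trans (sumBelow-cong (suc n) (λ { k (s≤s k≤n) → leibniz n k k≤n }))
      (≡-trans (sumBelow-+ (suc n) _ _)
        (≡-sym (≡-trans (coeff-+ (𝐃 f * g) (f * 𝐃 g) n)
          (cong₂ ℤ._+_ (coeff-* (𝐃 f) g n) (coeff-* f (𝐃 g) n)))))))
    where
    lemma : ∀ k l x y → (k ℤ.+ l) ℤ.* (x ℤ.* y) ≡ k ℤ.* x ℤ.* y ℤ.+ x ℤ.* (l ℤ.* y)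
    lemma = solve-∀
    leibniz : ∀ n k → k ≤ n → + n ℤ.* (f k ℤ.* g (n ℕ.∸ k)) ≡ + k ℤ.* f k ℤ.* g (n ℕ.∸ k)
      ℤ.+ f k ℤ.* (+ (n ℕ.∸ k) ℤ.* g (n ℕ.∸ k))
    leibniz n k k≤n = ≡-trans (cong (λ x → + x ℤ.* (f k ℤ.* g (n ℕ.∸ k))) (≡-sym (ℕₚ.m+[n∸m]≡n k≤n)))
      (lemma (+ k) (+ (n ℕ.∸ k)) (f k) (g (n ℕ.∸ k)))

  𝐃-const : ∀ c → 𝐃 (const c) ≈ # 0
  𝐃-const c = ≗⇒≈ λ { zero → ≡-refl ; (suc n) → ℤₚ.*-zeroʳ (+ suc n) }

  𝐃-q^ : ∀ e → 𝐃 (q^ e) ≈ const (+ e) * q^ e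
  𝐃-q^ e = ≗⇒≈ λ n → ≡-trans (eq n) (≡-sym (≡-trans (coeff-* (const (+ e)) (q^ e) n) (const-⊛ (+ e) (q^ e) n)))
    where
    eq : ∀ n → + n ℤ.* q^ e n ≡ + e ℤ.* q^ e n
    eq n with n ≡ᵇ e in h
    ... | true  = cong (λ x → + x ℤ.* + 1) (ℕₚ.≡ᵇ⇒≡ n e (subst Bool.T (≡-sym h) _))
    ... | false = ≡-trans (ℤₚ.*-zeroʳ (+ n)) (≡-sym (ℤₚ.*-zeroʳ (+ e)))

  𝐃-^ : ∀ f a → 𝐃 f ≈ f * a → ∀ n → 𝐃 (f ^ n) ≈ const (+ n) * f ^ n * a
  𝐃-^ f a h zero    = trans (𝐃-const (+ 1)) (solve 1 (λ a → :# 0 := :# 0 :* :# 1 :* a) refl a)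
  𝐃-^ f a h (suc n) = trans (𝐃-* f (f ^ n)) (trans (+-cong (*-cong h refl) (*-cong refl (𝐃-^ f a h n)))
    (trans (solve 4 (λ f a F c → f :* a :* F :+ f :* (c :* F :* a) := (:# 1 :+ c) :* (f :* F) :* a) refl f a
      (f ^ n) (const (+ n)))
      (*-cong (*-cong (sym (+-homo (+ 1) (+ n))) refl) refl)))

  ld : Series → Series
  ld f = 𝐃 f * inv f

  ld-unique : ∀ {f a} → f 0 ≡ + 1 → 𝐃 f ≈ f * a → ld f ≈ a
  ld-unique {f} {a} f0 h = trans (*-cong h refl)
    (trans (solve 3 (λ f a i → f :* a :* i := f :* i :* a) refl f a (inv f))
    (trans (*-cong (*-inv f f0) refl) (*-identityˡ a)))

  𝐃≈ld : ∀ {f} → f 0 ≡ + 1 → 𝐃 f ≈ f * ld f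
  𝐃≈ld {f} f0 = sym (trans (solve 3 (λ f d i → f :* (d :* i) := f :* i :* d) refl f (𝐃 f) (inv f))
    (trans (*-cong (*-inv f f0) refl) (*-identityˡ (𝐃 f))))

  ld-cong : ∀ {f g} → f 0 ≡ + 1 → g 0 ≡ + 1 → f ≈ g → ld f ≈ ld g
  ld-cong {f} {g} f0 g0 h = ld-unique f0 (trans (𝐃-cong h) (trans (𝐃≈ld g0) (*-cong (sym h) refl)))

  ld-* : ∀ {f g} → f 0 ≡ + 1 → g 0 ≡ + 1 → ld (f * g) ≈ ld f + ld g
  ld-* {f} {g} f0 g0 = ld-unique (*-0 {f} {g} f0 g0)
    (trans (𝐃-* f g) (trans (+-cong (*-cong (𝐃≈ld f0) refl) (*-cong refl (𝐃≈ld g0)))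
    (solve 4 (λ f g a b → f :* a :* g :+ f :* (g :* b) := f :* g :* (a :+ b)) refl f g (ld f) (ld g))))

  ld-^ : ∀ {f} → f 0 ≡ + 1 → ∀ n → ld (f ^ n) ≈ const (+ n) * ld f
  ld-^ {f} f0 n = ld-unique (^-0 {f} n f0) (trans (𝐃-^ f (ld f) (𝐃≈ld f0) n)
    (solve 3 (λ c F a → c :* F :* a := F :* (c :* a)) refl (const (+ n)) (f ^ n) (ld f)))

  ld-≡≤ : ∀ {N f g} → f ≡[≤ N ] g → ld f ≡[≤ N ] ld g
  ld-≡≤ {N} {f} {g} h = *-≡≤ {N} {𝐃 f} {𝐃 g} (λ n n≤N → cong (+ n ℤ.*_) (h n n≤N)) (inv-≡≤ h)

  -- The quotient r = g/f has 𝐃 r = 0; as ℤ has no torsion, r is constant, and its constant term is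
  -- 1.
  ld-injective : ∀ {f g} → f 0 ≡ + 1 → g 0 ≡ + 1 → ld f ≈ ld g → f ≈ g
  ld-injective {f} {g} f0 g0 h = trans (sym (trans (*-cong ratio refl) (*-identityˡ f))) rf≈g
    where
    r : Series
    r = g * inv f
    r0 : r 0 ≡ + 1
    r0 = *-0 {g} {inv f} g0 ≡-refl
    rf≈g : r * f ≈ g
    rf≈g = trans (solve 3 (λ g i f → g :* i :* f := g :* (f :* i)) refl g (inv f) f)
      (trans (*-cong refl (*-inv f f0)) (*-identityʳ g))
    𝐃r≈0 : 𝐃 r ≈ # 0
    𝐃r≈0 = cancelˡ {f} f0 (combine
      (solve 5 (λ f Dr r Df a → f :* Dr := f :* :# 0 :+
          (:# 1 :* (Dr :* f :+ r :* Df :- r :* f :* a) :+ (:- r) :* (Df :- f :* a))) refl f (𝐃 r) r (𝐃 f)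
            (ld f))
      (# 1 ⊡ trans (sym (𝐃-* r f)) (trans (𝐃-cong rf≈g) (trans (𝐃≈ld g0) (*-cong (sym rf≈g) (sym h))))
        ⊞ (- r) ⊡ 𝐃≈ld f0))
    ratio : r ≈ # 1
    ratio = ≗⇒≈ λ { zero → r0 ; (suc n) → ℤₚ.*-cancelˡ-≡ (+ suc n) (r (suc n)) (+ 0)
      (≡-trans (exact-≡ 𝐃r≈0 (suc n)) (≡-sym (ℤₚ.*-zeroʳ (+ suc n)))) }

  Supp-𝐃 : ∀ {d r f} .{{_ : NonZero d}} → Supp d r f → Supp d r (𝐃 f)
  Supp-𝐃 s = supp λ n n≢r → ∼0-*ʳ (+ n) (off s n n≢r)

  Supp-ld : ∀ {d f} .{{_ : NonZero d}} → f 0 ≡ + 1 → Supp d 0 f → Supp d 0 (ld f)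
  Supp-ld {d} {f} f0 s = subst (λ r → Supp d r (ld f)) (0%n≡0 d) (Supp-* (Supp-𝐃 s) (Supp-inv f0 s))

  -- g(q) = ∏ f(ζq) over the fifth roots of unity ζ, expressed through logarithmic derivatives
  record Norm₅ (f g : Series) : Set where
    constructor norm
    field ld-norm : # 5 * π 5 (ld f) ≈ ld g
  open Norm₅

  Norm₅-* : ∀ {f g f′ g′} → f 0 ≡ + 1 → g 0 ≡ + 1 → f′ 0 ≡ + 1 → g′ 0 ≡ + 1 → Norm₅ f f′ → Norm₅ g g′ →
    Norm₅ (f * g) (f′ * g′)
  Norm₅-* {f} {g} {f′} {g′} f0 g0 f′0 g′0 p r =
    norm (trans (*-cong refl (trans (π-cong {5} (ld-* {f} {g} f0 g0)) (π-+ {5} (ld f) (ld g))))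
    (trans (distribˡ (# 5) (π 5 (ld f)) (π 5 (ld g)))
      (trans (+-cong (ld-norm p) (ld-norm r)) (sym (ld-* {f′} {g′} f′0 g′0)))))

  Norm₅-cong : ∀ {f f′ g} → f 0 ≡ + 1 → f′ 0 ≡ + 1 → f ≈ f′ → Norm₅ f g → Norm₅ f′ g
  Norm₅-cong f0 f′0 h p = norm (trans (*-cong refl (π-cong {5} (ld-cong f′0 f0 (sym h)))) (ld-norm p))

  Norm₅-unique : ∀ {f g g′} → g 0 ≡ + 1 → g′ 0 ≡ + 1 → Norm₅ f g → Norm₅ f g′ → g ≈ g′
  Norm₅-unique g0 g′0 p r = ld-injective g0 g′0 (trans (sym (ld-norm p)) (ld-norm r))

  Norm₅-Supp : ∀ {f} → f 0 ≡ + 1 → Supp 5 0 f → Norm₅ f (f ^ 5)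
  Norm₅-Supp f0 s = norm (trans (*-cong refl (π-id {5} (Supp-ld f0 s))) (sym (ld-^ f0 5)))

  factor-0 : ∀ e .{{_ : NonZero e}} → factor e 0 ≡ + 1
  factor-0 (suc e) = +-0 {# 1} ≡-refl (neg-0 {q^ (suc e)} ≡-refl)

  ld-factor : ∀ e → 𝐃 (factor e) ≈ - (const (+ e) * q^ e)
  ld-factor e = trans (𝐃-+ (# 1) (- q^ e))
    (trans (+-cong (𝐃-const (+ 1)) (trans (𝐃-neg (q^ e)) (-‿cong (𝐃-q^ e)))) (+-identityˡ _))

  module _ (e : ℕ) .{{_ : NonZero e}} {r₁ r₂ r₃ r₄}
           (s₁ : Supp 5 (suc r₁) (q^ e ^ 1)) (s₂ : Supp 5 (suc r₂) (q^ e ^ 2))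
           (s₃ : Supp 5 (suc r₃) (q^ e ^ 3)) (s₄ : Supp 5 (suc r₄) (q^ e ^ 4)) where
    private
      x T i : Series
      x = q^ e
      T = factor (e ℕ.* 5)
      i = inv T
      T≈ : T ≈ # 1 - x ^ 5
      T≈ = +-cong refl (-‿cong (trans (reflexive (cong q^ (ℕₚ.*-comm e 5))) (sym (q^-^ (+ 0) e 5))))
      T0 : T 0 ≡ + 1
      T0 = factor-0 (e ℕ.* 5) {{ℕₚ.m*n≢0 e 5}}
      s₅ : Supp 5 0 (x ^ 5)
      s₅ = Supp-cong (trans (reflexive (cong q^ (ℕₚ.*-comm e 5))) (sym (q^-^ (+ 0) e 5)))
             (subst (λ r → Supp 5 r (q^ (e ℕ.* 5))) (m*n%n≡0 e 5) (Supp-q^ (e ℕ.* 5)))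
      sT : Supp 5 0 T
      sT = Supp-cong (sym T≈) (Supp-+ (Supp-const (+ 1)) (Supp-neg s₅))

    -- With x = q^e the logarithmic derivative of 1 - x is -e x/(1 - x) = -e (x + x² + x³ + x⁴ +
    -- x⁵)/(1 - x⁵). When 5 does not divide e, as the four support hypotheses ensure, only x⁵
    -- survives the projection.
    Norm₅-factor : Norm₅ (factor e) T
    Norm₅-factor = norm (trans
      (*-cong refl (trans (π-cong {5} (ld-unique (factor-0 e) deriv))
      (trans (π-* {5} coefficient (x ^ 1 + x ^ 2 + x ^ 3 + x ^ 4 + x ^ 5)) (*-cong refl projection))))
        (sym (ld-unique T0 (trans (ld-factor (e ℕ.* 5)) (combine
          (trans (-‿cong (*-cong (trans (reflexive (cong const (ℤₚ.pos-* e 5))) (*-homo (+ e) (+ 5)))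
            (trans (reflexive (cong q^ (ℕₚ.*-comm e 5))) (sym (q^-^ (+ 0) e 5)))))
            (solve 4 (λ c x T i → :- (c :* :# 5 :* x :^ 5) := T :* (:# 5 :* (:- c :* i :* x :^ 5))
              :+ (:# 5 :* c :* x :^ 5) :* (T :* i :- :# 1)) refl (const (+ e)) x T i))
          ((# 5 * const (+ e) * x ^ 5) ⊡ *-inv T T0))))))
      where
      coefficient : Supp 5 0 (- const (+ e) * i)
      coefficient = Supp-* (Supp-neg (Supp-const (+ e))) (Supp-inv T0 sT)
      deriv : 𝐃 (factor e) ≈ factor e * (- const (+ e) * i * (x ^ 1 + x ^ 2 + x ^ 3 + x ^ 4 + x ^ 5))
      deriv = trans (ld-factor e) (combine
        (solve 4 (λ c x T i → :- (c :* x) :=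
          (:# 1 :- x) :* (:- c :* i :* (x :^ 1 :+ x :^ 2 :+ x :^ 3 :+ x :^ 4 :+ x :^ 5))
            :+ ((:- c :* x :* i) :* (T :- (:# 1 :- x :^ 5)) :+ (c :* x) :* (T :* i :- :# 1))) refl
              (const (+ e)) x T i)
        ((- const (+ e) * x * i) ⊡ T≈ ⊞ (const (+ e) * x) ⊡ *-inv T T0))
      projection : π 5 (x ^ 1 + x ^ 2 + x ^ 3 + x ^ 4 + x ^ 5) ≈ x ^ 5
      projection = trans (π-+ {5} (x ^ 1 + x ^ 2 + x ^ 3 + x ^ 4) (x ^ 5)) (trans (+-cong
          (trans (π-+ {5} (x ^ 1 + x ^ 2 + x ^ 3) (x ^ 4))
            (+-cong (trans (π-+ {5} (x ^ 1 + x ^ 2) (x ^ 3)) (+-cong (trans (π-+ {5} (x ^ 1) (x ^ 2))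
            (+-cong (π-kill {5} r₁ s₁) (π-kill {5} r₂ s₂))) (π-kill {5} r₃ s₃))) (π-kill {5} r₄ s₄)))
              (π-id {5} s₅))
        (solve 1 (λ y → :# 0 :+ :# 0 :+ :# 0 :+ :# 0 :+ y := y) refl (x ^ 5)))

  π-local : ∀ d .{{_ : NonZero d}} → Local (π d)
  π-local d N h n n≤N with (n % d) ≡ᵇ 0
  ... | true  = h n n≤N
  ... | false = ≡-refl

  ∏-0 : ∀ n {F : ℕ → Series} → (∀ k → F k 0 ≡ + 1) → ∏ n F 0 ≡ + 1
  ∏-0 zero    h = ≡-refl
  ∏-0 (suc n) {F} h = *-0 {∏ n F} {F n} (∏-0 n h) (h n)

  -- Partial products have the right norm by multiplicativity, and `ld` and `π 5` are both local, so
  -- each coefficient can be computed from a partial product.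
  Norm₅-infProd : ∀ {F G : ℕ → Series} → Admissible F → Admissible G → (∀ k → F k 0 ≡ + 1) → (∀ k → G k 0 ≡ + 1)
    →
                  (∀ k → Norm₅ (F k) (G k)) → Norm₅ (infProd F) (infProd G)
  Norm₅-infProd {F} {G} aF aG F0 G0 h = norm (≗⇒≈ λ n →
    ≡-trans (*-≡≤ {n} {# 5} {# 5} (λ _ _ → ≡-refl) (π-local 5 n (ld-≡≤ (infProd-≡≤ aF n))) n ℕₚ.≤-refl)
      (≡-trans (exact-≡ (ld-norm (finite n)) n) (ld-≡≤ (≡≤-sym (infProd-≡≤ aG n)) n ℕₚ.≤-refl)))
    where
    finite : ∀ n → Norm₅ (∏ n F) (∏ n G)
    finite zero    = norm (trans (*-cong refl (trans (π-cong {5} ld-1) (π-id {5} (Supp-const (+ 0)))))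
      (trans (zeroʳ (# 5)) (sym ld-1)))
      where
      ld-1 : ld (# 1) ≈ # 0
      ld-1 = ld-unique ≡-refl (trans (𝐃-const (+ 1)) (sym (zeroʳ (# 1))))
    finite (suc n) = Norm₅-* {∏ n F} {F n} {∏ n G} {G n} (∏-0 n F0) (F0 n) (∏-0 n G0) (G0 n) (finite n) (h n)

open LogarithmicDerivatives

-- The quotient R and the Euler product: dissection, norm and Ramanujan's identity.

module RogersRamanujan where
  open SeriesRing

  open SeriesMod (+ 0)
  open Substitutions (+ 0)
  open Support (+ 0)

  opaque
    ℛ 𝐸 : Series
    ℛ = R
    𝐸 = poch 1 1

    ℛ≡R : ℛ ≡ R
    ℛ≡R = ≡-refl

    𝐸≡poch : 𝐸 ≡ poch 1 1
    𝐸≡poch = ≡-refl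

  𝐸-0 : 𝐸 0 ≡ + 1
  𝐸-0 = ≡-trans (cong (λ f → f 0) 𝐸≡poch) (poch-0 1 1)

  p : ℕ → Series
  p i = poch i 5

  p-0 : ∀ i .{{_ : NonZero i}} → p i 0 ≡ + 1
  p-0 i = poch-0 i 5

  ℛ≈ : ℛ ≈ p 1 * p 4 * inv (p 2 * p 3)
  ℛ≈ = reflexive (≡-trans ℛ≡R (cong (λ op → op (op (p 1) (p 4)) (inv (op (p 2) (p 3)))) (≡-sym *≡⊛)))

  ℛ-0 : ℛ 0 ≡ + 1
  ℛ-0 = ≡-trans (exact-≡ ℛ≈ 0) (*-0 {p 1 * p 4} {inv (p 2 * p 3)} (*-0 {p 1} {p 4} (p-0 1) (p-0 4)) ≡-refl)

  dilℛ-0 : ∀ d .{{_ : NonZero d}} → dil d ℛ 0 ≡ + 1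
  dilℛ-0 d = ≡-trans (dil-0 d ℛ) ℛ-0

  dil𝐸-0 : ∀ d .{{_ : NonZero d}} → dil d 𝐸 0 ≡ + 1
  dil𝐸-0 d = ≡-trans (dil-0 d 𝐸) 𝐸-0

  ℛ-quotient : ℛ * (p 2 * p 3) ≈ p 1 * p 4
  ℛ-quotient = trans (*-cong ℛ≈ refl)
    (trans (solve 3 (λ x i y → x :* i :* y := x :* (y :* i)) refl (p 1 * p 4) (inv (p 2 * p 3)) (p 2 * p 3))
    (trans (*-cong refl (*-inv (p 2 * p 3) (*-0 {p 2} {p 3} (p-0 2) (p-0 3)))) (*-identityʳ _)))

  dil5𝐸 : dil 5 𝐸 ≈ p 5
  dil5𝐸 = trans (Dil.τ-cong 5 (reflexive 𝐸≡poch)) (dil-poch 5 1 1)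

  -- The quotient E(q)/E(q⁵): the product over exponents prime to 5, whose norm can be taken factor
  -- by factor.
  coprimePart : Series
  coprimePart = p 1 * p 2 * p 3 * p 4

  𝐸≈ : 𝐸 ≈ coprimePart * dil 5 𝐸
  𝐸≈ = trans (reflexive 𝐸≡poch) (trans (poch-split 5 1 1)
    (trans (solve 5 (λ a b c d e → :# 1 :* a :* b :* c :* d :* e := a :* b :* c :* d :* e) refl (p 1) (p 2)
      (p 3) (p 4) (p 5))
      (*-cong refl (sym dil5𝐸))))

  θ₁θ₂ : θ₁ * θ₂ ≈ 𝐸 * dil 5 𝐸
  θ₁θ₂ = trans (solve 5 (λ a b c d e → e :* (d :* a) :* (e :* (c :* b)) := a :* b :* c :* d :* e :* e) refl
    (p 1) (p 2) (p 3) (p 4) (p 5))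
    (*-cong (trans (*-cong refl (sym dil5𝐸)) (sym 𝐸≈)) (sym dil5𝐸))

  θ₁≈ℛθ₂ : θ₁ ≈ ℛ * θ₂
  θ₁≈ℛθ₂ = trans (solve 3 (λ a d e → e :* (d :* a) := e :* (a :* d)) refl (p 1) (p 4) (p 5))
    (trans (*-cong refl (sym ℛ-quotient))
      (solve 4 (λ r b c e → e :* (r :* (b :* c)) := r :* (e :* (c :* b))) refl ℛ (p 2) (p 3) (p 5)))

  u : Series
  u = q^ 1 * dil 5 ℛ

  u-0 : u 0 ≡ + 0
  u-0 = *-0ˡ {q^ 1} (dil 5 ℛ) ≡-refl

  -- The five-dissection of the Euler function: 𝐸(q) = 𝐸(q²⁵) (1/R(q⁵) - q - q² R(q⁵))
  euler-dissection : 𝐸 * dil 5 ℛ ≈ dil 5 (dil 5 𝐸) * (# 1 - u - u * u)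
  euler-dissection = cancelˡ {dil 5 𝐸} (dil𝐸-0 5) (combine
    (solve 6 (λ E₁ E₅ E₂₅ r t q →
        E₅ :* (E₁ :* r) := E₅ :* (E₂₅ :* (:# 1 :- q :* r :- q :* r :* (q :* r))) :+
        (r :* (E₁ :* E₅ :- (:# 1 :* (t :* t) :- q :* (E₅ :* E₂₅) :- q :* q :* (r :* t :* (r :* t))))
         :+ (:# 1 :- q :* r :* (q :* r)) :* (r :* t :* t :- E₅ :* E₂₅)))
      refl 𝐸 (dil 5 𝐸) (dil 5 (dil 5 𝐸)) (dil 5 ℛ) (dil 5 θ₂) (q^ 1))
    (dil 5 ℛ ⊡ dissected ⊞ (# 1 - q^ 1 * dil 5 ℛ * (q^ 1 * dil 5 ℛ)) ⊡ product))
    where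
    dil-θ₁ : dil 5 θ₁ ≈ dil 5 ℛ * dil 5 θ₂
    dil-θ₁ = trans (Dil.τ-cong 5 θ₁≈ℛθ₂) (Dil.τ-* 5 ℛ θ₂)
    product : dil 5 ℛ * dil 5 θ₂ * dil 5 θ₂ ≈ dil 5 𝐸 * dil 5 (dil 5 𝐸)
    product = trans (*-cong (sym dil-θ₁) refl)
      (trans (sym (Dil.τ-* 5 θ₁ θ₂)) (trans (Dil.τ-cong 5 θ₁θ₂) (Dil.τ-* 5 𝐸 (dil 5 𝐸))))
    dissected : 𝐸 * dil 5 𝐸 ≈ # 1 * (dil 5 θ₂ * dil 5 θ₂) - q^ 1 * (dil 5 𝐸 * dil 5 (dil 5 𝐸)) - q^ 1 * q^ 1
      * (dil 5 ℛ * dil 5 θ₂ * (dil 5 ℛ * dil 5 θ₂))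
    dissected = trans (sym θ₁θ₂) (trans dissection (+-cong (+-cong (*-cong refl (Dil.τ-* 5 θ₂ θ₂))
        (-‿cong (*-cong refl (trans (Dil.τ-cong 5 θ₁θ₂) (Dil.τ-* 5 𝐸 (dil 5 𝐸))))))
      (-‿cong (*-cong (q^-+ (+ 0) 1 1) (trans (Dil.τ-* 5 θ₁ θ₁) (*-cong dil-θ₁ dil-θ₁))))))

  -- P and Q are the quartics in Ramanujan's relation R(q)⁵ = R(q⁵) Q(u)/P(u). T is the norm of 1 -
  -- u - u²: if that is (1 - αu)(1 - βu), then T = (1 - α⁵u⁵)(1 - β⁵u⁵), where αβ = -1 and α⁵ + β⁵ =
  -- 11.
  P Q T : Series → Series
  P u = # 1 + # 3 * u + # 4 * u ^ 2 + # 2 * u ^ 3 + u ^ 4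
  Q u = # 1 - # 2 * u + # 4 * u ^ 2 - # 3 * u ^ 3 + u ^ 4
  T u = # 1 - # 11 * u ^ 5 - u ^ 10

  :P :Q : ∀ {n} → Polynomial n → Polynomial n
  :P u = :# 1 :+ :# 3 :* u :+ :# 4 :* u :^ 2 :+ :# 2 :* u :^ 3 :+ u :^ 4
  :Q u = :# 1 :- :# 2 :* u :+ :# 4 :* u :^ 2 :- :# 3 :* u :^ 3 :+ u :^ 4

  factorisation : ∀ u → (# 1 - u - u * u) * (P u * Q u) ≈ T u
  factorisation = solve 1 (λ u → (:# 1 :- u :- u :* u) :* (:P u :* :Q u) :=
    :# 1 :- :# 11 :* u :^ 5 :- u :^ 10) refl

  -- The form x² - 11xy - y² at x = P, y = uQ. If κ = uQ/P, as `modular-equation` will show, then it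
  -- equals P² (1 - 11κ - κ²), which is how it meets `ramanujan`.
  discriminant : ∀ u → P u * P u - # 11 * u * P u * Q u - u * u * Q u * Q u ≈ (# 1 - u - u * u) ^ 5
  discriminant = solve 1 (λ u → :P u :* :P u :- :# 11 :* u :* :P u :* :Q u :- u :* u :* :Q u :* :Q u :=
    (:# 1 :- u :- u :* u) :^ 5) refl

  sumOfMonomials : (u c₁ c₂ c₃ c₄ c₅ c₆ c₇ c₈ c₉ c₁₀ : Series) → Series
  sumOfMonomials u c₁ c₂ c₃ c₄ c₅ c₆ c₇ c₈ c₉ c₁₀ =
    c₁ * u ^ 1 + c₂ * u ^ 2 + c₃ * u ^ 3 + c₄ * u ^ 4 + c₅ * u ^ 5 + c₆ * u ^ 6 + c₇ * u ^ 7 + c₈ * u ^ 8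
      + c₉ * u ^ 9 + c₁₀ * u ^ 10

  u-Supp : Supp 5 1 u
  u-Supp = Supp-* (Supp-q^ {5} 1) (Supp-dil ℛ)

  1-u-u²-0 : (# 1 - u - u * u) 0 ≡ + 1
  1-u-u²-0 = +-0 {# 1 - u} (+-0 {# 1} ≡-refl (neg-0 {u} u-0)) (neg-0 {u * u} (*-0ˡ {u} u u-0))

  T-0 : ∀ v → v 0 ≡ + 0 → T v 0 ≡ + 1
  T-0 v v0 = +-0 {# 1 - # 11 * v ^ 5} (+-0 {# 1} ≡-refl (neg-0 {# 11 * v ^ 5}
      (≡-trans (coeff-* (# 11) (v ^ 5) 0)
        (≡-trans (const-⊛ (+ 11) (v ^ 5) 0) (cong (+ 11 ℤ.*_) (*-0ˡ {v} (v ^ 4) v0))))))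
    (neg-0 {v ^ 10} (*-0ˡ {v} (v ^ 9) v0))

  T-Supp : Supp 5 0 (T u)
  T-Supp = Supp-+ (Supp-+ (Supp-const (+ 1)) (Supp-neg (Supp-* {d = 5} (Supp-const (+ 11)) (Supp-^ u-Supp 5))))
    (Supp-neg (Supp-^ u-Supp 10))

  -- With M = 𝐃 u / u the logarithmic derivative is -M (u + 2u²)/(1 - u - u²) = -M (u + 2u²) P Q/T.
  -- As M and T are series in q⁵ and u has exponents in the class 1, the projection keeps only 11u⁵
  -- + 2u¹⁰ from (u + 2u²) P Q, and five times this accounts for the 55 and the 10 in 𝐃 T.
  Norm₅-1-u-u² : Norm₅ (# 1 - u - u * u) (T u)
  Norm₅-1-u-u² = norm (trans
    (*-cong refl (trans (π-cong {5} (ld-unique 1-u-u²-0 derivative))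
    (trans (π-* {5} M/T-Supp _) (*-cong refl projection))))
    (sym (ld-unique (T-0 u u-0) (trans 𝐃T (combine
      (solve 4 (λ u M T i → :- (:# 55 :* u :^ 5 :* M) :- :# 10 :* u :^ 10 :* M :=
          T :* (:# 5 :* (M :* i :* :- (:# 11 :* u :^ 5 :+ :# 2 :* u :^ 10))) :+
          (:# 5 :* M :* (:# 11 :* u :^ 5 :+ :# 2 :* u :^ 10)) :* (T :* i :- :# 1)) refl u M (T u) (inv (T u)))
      ((# 5 * M * (# 11 * u ^ 5 + # 2 * u ^ 10)) ⊡ *-inv (T u) (T-0 u u-0)))))))
    where
    -- The quotient 𝐃 u / u is written by hand because u has no constant term; its factor q
    -- contributes the 1.
    M : Series
    M = # 1 + ld (dil 5 ℛ)
    M-Supp : Supp 5 0 M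
    M-Supp = Supp-+ (Supp-const (+ 1)) (Supp-ld (dilℛ-0 5) (Supp-dil ℛ))
    M/T-Supp : Supp 5 0 (M * inv (T u))
    M/T-Supp = Supp-* {d = 5} M-Supp (Supp-inv (T-0 u u-0) T-Supp)
    𝐃u : 𝐃 u ≈ u * M
    𝐃u = trans (𝐃-* (q^ 1) (dil 5 ℛ)) (trans (+-cong (*-cong (𝐃-q^ 1) refl) (*-cong refl (𝐃≈ld (dilℛ-0 5))))
      (solve 3 (λ q r l → :# 1 :* q :* r :+ q :* (r :* l) := q :* r :* (:# 1 :+ l)) refl (q^ 1) (dil 5 ℛ)
        (ld (dil 5 ℛ))))
    𝐃-1-u-u² : 𝐃 (# 1 - u - u * u) ≈ - (u * M) - # 2 * (u * u) * M
    𝐃-1-u-u² = trans (𝐃-+ (# 1 - u) (- (u * u)))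
      (trans (+-cong (trans (𝐃-+ (# 1) (- u)) (+-cong (𝐃-const (+ 1)) (trans (𝐃-neg u) (-‿cong 𝐃u))))
        (trans (𝐃-neg (u * u)) (-‿cong (trans (𝐃-* u u) (+-cong (*-cong 𝐃u refl) (*-cong refl 𝐃u))))))
      (solve 2 (λ u M → :# 0 :- u :* M :- (u :* M :* u :+ u :* (u :* M))
        := :- (u :* M) :- :# 2 :* (u :* u) :* M) refl u M))
    𝐃T : 𝐃 (T u) ≈ - (# 55 * u ^ 5 * M) - # 10 * u ^ 10 * M
    𝐃T = trans (𝐃-+ (# 1 - # 11 * u ^ 5) (- u ^ 10)) (+-cong
      (trans (𝐃-+ (# 1) (- (# 11 * u ^ 5))) (trans (+-cong (𝐃-const (+ 1)) (trans (𝐃-neg (# 11 * u ^ 5)) (-‿cong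
        (trans (𝐃-* (# 11) (u ^ 5)) (+-cong (*-cong (𝐃-const (+ 11)) refl) (*-cong refl (𝐃-^ u M 𝐃u 5)))))))
        (solve 2 (λ U M → :# 0 :- (:# 0 :* U :+ :# 11 :* (:# 5 :* U :* M)) := :- (:# 55 :* U :* M)) refl
          (u ^ 5) M)))
      (trans (𝐃-neg (u ^ 10)) (-‿cong (𝐃-^ u M 𝐃u 10))))
    S : Series
    S = sumOfMonomials u (# 1) (# 3) (# 4) (# 7) (# 11) (# 7) (const (ℤ.- + 4)) (# 3) (const (ℤ.- + 1)) (# 2)
    expansion : (u + # 2 * (u * u)) * (P u * Q u) ≈ S
    expansion = solve 1 (λ u → (u :+ :# 2 :* (u :* u)) :* (:P u :* :Q u) :=
      :# 1 :* u :^ 1 :+ :# 3 :* u :^ 2 :+ :# 4 :* u :^ 3 :+ :# 7 :* u :^ 4 :+ :# 11 :* u :^ 5 :+ :# 7 :* u :^ 6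
      :+ con (ℤ.- + 4) :* u :^ 7 :+ :# 3 :* u :^ 8 :+ con (ℤ.- + 1) :* u :^ 9 :+ :# 2 :* u :^ 10) refl u
    derivative : 𝐃 (# 1 - u - u * u) ≈ (# 1 - u - u * u) * (M * inv (T u) * - S)
    derivative = trans 𝐃-1-u-u² (combine
      (solve 7 (λ u M T i S PQ f → :- (u :* M) :- :# 2 :* (u :* u) :* M := f :* (M :* i :* :- S) :+
          ((:- M :* i :* f) :* ((u :+ :# 2 :* (u :* u)) :* PQ :- S)
            :+ (M :* i :* (u :+ :# 2 :* (u :* u))) :* (f :* PQ :- T)
           :+ (M :* (u :+ :# 2 :* (u :* u))) :* (T :* i :- :# 1))) refl u M (T u) (inv (T u)) S (P u * Q u)
             (# 1 - u - u * u))
      ((- M * inv (T u) * (# 1 - u - u * u)) ⊡ expansion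
        ⊞ (M * inv (T u) * (u + # 2 * (u * u))) ⊡ factorisation u
        ⊞ (M * (u + # 2 * (u * u))) ⊡ *-inv (T u) (T-0 u u-0)))
    scaled : ∀ c k → Supp 5 ((k ℕ.* 1) % 5 % 5) (const c * u ^ k)
    scaled c k = Supp-* {d = 5} (Supp-const c) (Supp-^ u-Supp k)
    kill : ∀ {f g} r → Supp 5 (suc r) g → π 5 (f + g) ≈ π 5 f
    kill {f} {g} r s = trans (π-+ {5} f g) (trans (+-cong refl (π-kill {5} r s)) (+-identityʳ _))
    π-neg : ∀ f → π 5 (- f) ≈ - π 5 f
    π-neg f = trans (π-cong {5} (solve 1 (λ f → :- f := con (ℤ.- + 1) :* f) refl f))
      (trans (π-* {5} (Supp-const (ℤ.- + 1)) f) (solve 1 (λ f → con (ℤ.- + 1) :* f := :- f) refl (π 5 f)))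
    projection : π 5 (- S) ≈ - (# 11 * u ^ 5 + # 2 * u ^ 10)
    projection = trans (π-neg S) (-‿cong (trans (π-+ {5} _ _) (+-cong
      (trans (kill 3 (scaled _ 9))
        (trans (kill 2 (scaled _ 8)) (trans (kill 1 (scaled _ 7)) (trans (kill 0 (scaled _ 6))
        (trans (π-+ {5} _ _) (trans (+-cong
          (trans (kill 3 (scaled _ 4))
            (trans (kill 2 (scaled _ 3)) (trans (kill 1 (scaled _ 2)) (π-kill {5} 0 (scaled _ 1)))))
          (π-id {5} (scaled _ 5))) (+-identityˡ _)))))))
      (π-id {5} (scaled _ 10)))))

  -- The numerical hypotheses say that i is a nonzero reduced residue modulo 5, so every exponent i
  -- + 5k has its first four multiples prime to 5.
  Norm₅-p : ∀ i .{{_ : NonZero i}} {r₁ r₂ r₃ r₄} → (1 ℕ.* i) % 5 ≡ suc r₁ → (2 ℕ.* i) % 5 ≡ suc r₂ →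
    (3 ℕ.* i) % 5 ≡ suc r₃ → (4 ℕ.* i) % 5 ≡ suc r₄ → i % 5 ≡ i →
            Norm₅ (p i) (dil 5 (p i))
  Norm₅-p i e₁ e₂ e₃ e₄ e =
    Norm₅-congˡʳ (Norm₅-infProd adm (τ-admissible (dil-isSubst 5) (dil-local 5) adm) F0
    (λ k → ≡-trans (dil-0 5 (factor (expo k))) (F0 k)) factors)
    where
    expo : ℕ → ℕ
    expo k = i ℕ.+ 5 ℕ.* k
    nz : ∀ k → NonZero (expo k)
    nz k = ℕ.>-nonZero (ℕₚ.≤-trans (ℕ.>-nonZero⁻¹ i) (ℕₚ.m≤m+n i _))
    adm : Admissible (λ k → factor (expo k))
    adm = pochFactor-admissible i 5
    F0 : ∀ k → factor (expo k) 0 ≡ + 1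
    F0 k = factor-0 (expo k) {{nz k}}
    class : ∀ k → expo k % 5 ≡ i
    class k = ≡-trans (cong (λ x → (i ℕ.+ x) % 5) (ℕₚ.*-comm 5 k)) (≡-trans ([m+kn]%n≡m%n i k 5) e)
    q-Supp : ∀ k → Supp 5 i (q^ (expo k))
    q-Supp k = subst (λ r → Supp 5 r (q^ (expo k))) (class k) (Supp-q^ (expo k))
    power : ∀ {r} k n → (n ℕ.* i) % 5 ≡ suc r → Supp 5 (suc r) (q^ (expo k) ^ n)
    power k n h = subst (λ r → Supp 5 r (q^ (expo k) ^ n)) h (Supp-^ (q-Supp k) n)
    dil-factor : ∀ e → dil 5 (factor e) ≈ factor (e ℕ.* 5)
    dil-factor e = trans (Dil.τ-+ 5 (# 1) (- q^ e))
      (+-cong (Dil.τ-const 5 (+ 1)) (trans (Dil.τ-neg 5 (q^ e)) (-‿cong (dil-q^ 5 e))))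
    factors : ∀ k → Norm₅ (factor (expo k)) (dil 5 (factor (expo k)))
    factors k = norm (trans (Norm₅.ld-norm
      (Norm₅-factor (expo k) {{nz k}} (power k 1 e₁) (power k 2 e₂) (power k 3 e₃) (power k 4 e₄)))
      (ld-cong (≡-trans (≡-sym (exact-≡ (dil-factor (expo k)) 0)) (≡-trans (dil-0 5 (factor (expo k))) (F0 k)))
        (≡-trans (dil-0 5 (factor (expo k))) (F0 k)) (sym (dil-factor (expo k)))))
    p≈ : p i ≈ infProd (λ k → factor (expo k))
    p≈ = poch≈ i 5
    inf0 : infProd (λ k → factor (expo k)) 0 ≡ + 1
    inf0 = ≡-trans (≡-sym (exact-≡ p≈ 0)) (p-0 i)
    dilp≈ : infProd (λ k → dil 5 (factor (expo k))) ≈ dil 5 (p i)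
    dilp≈ = sym (trans (Dil.τ-cong 5 p≈) (τ-infProd (dil-isSubst 5) (dil-local 5) adm))
    dilp0 : dil 5 (p i) 0 ≡ + 1
    dilp0 = ≡-trans (dil-0 5 (p i)) (p-0 i)
    Norm₅-congˡʳ : Norm₅ (infProd (λ k → factor (expo k))) (infProd (λ k → dil 5 (factor (expo k)))) →
      Norm₅ (p i) (dil 5 (p i))
    Norm₅-congˡʳ h = Norm₅-cong inf0 (p-0 i) (sym p≈)
      (norm (trans (Norm₅.ld-norm h) (ld-cong (≡-trans (exact-≡ dilp≈ 0) dilp0) dilp0 dilp≈)))

  dilp-0 : ∀ i .{{_ : NonZero i}} → dil 5 (p i) 0 ≡ + 1
  dilp-0 i = ≡-trans (dil-0 5 (p i)) (p-0 i)

  coprimePart-0 : coprimePart 0 ≡ + 1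
  coprimePart-0 = *-0 {p 1 * p 2 * p 3} (*-0 {p 1 * p 2} (*-0 {p 1} (p-0 1) (p-0 2)) (p-0 3)) (p-0 4)

  Norm₅-coprimePart : Norm₅ coprimePart (dil 5 (p 1) * dil 5 (p 2) * dil 5 (p 3) * dil 5 (p 4))
  Norm₅-coprimePart =
    Norm₅-* {p 1 * p 2 * p 3} {p 4} (*-0 {p 1 * p 2} (*-0 {p 1} (p-0 1) (p-0 2)) (p-0 3)) (p-0 4)
      (*-0 {dil 5 (p 1) * dil 5 (p 2)} (*-0 {dil 5 (p 1)} (dilp-0 1) (dilp-0 2)) (dilp-0 3)) (dilp-0 4)
      (Norm₅-* {p 1 * p 2} {p 3} (*-0 {p 1} (p-0 1) (p-0 2)) (p-0 3) (*-0 {dil 5 (p 1)} (dilp-0 1) (dilp-0 2))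
        (dilp-0 3)
        (Norm₅-* {p 1} {p 2} (p-0 1) (p-0 2) (dilp-0 1) (dilp-0 2)
          (Norm₅-p 1 ≡-refl ≡-refl ≡-refl ≡-refl ≡-refl) (Norm₅-p 2 ≡-refl ≡-refl ≡-refl ≡-refl ≡-refl))
        (Norm₅-p 3 ≡-refl ≡-refl ≡-refl ≡-refl ≡-refl))
      (Norm₅-p 4 ≡-refl ≡-refl ≡-refl ≡-refl ≡-refl)

  dil-coprimePart : dil 5 (p 1) * dil 5 (p 2) * dil 5 (p 3) * dil 5 (p 4) * dil 5 (dil 5 𝐸) ≈ dil 5 𝐸
  dil-coprimePart = sym (trans (Dil.τ-cong 5 𝐸≈) (trans (Dil.τ-* 5 coprimePart (dil 5 𝐸)) (*-cong
    (trans (Dil.τ-* 5 (p 1 * p 2 * p 3) (p 4))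
      (*-cong (trans (Dil.τ-* 5 (p 1 * p 2) (p 3)) (*-cong (Dil.τ-* 5 (p 1) (p 2)) refl)) refl)) refl)))

  -- The norm of `euler-dissection`. On the left `coprimePart` has norm E(q⁵)/E(q²⁵) and the other
  -- factors, being series in q⁵, are raised to the fifth power; the right side gives E(q²⁵)⁵ T.
  -- Multiplying by E(q²⁵) clears the quotient.
  norm-identity : dil 5 (dil 5 𝐸) ^ 6 * T u ≈ dil 5 𝐸 ^ 6 * dil 5 ℛ ^ 5
  norm-identity = combine
    (solve 5 (λ E₂₅ T F E₅ r → E₂₅ :^ 6 :* T := E₅ :^ 6 :* r :^ 5 :+
        (E₂₅ :* (E₂₅ :^ 5 :* T :- F :* E₅ :^ 5 :* r :^ 5) :+ (E₅ :^ 5 :* r :^ 5) :* (F :* E₂₅ :- E₅))) refl E₂₅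
          (T u) F₅ E₅ r)
    (E₂₅ ⊡ Norm₅-unique g0 g′0
      (Norm₅-* {E₂₅} {f} E₂₅0 1-u-u²-0 (^-0 {E₂₅} 5 E₂₅0) (T-0 u u-0)
      (Norm₅-Supp E₂₅0 (Supp-dil E₅)) Norm₅-1-u-u²) left
      ⊞ (E₅ ^ 5 * r ^ 5) ⊡ dil-coprimePart)
    where
    E₅ E₂₅ r f F₅ : Series
    E₅ = dil 5 𝐸
    E₂₅ = dil 5 E₅
    r = dil 5 ℛ
    f = # 1 - u - u * u
    F₅ = dil 5 (p 1) * dil 5 (p 2) * dil 5 (p 3) * dil 5 (p 4)
    E₂₅0 : E₂₅ 0 ≡ + 1
    E₂₅0 = ≡-trans (dil-0 5 E₅) (dil𝐸-0 5)
    F₅0 : F₅ 0 ≡ + 1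
    F₅0 = *-0 {dil 5 (p 1) * dil 5 (p 2) * dil 5 (p 3)}
      (*-0 {dil 5 (p 1) * dil 5 (p 2)} (*-0 {dil 5 (p 1)} (dilp-0 1) (dilp-0 2)) (dilp-0 3)) (dilp-0 4)
    FE0 : (F₅ * E₅ ^ 5) 0 ≡ + 1
    FE0 = *-0 {F₅} F₅0 (^-0 {E₅} 5 (dil𝐸-0 5))
    g0 : (E₂₅ ^ 5 * T u) 0 ≡ + 1
    g0 = *-0 {E₂₅ ^ 5} (^-0 {E₂₅} 5 E₂₅0) (T-0 u u-0)
    g′0 : (F₅ * E₅ ^ 5 * r ^ 5) 0 ≡ + 1
    g′0 = *-0 {F₅ * E₅ ^ 5} FE0 (^-0 {r} 5 (dilℛ-0 5))
    left : Norm₅ (E₂₅ * f) (F₅ * E₅ ^ 5 * r ^ 5)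
    left = Norm₅-cong (*-0 {coprimePart * E₅} (*-0 {coprimePart} coprimePart-0 (dil𝐸-0 5)) (dilℛ-0 5))
      (*-0 {E₂₅} E₂₅0 1-u-u²-0)
      (trans (*-cong (sym 𝐸≈) refl) euler-dissection)
      (Norm₅-* {coprimePart * E₅} {r} (*-0 {coprimePart} coprimePart-0 (dil𝐸-0 5)) (dilℛ-0 5) FE0
        (^-0 {r} 5 (dilℛ-0 5))
        (Norm₅-* {coprimePart} {E₅} coprimePart-0 (dil𝐸-0 5) F₅0 (^-0 {E₅} 5 (dil𝐸-0 5)) Norm₅-coprimePart
          (Norm₅-Supp (dil𝐸-0 5) (Supp-dil 𝐸)))
        (Norm₅-Supp (dilℛ-0 5) (Supp-dil ℛ)))

  κ : Series
  κ = q^ 1 * ℛ ^ 5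

  -- Hence `T u` is 1 - 11κ - κ² taken at q⁵, all of `norm-identity` is a statement in q⁵, and
  -- `dil-injective` can bring it down to q.
  dil-κ : dil 5 κ ≈ u ^ 5
  dil-κ = trans (Dil.τ-* 5 (q^ 1) (ℛ ^ 5)) (trans (*-cong (Dil.τ-q^ 5 1) (Dil.τ-^ 5 ℛ 5))
    (trans (*-cong (trans (*-identityʳ (q^ 5)) (sym (q^-^ (+ 0) 1 5))) refl)
      (sym (^-distrib-* (q^ 1) (dil 5 ℛ) 5))))

  -- 1/R⁵ - 11 q - q² R⁵ = 𝐸(q)⁶ / 𝐸(q⁵)⁶
  ramanujan : dil 5 𝐸 ^ 6 * (# 1 - # 11 * κ - κ * κ) ≈ 𝐸 ^ 6 * ℛ ^ 5
  ramanujan = dil-injective 5 (trans (Dil.τ-* 5 (dil 5 𝐸 ^ 6) _)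
    (trans (*-cong (Dil.τ-^ 5 (dil 5 𝐸) 6) (trans (Dil.τ-+ 5 _ _) (trans (+-cong
        (trans (Dil.τ-+ 5 _ _) (+-cong (Dil.τ-const 5 (+ 1))
          (trans (Dil.τ-neg 5 _) (-‿cong (trans (Dil.τ-scale 5 (+ 11) κ) (*-cong refl dil-κ))))))
        (trans (Dil.τ-neg 5 _) (-‿cong (trans (Dil.τ-* 5 κ κ) (*-cong dil-κ dil-κ)))))
        (solve 1 (λ u → :# 1 :- :# 11 :* u :^ 5 :- u :^ 5 :* u :^ 5 :=
          :# 1 :- :# 11 :* u :^ 5 :- u :^ 10) refl u))))
      (trans norm-identity (sym (trans (Dil.τ-* 5 (𝐸 ^ 6) (ℛ ^ 5)) (*-cong (Dil.τ-^ 5 𝐸 6) (Dil.τ-^ 5 ℛ 5)))))))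

  𝐸-norm : 𝐸 * σ 𝐸 * dil 2 (dil 2 𝐸) ≈ dil 2 𝐸 * dil 2 𝐸 ^ 2
  𝐸-norm = norm₂ {𝐸} {poch 1 2} {𝐸}
    (trans (reflexive 𝐸≡poch)
      (trans (poch-split 2 1 1)
      (*-cong (*-identityˡ _) (sym (trans (Dil.τ-cong 2 (reflexive 𝐸≡poch)) (dil-poch 2 1 1))))))
    (poch-odd-norm 0 1)

  private
    -- Modulo 10 the class i modulo 5 splits into an odd class and an even class 2j. The pairs (i,
    -- j) are (1, 3), (4, 2), (2, 1) and (3, 4), so numerator and denominator of R change places.
    split-norm : ∀ i j {o : Series} → p i ≈ o * dil 2 (p j) → o * σ o ≈ dil 2 o →
      p i * σ (p i) * dil 2 (dil 2 (p j)) ≈ dil 2 (p i) * dil 2 (p j) ^ 2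
    split-norm i j {o} = norm₂ {p i} {o} {p j}

    p1-norm : p 1 * σ (p 1) * dil 2 (dil 2 (p 3)) ≈ dil 2 (p 1) * dil 2 (p 3) ^ 2
    p1-norm = split-norm 1 3 (trans (poch-split 2 1 5) (*-cong (*-identityˡ _) (sym (dil-poch 2 3 5))))
      (poch-odd-norm 0 5)

    p4-norm : p 4 * σ (p 4) * dil 2 (dil 2 (p 2)) ≈ dil 2 (p 4) * dil 2 (p 2) ^ 2
    p4-norm = split-norm 4 2 (trans (poch-split 2 4 5)
      (trans (solve 2 (λ x y → :# 1 :* x :* y := y :* x) refl (poch 4 10) (poch 9 10))
      (*-cong refl (sym (dil-poch 2 2 5))))) (poch-odd-norm 4 5)

    p2-norm : p 2 * σ (p 2) * dil 2 (dil 2 (p 1)) ≈ dil 2 (p 2) * dil 2 (p 1) ^ 2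
    p2-norm = split-norm 2 1 (trans (poch-split 2 2 5)
      (trans (solve 2 (λ x y → :# 1 :* x :* y := y :* x) refl (poch 2 10) (poch 7 10))
      (*-cong refl (sym (dil-poch 2 1 5))))) (poch-odd-norm 3 5)

    p3-norm : p 3 * σ (p 3) * dil 2 (dil 2 (p 4)) ≈ dil 2 (p 3) * dil 2 (p 4) ^ 2
    p3-norm = split-norm 3 4 (trans (poch-split 2 3 5) (*-cong (*-identityˡ _) (sym (dil-poch 2 4 5))))
      (poch-odd-norm 1 5)

  pair-norm : ∀ {f g f₁ g₁ f₂ g₂ h k h₁ k₁ : Series} → f * g * h ≈ f₁ * h₁ ^ 2 → f₂ * g₂ * k ≈ g₁ * k₁ ^ 2 →
              f * f₂ * (g * g₂) * (h * k) ≈ f₁ * g₁ * (h₁ * k₁) ^ 2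
  pair-norm {f} {g} {f₁} {g₁} {f₂} {g₂} {h} {k} {h₁} {k₁} p r = combine
    (solve 10 (λ f g f₁ g₁ f₂ g₂ h k h₁ k₁ → f :* f₂ :* (g :* g₂) :* (h :* k) := f₁ :* g₁ :* (h₁ :* k₁) :^ 2 :+
        ((f₂ :* g₂ :* k) :* (f :* g :* h :- f₁ :* h₁ :^ 2)
          :+ (f₁ :* h₁ :^ 2) :* (f₂ :* g₂ :* k :- g₁ :* k₁ :^ 2))) refl f g f₁ g₁ f₂ g₂ h k h₁ k₁)
    ((f₂ * g₂ * k) ⊡ p ⊞ (f₁ * h₁ ^ 2) ⊡ r)

  -- R(q) R(-q) = R(q⁴) / R(q²)
  ℛ-norm : ℛ * σ ℛ * dil 2 ℛ ≈ dil 2 (dil 2 ℛ)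
  ℛ-norm = cancelˡ {y * σ y * dil 2 (dil 2 y)}
    (*-0 {y * σ y} (*-0 {y} {σ y} y0 y0) (≡-trans (dil-0 2 (dil 2 y)) (≡-trans (dil-0 2 y) y0))) (combine
    (solve 6 (λ r r′ r₁ r₂ Y c →
        Y :* (r :* r′ :* r₁) := Y :* r₂ :+
        (r₁ :* (r :* r′ :* Y :- r₁ :* c) :+ (:- :# 1) :* (Y :* r₂ :- r₁ :* r₁ :* c))) refl
        ℛ (σ ℛ) (dil 2 ℛ) (dil 2 (dil 2 ℛ)) (y * σ y * dil 2 (dil 2 y)) (dil 2 y ^ 3))
    (dil 2 ℛ ⊡ first ⊞ (- # 1) ⊡ second))
    where
    x y : Series
    x = p 1 * p 4
    y = p 2 * p 3
    y0 : y 0 ≡ + 1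
    y0 = *-0 {p 2} {p 3} (p-0 2) (p-0 3)
    σx : σ x ≈ σ (p 1) * σ (p 4)
    σx = Sigma.τ-* (p 1) (p 4)
    x-norm : x * σ x * dil 2 (dil 2 y) ≈ dil 2 x * dil 2 y ^ 2
    x-norm = trans (*-cong (*-cong refl σx)
      (trans (Dil.τ-cong 2 (trans (Dil.τ-* 2 (p 2) (p 3)) (*-comm _ _))) (Dil.τ-* 2 _ _)))
      (trans (pair-norm {p 1} {σ (p 1)} p1-norm p4-norm)
        (*-cong (sym (Dil.τ-* 2 (p 1) (p 4))) (pow-cong 2 (trans (*-comm _ _) (sym (Dil.τ-* 2 (p 2) (p 3)))))))
    y-norm : y * σ y * dil 2 (dil 2 x) ≈ dil 2 y * dil 2 x ^ 2
    y-norm = trans (*-cong (*-cong refl (Sigma.τ-* (p 2) (p 3)))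
      (trans (Dil.τ-cong 2 (Dil.τ-* 2 (p 1) (p 4))) (Dil.τ-* 2 _ _)))
      (trans (pair-norm {p 2} {σ (p 2)} p2-norm p3-norm)
        (*-cong (sym (Dil.τ-* 2 (p 2) (p 3))) (pow-cong 2 (sym (Dil.τ-* 2 (p 1) (p 4))))))
    dilx : dil 2 x ≈ dil 2 ℛ * dil 2 y
    dilx = trans (Dil.τ-cong 2 (sym ℛ-quotient)) (Dil.τ-* 2 ℛ y)
    first : ℛ * σ ℛ * (y * σ y * dil 2 (dil 2 y)) ≈ dil 2 ℛ * dil 2 y ^ 3
    first = trans (solve 5 (λ r r′ y y′ z → r :* r′ :* (y :* y′ :* z) := r :* y :* (r′ :* y′) :* z) refl ℛ
      (σ ℛ) y (σ y) (dil 2 (dil 2 y)))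
      (trans (*-cong (*-cong ℛ-quotient (trans (sym (Sigma.τ-* ℛ y)) (Sigma.τ-cong ℛ-quotient))) refl)
        (trans x-norm (trans (*-cong dilx refl)
          (solve 2 (λ r y → r :* y :* y :^ 2 := r :* y :^ 3) refl (dil 2 ℛ) (dil 2 y)))))
    second : y * σ y * dil 2 (dil 2 y) * dil 2 (dil 2 ℛ) ≈ dil 2 ℛ * dil 2 ℛ * dil 2 y ^ 3
    second = trans (solve 4 (λ y y′ z r → y :* y′ :* z :* r := y :* y′ :* (r :* z)) refl y (σ y)
      (dil 2 (dil 2 y)) (dil 2 (dil 2 ℛ)))
      (trans (*-cong refl (sym (trans (Dil.τ-cong 2 dilx) (Dil.τ-* 2 (dil 2 ℛ) (dil 2 y)))))
        (trans y-norm (trans (*-cong refl (pow-cong 2 dilx))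
          (solve 2 (λ r y → y :* (r :* y) :^ 2 := r :* r :* y :^ 3) refl (dil 2 ℛ) (dil 2 y)))))

open RogersRamanujan

-- The relation between R(q)⁵ and R(q⁵), and expansions in powers of u.

module ModularEquation where
  open SeriesRing
  open import Data.Integer.Divisibility.Signed using (_∣_)

  open SeriesMod (+ 0)
  open Substitutions (+ 0)
  open Support (+ 0)

  -- z is a series in q⁵ and also a cube, so its exponents are controlled modulo 5 exactly and
  -- modulo 3 up to multiples of 3.
  E₅ E₂₅ r X f z i : Series
  E₅ = dil 5 𝐸
  E₂₅ = dil 5 E₅
  r = dil 5 ℛ
  X = ℛ ^ 5
  f = # 1 - u - u * u
  z = E₂₅ ^ 6 * inv E₅ ^ 6
  i = inv r

  X-0 : X 0 ≡ + 1
  X-0 = ^-0 {ℛ} 5 ℛ-0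

  E₅-0 : E₅ 0 ≡ + 1
  E₅-0 = dil𝐸-0 5

  r-0 : r 0 ≡ + 1
  r-0 = dilℛ-0 5

  E₂₅-0 : E₂₅ 0 ≡ + 1
  E₂₅-0 = ≡-trans (dil-0 5 E₅) E₅-0

  E₅-inv : E₅ * inv E₅ ≈ # 1
  E₅-inv = *-inv E₅ E₅-0

  r-inv : r * i ≈ # 1
  r-inv = *-inv r r-0

  X-inv : X * inv X ≈ # 1
  X-inv = *-inv X X-0

  ^-1 : ∀ {f g} → f * g ≈ # 1 → ∀ n → f ^ n * g ^ n ≈ # 1
  ^-1 {f} {g} h zero    = *-identityˡ (# 1)
  ^-1 {f} {g} h (suc n) = trans (solve 4 (λ f g F G → f :* F :* (g :* G) := f :* g :* (F :* G)) refl f g (f ^ n)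
    (g ^ n))
    (trans (*-cong h (^-1 h n)) (*-identityˡ (# 1)))

  T≈ : T u ≈ E₅ ^ 6 * inv E₂₅ ^ 6 * r ^ 5
  T≈ = cancelˡ {E₂₅ ^ 6} (^-0 {E₂₅} 6 E₂₅-0) (trans norm-identity (combine
    (solve 4 (λ E e F r → E :* r := F :* (E :* e :* r) :+ (:- (E :* r)) :* (F :* e :- :# 1)) refl (E₅ ^ 6)
      (inv E₂₅ ^ 6) (E₂₅ ^ 6) (r ^ 5))
    ((- (E₅ ^ 6 * r ^ 5)) ⊡ ^-1 (*-inv E₂₅ E₂₅-0) 6)))

  -- R(q⁵)/R(q)⁵ and P/Q are roots with constant term 1 of the same monic quadratic, whose other root vanishes at 0.
  modular-equation : r * Q u ≈ X * P u
  modular-equation = combine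
    (solve 2 (λ a b → a := b :+ :# 1 :* (a :- b :- :# 0)) refl (r * Q u) (X * P u))
    -- Subtracting X times `discriminant` from `balance` cancels the terms with 11 and leaves this
    -- factor, a unit, times rQ - XP.
    (# 1 ⊡ cancelˡ {P u + q^ 1 * q^ 1 * X * r * Q u} unit (combine
      (solve 6 (λ q X r P Q F → let k = q :* X ; u = q :* r in
         (P :+ q :* q :* X :* r :* Q) :* (r :* Q :- X :* P) := (P :+ q :* q :* X :* r :* Q) :* :# 0 :+
         (:# 1 :* (r :* P :* Q :* (:# 1 :- :# 11 :* k :- k :* k) :- X :* F)
          :+ (:- X) :* (P :* P :- :# 11 :* u :* P :* Q :- u :* u :* Q :* Q :- F))) refl (q^ 1) X r (P u) (Q u)
            (f ^ 5))
      (# 1 ⊡ balance ⊞ (- X) ⊡ discriminant u)))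
    where
    K : Series
    K = # 1 - # 11 * κ - κ * κ
    PQ-0 : ∀ c₁ c₂ c₃ → (# 1 + c₁ * u + c₂ * u ^ 2 + c₃ * u ^ 3 + u ^ 4) 0 ≡ + 1
    PQ-0 c₁ c₂ c₃ = +-0 {# 1 + c₁ * u + c₂ * u ^ 2 + c₃ * u ^ 3}
      (+-0 {# 1 + c₁ * u + c₂ * u ^ 2} (+-0 {# 1 + c₁ * u} (+-0 {# 1} ≡-refl
      (*-0ʳ c₁ {u} u-0)) (*-0ʳ c₂ {u ^ 2} (*-0ˡ {u} (u ^ 1) u-0))) (*-0ʳ c₃ {u ^ 3} (*-0ˡ {u} (u ^ 2) u-0)))
        (*-0ˡ {u} (u ^ 3) u-0)
    unit : (P u + q^ 1 * q^ 1 * X * r * Q u) 0 ≡ + 1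
    unit = +-0 {P u} (PQ-0 (# 3) (# 4) (# 2))
      (≡-trans (exact-≡ (solve 4 (λ q X r Q → q :* q :* X :* r :* Q := q :* (q :* X :* r :* Q)) refl (q^ 1) X r
      (Q u)) 0) (*-0ˡ {q^ 1} _ ≡-refl))
    -- By `ramanujan` K = X E⁶/E₅⁶; the dissection gives E⁶ = E₂₅⁶ f⁶/r⁶ and the norm gives E₂₅⁶/E₅⁶
    -- = r⁵/T, so K = X f⁶/(r T) with T = f P Q.
    balance : r * P u * Q u * K ≈ X * f ^ 5
    balance = cancelˡ {f * (E₅ ^ 6 * r ^ 5)} (*-0 {f} 1-u-u²-0 (*-0 {E₅ ^ 6} (^-0 {E₅} 6 E₅-0) (^-0 {r} 5 r-0)))
      (combine
      (solve 9 (λ f E r P Q K T X D →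
          f :* (E :* r :^ 5) :* (r :* P :* Q :* K) := f :* (E :* r :^ 5) :* (X :* f :^ 5) :+
          ((E :* r :^ 6 :* K) :* (f :* (P :* Q) :- T) :+ (r :^ 6 :* T) :* (E :* K :- D :* X) :+
           :# 1 :* (T :* X :* D :* r :^ 6 :- X :* f :^ 6 :* (E :* r :^ 5))))
        refl f (E₅ ^ 6) r (P u) (Q u) K (T u) X (𝐸 ^ 6))
      ((E₅ ^ 6 * r ^ 6 * K) ⊡ factorisation u ⊞ (r ^ 6 * T u) ⊡ ramanujan ⊞ # 1 ⊡ rest))
      where
      rest : T u * X * 𝐸 ^ 6 * r ^ 6 ≈ X * f ^ 6 * (E₅ ^ 6 * r ^ 5)
      rest = trans (solve 4 (λ T X E r → T :* X :* E :^ 6 :* r :^ 6 := T :* X :* (E :* r) :^ 6) refl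
        (T u) X 𝐸 r)
        (trans (*-cong refl (pow-cong 6 euler-dissection))
          (trans (solve 4 (λ T X E f → T :* X :* (E :* f) :^ 6 := X :* f :^ 6 :* (E :^ 6 :* T)) refl
            (T u) X E₂₅ f) (*-cong refl norm-identity)))

  private
    rT : ∀ {c d} → c * T u ≈ d → c * r ^ 5 ≈ d * z
    rT {c} {d} h = combine
      (solve 8 (λ c d r T E e F f → c :* r := d :* (F :* e) :+
          ((F :* e) :* (c :* T :- d) :+ (:- (c :* F :* e)) :* (T :- E :* f :* r)
           :+ (:- (c :* r)) :* (E :* e :* (F :* f) :- :# 1))) refl c d (r ^ 5) (T u) (E₅ ^ 6) (inv E₅ ^ 6)
             (E₂₅ ^ 6) (inv E₂₅ ^ 6))
      ((E₂₅ ^ 6 * inv E₅ ^ 6) ⊡ h ⊞ (- (c * E₂₅ ^ 6 * inv E₅ ^ 6)) ⊡ T≈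
        ⊞ (- (c * r ^ 5)) ⊡ trans (*-cong (^-1 E₅-inv 6) (^-1 (*-inv E₂₅ E₂₅-0) 6)) (*-identityˡ (# 1)))

    unr : ∀ {c d} → c * r ^ 5 ≈ d → c ≈ d * i ^ 5
    unr {c} {d} h = combine
      (solve 4 (λ c d r i → c := d :* i :+ (i :* (c :* r :- d) :+ (:- c) :* (r :* i :- :# 1))) refl c d (r ^ 5)
        (i ^ 5))
      (i ^ 5 ⊡ h ⊞ (- c) ⊡ ^-1 r-inv 5)

  -- X/r = Q/P = Q² f/(f P Q) = Q² f/T, and 1/T = z/r⁵. The denominator thus becomes a series in q⁵
  -- and the numerator a polynomial in u; `x≈` treats P/Q in the same way.
  X≈ : X * i ≈ Q u * Q u * f * (i ^ 5 * z)
  X≈ = trans (unr (rT {X * i} {Q u * Q u * f} (combine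
    (solve 7 (λ X i r P Q f T → X :* i :* T := Q :* Q :* f :+
        ((:- (X :* i)) :* (f :* (P :* Q) :- T) :+ (:- (i :* Q :* f)) :* (r :* Q :- X :* P)
          :+ (Q :* Q :* f) :* (r :* i :- :# 1))) refl X i r (P u) (Q u) f (T u))
    ((- (X * i)) ⊡ factorisation u ⊞ (- (i * Q u * f)) ⊡ modular-equation ⊞ (Q u * Q u * f) ⊡ r-inv))))
    (solve 3 (λ a z i → a :* z :* i := a :* (i :* z)) refl (Q u * Q u * f) z (i ^ 5))

  x≈ : r * inv X ≈ P u * P u * f * (i ^ 5 * z)
  x≈ = trans (unr (rT {r * inv X} {P u * P u * f} (combine
    (solve 7 (λ X x r P Q f T → r :* x :* T := P :* P :* f :+
        ((:- (r :* x)) :* (f :* (P :* Q) :- T) :+ (x :* P :* f) :* (r :* Q :- X :* P)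
          :+ (P :* P :* f) :* (X :* x :- :# 1))) refl X (inv X) r (P u) (Q u) f (T u))
    ((- (r * inv X)) ⊡ factorisation u ⊞ (inv X * P u * f) ⊡ modular-equation ⊞ (P u * P u * f) ⊡ X-inv))))
    (solve 3 (λ a z i → a :* z :* i := a :* (i :* z)) refl (P u * P u * f) z (i ^ 5))

  poly : Series → ℕ → List ℤ → Series
  poly w k []       = # 0
  poly w k (c ∷ cs) = const c * (u ^ k * w) + poly w (suc k) cs

  Terms : (ℤ → ℕ → Set) → ℕ → List ℤ → Set
  Terms S k []       = ⊤
  Terms S k (c ∷ cs) = S c k × Terms S (suc k) cs

  poly-∣ : ∀ {m n} w k cs → Terms (λ c k → m ∣ (const c * (u ^ k * w)) n) k cs → m ∣ poly w k cs n
  poly-∣ {m} {n} w k []       _        = subst (m ∣_) (≡-sym (const0≡0 n)) (m ∣0)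
  poly-∣ {m} {n} w k (c ∷ cs) (h , hs) =
    subst (m ∣_) (≡-sym (coeff-+ (const c * (u ^ k * w)) (poly w (suc k) cs) n))
    (∣m∣n⇒∣m+n h (poly-∣ w (suc k) cs hs))

  -- Modulo 5 one has f ≡ (1 + 2u)² and P ≡ Q ≡ (1 + 2u)⁴, so both polynomials are ≡ (1 + 2u)¹⁰ ≡ (1
  -- + 2u⁵)². Hence 5 divides every coefficient except those of 1, u⁵ and u¹⁰.
  P²f Q²f : List ℤ
  P²f = + 1 ∷ + 5 ∷ + 10 ∷ + 5 ∷ ℤ.- + 15 ∷ ℤ.- + 36 ∷ ℤ.- + 40 ∷ ℤ.- + 30 ∷ ℤ.- + 15 ∷ ℤ.- + 5 ∷ ℤ.- + 1 ∷ []
  Q²f = + 1 ∷ ℤ.- + 5 ∷ + 15 ∷ ℤ.- + 30 ∷ + 40 ∷ ℤ.- + 36 ∷ + 15 ∷ + 5 ∷ ℤ.- + 10 ∷ + 5 ∷ ℤ.- + 1 ∷ []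

  :poly : ∀ {n} → Polynomial n → Polynomial n → ℕ → List ℤ → Polynomial n
  :poly u w k []       = :# 0
  :poly u w k (c ∷ cs) = con c :* (u :^ k :* w) :+ :poly u w (suc k) cs

  expand-P : ∀ w → P u * P u * f * w ≈ poly w 0 P²f
  expand-P w = solve 2 (λ u w → :P u :* :P u :* (:# 1 :- u :- u :* u) :* w := :poly u w 0 P²f) refl u w

  expand-Q : ∀ w → Q u * Q u * f * w ≈ poly w 0 Q²f
  expand-Q w = solve 2 (λ u w → :Q u :* :Q u :* (:# 1 :- u :- u :* u) :* w := :poly u w 0 Q²f) refl u w

  i-Supp : Supp 5 0 i
  i-Supp = Supp-inv r-0 (Supp-dil ℛ)

  z-Supp : Supp 5 0 z
  z-Supp = Supp-* {d = 5} (Supp-^ (Supp-dil E₅) 6) (Supp-^ (Supp-inv E₅-0 (Supp-dil 𝐸)) 6)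

  coeff-const* : ∀ c y n → (const c * y) n ≡ c ℤ.* y n
  coeff-const* c y n = ≡-trans (coeff-* (const c) y n) (const-⊛ c y n)

  -- Three reasons for a divisor of a term: its exponents miss the class of n modulo 5, the divisor
  -- divides the integer c, or c supplies one factor and the coefficient of the series the other.
  module Term (w : Series) (w-Supp : Supp 5 0 w) where

    off-class : ∀ {m n ρ} c k → n % 5 ≡ ρ → ρ ≢ (k ℕ.* 1) % 5 → m ∣ (const c * (u ^ k * w)) n
    off-class {m} {n} c k n≡ρ ρ≢ = subst (m ∣_) (≡-sym (≡-trans (coeff-const* c (u ^ k * w) n)
      (≡-trans (cong (c ℤ.*_) (exact-0
        (off (Supp-* {d = 5} (Supp-^ u-Supp k) w-Supp) n
        (λ h → ρ≢ (≡-trans (≡-sym n≡ρ) (≡-trans h (mod-mod (k ℕ.* 1)))))))) (ℤₚ.*-zeroʳ c)))) (m ∣0)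
      where
      exact-0 : ∀ {x} → x ∼ + 0 → x ≡ + 0
      exact-0 {x} h = 0∣⇒≡0 (∼0⇒∣ h)
      mod-mod : ∀ k → (k % 5 ℕ.+ 0) % 5 ≡ k % 5
      mod-mod k = ≡-trans (cong (_% 5) (ℕₚ.+-identityʳ (k % 5))) (m%n%n≡m%n k 5)

    coefficient : ∀ {m n} c k → m ∣ c → m ∣ (const c * (u ^ k * w)) n
    coefficient {m} {n} c k h = subst (m ∣_) (≡-sym (coeff-const* c (u ^ k * w) n)) (∣m⇒∣m*n _ h)

    both : ∀ {a b n} c k → a ∣ c → b ∣ (u ^ k * w) n → a ℤ.* b ∣ (const c * (u ^ k * w)) n
    both {a} {b} {n} c k (divides s ≡-refl) h =
      subst (a ℤ.* b ∣_) (≡-sym (≡-trans (coeff-const* (s ℤ.* a) (u ^ k * w) n) (ℤₚ.*-assoc s a _)))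
      (∣n⇒∣m*n s (*-monoʳ-∣ a h))

  module _ where
    private
      module S₃ = SeriesMod (+ 3)
      module Supp₃ = Support (+ 3)

    cube-Supp : ∀ g → Supp₃.Supp 3 0 (g ^ 3)
    cube-Supp g = Supp₃.Supp-cong (S₃.sym (frobenius₃ g)) (Supp₃.Supp-dil g)

    z-cube : Supp₃.Supp 3 0 z
    z-cube = Supp₃.Supp-cong (reduce
      (solve 2 (λ E e → (E :^ 2 :* e :^ 2) :^ 3 := E :^ 6 :* e :^ 6) refl E₂₅ (inv E₅)))
      (cube-Supp (E₂₅ ^ 2 * inv E₅ ^ 2))

    -- u^k i^l with k + 3 = l or k = l + 3 equals q^k times a cube
    low : ∀ k l → k ℕ.+ 3 ≡ l → Supp₃.Supp 3 (k % 3) (u ^ k * (i ^ l * z))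
    low k l ≡-refl = subst (λ c → Supp₃.Supp 3 c (u ^ k * (i ^ (k ℕ.+ 3) * z))) (mod0 k)
      (Supp₃.Supp-cong (reduce (sym eq))
      (Supp₃.Supp-* (Supp₃.Supp-q^ {3} k) (Supp₃.Supp-* {d = 3} (cube-Supp i) z-cube)))
      where
      mod0 : ∀ k → (k % 3 ℕ.+ 0) % 3 ≡ k % 3
      mod0 k = ≡-trans (cong (_% 3) (ℕₚ.+-identityʳ (k % 3))) (m%n%n≡m%n k 3)
      eq : u ^ k * (i ^ (k ℕ.+ 3) * z) ≈ q^ k * (i ^ 3 * z)
      eq = trans (*-cong (trans (^-distrib-* (q^ 1) r k)
        (*-cong (trans (q^-^ (+ 0) 1 k) (reflexive (cong q^ (ℕₚ.*-identityʳ k)))) refl))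
        (*-cong (^-+ i k 3) refl))
        (trans (solve 5 (λ q R I J z → q :* R :* (I :* J :* z) := R :* I :* (q :* (J :* z))) refl (q^ k) (r ^ k)
          (i ^ k) (i ^ 3) z)
          (trans (*-cong (^-1 r-inv k) refl) (*-identityˡ _)))

    high : ∀ k l → k ≡ l ℕ.+ 3 → Supp₃.Supp 3 (k % 3) (u ^ k * (i ^ l * z))
    high k l ≡-refl = subst (λ c → Supp₃.Supp 3 c (u ^ k * (i ^ l * z))) (mod0 k)
      (Supp₃.Supp-cong (reduce (sym eq))
      (Supp₃.Supp-* (Supp₃.Supp-q^ {3} k) (Supp₃.Supp-* {d = 3} (cube-Supp r) z-cube)))
      where
      mod0 : ∀ k → (k % 3 ℕ.+ 0) % 3 ≡ k % 3
      mod0 k = ≡-trans (cong (_% 3) (ℕₚ.+-identityʳ (k % 3))) (m%n%n≡m%n k 3)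
      eq : u ^ (l ℕ.+ 3) * (i ^ l * z) ≈ q^ (l ℕ.+ 3) * (r ^ 3 * z)
      eq = trans (*-cong (trans (^-distrib-* (q^ 1) r (l ℕ.+ 3))
        (*-cong (trans (q^-^ (+ 0) 1 (l ℕ.+ 3)) (reflexive (cong q^ (ℕₚ.*-identityʳ (l ℕ.+ 3))))) (^-+ r l 3)))
        refl)
        (trans (solve 5 (λ q R I J z → q :* (R :* J) :* (I :* z) := R :* I :* (q :* (J :* z))) refl
          (q^ (l ℕ.+ 3)) (r ^ l) (i ^ l) (r ^ 3) z)
          (trans (*-cong (^-1 r-inv l) refl) (*-identityˡ _)))

open ModularEquation

-- The congruences modulo 15 and 30.

module Modulo15And30 where
  open SeriesRing
  open import Data.Integer.Divisibility.Signed using (_∣_)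

  open SeriesMod (+ 0)
  open Support (+ 0)

  i·z-Supp : ∀ l → Supp 5 0 (i ^ l * z)
  i·z-Supp l = subst (λ c → Supp 5 c (i ^ l * z)) (cong (λ x → (x % 5 ℕ.+ 0) % 5) (ℕₚ.*-zeroʳ l))
    (Supp-* (Supp-^ i-Supp l) z-Supp)

  X-expansion : X ≈ poly (i ^ 4 * z) 0 Q²f
  X-expansion = trans (combine
    (solve 5 (λ X r i S z → X :=
      S :* (i :^ 4 :* z) :+ ((:- X) :* (r :* i :- :# 1) :+ r :* (X :* i :- S :* (i :^ 5 :* z))
      :+ (S :* (i :^ 4 :* z)) :* (r :* i :- :# 1))) refl X r i (Q u * Q u * f) z)
    ((- X) ⊡ r-inv ⊞ r ⊡ X≈ ⊞ (Q u * Q u * f * (i ^ 4 * z)) ⊡ r-inv)) (expand-Q (i ^ 4 * z))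

  x-expansion : inv X ≈ poly (i ^ 6 * z) 0 P²f
  x-expansion = trans (combine
    (solve 5 (λ x r i S z → x :=
      S :* (i :^ 6 :* z) :+ ((:- x) :* (r :* i :- :# 1) :+ i :* (r :* x :- S :* (i :^ 5 :* z)))) refl
      (inv X) r i (P u * P u * f) z)
    ((- inv X) ⊡ r-inv ⊞ i ⊡ x≈)) (expand-P (i ^ 6 * z))

  private
    module Supp₃ = Support (+ 3)

  ∣-resp : ∀ {m f g} n → f ≈ g → m ∣ g n → m ∣ f n
  ∣-resp {m} n h = subst (m ∣_) (≡-sym (exact-≡ h n))

  -- Exponents in the class 3 modulo 5 come from u³ and u⁸ alone. The coefficient of u⁸ is -15. That
  -- of u³ is 5, and modulo 3 the series u³ i⁶ z is q³ times cubes, so its exponents are multiples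
  -- of 3, which n avoids. The five lemmas below follow this pattern.
  A-class-3 : ∀ n → n % 5 ≡ 3 → n % 3 ≢ 0 → + 15 ∣ inv X n
  A-class-3 n n₅ n₃ = ∣-resp n x-expansion (poly-∣ (i ^ 6 * z) 0 P²f
    ( off-class _ 0 n₅ (λ ()) , off-class _ 1 n₅ (λ ()) , off-class _ 2 n₅ (λ ())
    , both {+ 5} {+ 3} _ 3 (divides (+ 1) ≡-refl) (Supp₃.off-∣ (low 3 6 ≡-refl) n n₃)
    , off-class _ 4 n₅ (λ ()) , off-class _ 5 n₅ (λ ()) , off-class _ 6 n₅ (λ ()) , off-class _ 7 n₅ (λ ())
    , coefficient _ 8 (divides (ℤ.- + 1) ≡-refl) , off-class _ 9 n₅ (λ ()) , off-class _ 10 n₅ (λ ()) , tt ))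
    where open Term (i ^ 6 * z) (i·z-Supp 6)

  A-class-4 : ∀ n → n % 5 ≡ 4 → n % 3 ≢ 0 → + 15 ∣ inv X n
  A-class-4 n n₅ n₃ = ∣-resp n x-expansion (poly-∣ (i ^ 6 * z) 0 P²f
    ( off-class _ 0 n₅ (λ ()) , off-class _ 1 n₅ (λ ()) , off-class _ 2 n₅ (λ ()) , off-class _ 3 n₅ (λ ())
    , coefficient _ 4 (divides (ℤ.- + 1) ≡-refl)
    , off-class _ 5 n₅ (λ ()) , off-class _ 6 n₅ (λ ()) , off-class _ 7 n₅ (λ ()) , off-class _ 8 n₅ (λ ())
    , both {+ 5} {+ 3} _ 9 (divides (ℤ.- + 1) ≡-refl) (Supp₃.off-∣ (high 9 6 ≡-refl) n n₃)
      , off-class _ 10 n₅ (λ ()) , tt ))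
    where open Term (i ^ 6 * z) (i·z-Supp 6)

  B-class-1 : ∀ n → n % 5 ≡ 1 → n % 3 ≢ 1 → + 15 ∣ X n
  B-class-1 n n₅ n₃ = ∣-resp n X-expansion (poly-∣ (i ^ 4 * z) 0 Q²f
    ( off-class _ 0 n₅ (λ ()) , both {+ 5} {+ 3} _ 1 (divides (ℤ.- + 1) ≡-refl)
      (Supp₃.off-∣ (low 1 4 ≡-refl) n n₃)
    , off-class _ 2 n₅ (λ ()) , off-class _ 3 n₅ (λ ()) , off-class _ 4 n₅ (λ ()) , off-class _ 5 n₅ (λ ())
    , coefficient _ 6 (divides (+ 1) ≡-refl)
    , off-class _ 7 n₅ (λ ()) , off-class _ 8 n₅ (λ ()) , off-class _ 9 n₅ (λ ()) , off-class _ 10 n₅ (λ ())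
      , tt ))
    where open Term (i ^ 4 * z) (i·z-Supp 4)

  B-class-2 : ∀ n → n % 5 ≡ 2 → n % 3 ≢ 1 → + 15 ∣ X n
  B-class-2 n n₅ n₃ = ∣-resp n X-expansion (poly-∣ (i ^ 4 * z) 0 Q²f
    ( off-class _ 0 n₅ (λ ()) , off-class _ 1 n₅ (λ ()) , coefficient _ 2 (divides (+ 1) ≡-refl)
    , off-class _ 3 n₅ (λ ()) , off-class _ 4 n₅ (λ ()) , off-class _ 5 n₅ (λ ()) , off-class _ 6 n₅ (λ ())
    , both {+ 5} {+ 3} _ 7 (divides (+ 1) ≡-refl) (Supp₃.off-∣ (high 7 4 ≡-refl) n n₃)
    , off-class _ 8 n₅ (λ ()) , off-class _ 9 n₅ (λ ()) , off-class _ 10 n₅ (λ ()) , tt ))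
    where open Term (i ^ 4 * z) (i·z-Supp 4)

  -- In Q² f the coefficients of u³ and u⁸ are -30 and -10, even as well as divisible by 5, whence
  -- the modulus 30; for D the coefficients of u² and u⁷ in P² f are 10 and -30.
  C-class-3 : ∀ n → n % 5 ≡ 3 → n % 3 ≢ 2 → + 30 ∣ (X * i) n
  C-class-3 n n₅ n₃ = ∣-resp n (trans X≈ (expand-Q (i ^ 5 * z))) (poly-∣ (i ^ 5 * z) 0 Q²f
    ( off-class _ 0 n₅ (λ ()) , off-class _ 1 n₅ (λ ()) , off-class _ 2 n₅ (λ ())
      , coefficient _ 3 (divides (ℤ.- + 1) ≡-refl)
    , off-class _ 4 n₅ (λ ()) , off-class _ 5 n₅ (λ ()) , off-class _ 6 n₅ (λ ()) , off-class _ 7 n₅ (λ ())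
    , both {+ 10} {+ 3} _ 8 (divides (ℤ.- + 1) ≡-refl) (Supp₃.off-∣ (high 8 5 ≡-refl) n n₃)
    , off-class _ 9 n₅ (λ ()) , off-class _ 10 n₅ (λ ()) , tt ))
    where open Term (i ^ 5 * z) (i·z-Supp 5)

  D-class-2 : ∀ n → n % 5 ≡ 2 → n % 3 ≢ 2 → + 30 ∣ (r * inv X) n
  D-class-2 n n₅ n₃ = ∣-resp n (trans x≈ (expand-P (i ^ 5 * z))) (poly-∣ (i ^ 5 * z) 0 P²f
    ( off-class _ 0 n₅ (λ ()) , off-class _ 1 n₅ (λ ())
    , both {+ 10} {+ 3} _ 2 (divides (+ 1) ≡-refl) (Supp₃.off-∣ (low 2 5 ≡-refl) n n₃)
    , off-class _ 3 n₅ (λ ()) , off-class _ 4 n₅ (λ ()) , off-class _ 5 n₅ (λ ()) , off-class _ 6 n₅ (λ ())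
    , coefficient _ 7 (divides (ℤ.- + 1) ≡-refl)
    , off-class _ 8 n₅ (λ ()) , off-class _ 9 n₅ (λ ()) , off-class _ 10 n₅ (λ ()) , tt ))
    where open Term (i ^ 5 * z) (i·z-Supp 5)

  g : Series
  g = 𝐸 ^ 6 * inv E₅ ^ 6

  X·g : # 1 - # 11 * κ - κ * κ ≈ X * g
  X·g = combine
    (solve 5 (λ K X E F e → K := X :* (E :* e) :+ ((:- K) :* (F :* e :- :# 1) :+ e :* (F :* K :- E :* X))) refl
      (# 1 - # 11 * κ - κ * κ) X (𝐸 ^ 6) (E₅ ^ 6) (inv E₅ ^ 6))
    ((- (# 1 - # 11 * κ - κ * κ)) ⊡ ^-1 E₅-inv 6 ⊞ inv E₅ ^ 6 ⊡ ramanujan)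

  inv-X≈ : inv X ≈ g + # 11 * q^ 1 + q^ 1 * q^ 1 * X
  inv-X≈ = combine
    (solve 4 (λ x X g q → x := g :+ :# 11 :* q :+ q :* q :* X :+
        (x :* (:# 1 :- :# 11 :* (q :* X) :- q :* X :* (q :* X) :- X :* g)
          :+ (g :+ :# 11 :* q :+ q :* q :* X) :* (X :* x :- :# 1))) refl (inv X) X g (q^ 1))
    (inv X ⊡ X·g ⊞ (g + # 11 * q^ 1 + q^ 1 * q^ 1 * X) ⊡ X-inv)

  coeff-q²* : ∀ h n → (q^ 1 * q^ 1 * h) (suc (suc n)) ≡ h n
  coeff-q²* h n = ≡-trans (exact-≡ (*-cong (sym (q^-+ (+ 0) 1 1)) refl) (suc (suc n)))
    (≡-trans (coeff-* (q^ 2) h (suc (suc n))) (qpow-⊛-+ 2 h n))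

  -- The term 11q of `inv-X≈` plays out before exponent 2, so A(n + 2) and B(n) differ by a
  -- coefficient of g. This carries the congruences modulo 3 and 4 from B to A.
  coeff-inv-X : ∀ n → inv X (suc (suc n)) ≡ g (suc (suc n)) ℤ.+ X n
  coeff-inv-X n = ≡-trans (exact-≡ inv-X≈ (suc (suc n)))
    (≡-trans (coeff-+ (g + # 11 * q^ 1) (q^ 1 * q^ 1 * X) (suc (suc n)))
    (cong₂ ℤ._+_ (≡-trans (coeff-+ g (# 11 * q^ 1) (suc (suc n)))
      (≡-trans (cong (λ y → g (suc (suc n)) ℤ.+ y) (coeff-const* (+ 11) (q^ 1) (suc (suc n))))
      (ℤₚ.+-identityʳ (g (suc (suc n))))))
      (coeff-q²* X n)))

open Modulo15And30

-- The congruences modulo 3.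

module Modulo3 where
  open SeriesRing
  open import Data.Integer.Divisibility.Signed using (_∣_)

  open SeriesMod (+ 3)
  open Support (+ 3)

  private
    -- W is (g + 11q)² + 4q² reduced modulo 3, and y = V W² with V and g series in q³. The terms of
    -- W² with exponents in the class 1 are q (2g³ + q³) ≡ q (2g + q)³; s is chosen so that q s³ is
    -- the resulting part of y.
    q x y W Wi V s : Series
    q = q^ 1
    x = inv X
    y = x + q * q * X
    W = g * g + g * q - q * q
    Wi = inv W
    V = y ^ 3 * Wi ^ 3
    s = y * Wi * (# 2 * g + q)

    0≈3 : # 3 ≈ # 0
    0≈3 = const-m≈0 (+ 3)

    g-cube : Supp 3 0 g
    g-cube = Supp-cong (solve 2 (λ E e → (E :^ 2 :* e :^ 2) :^ 3 := E :^ 6 :* e :^ 6) refl 𝐸 (inv E₅))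
      (cube-Supp (𝐸 ^ 2 * inv E₅ ^ 2))

    g-0 : g 0 ≡ + 1
    g-0 = *-0 {𝐸 ^ 6} (^-0 {𝐸} 6 𝐸-0) (^-0 {inv E₅} 6 ≡-refl)

    W-0 : W 0 ≡ + 1
    W-0 = +-0 {g * g + g * q} (+-0 {g * g} (*-0 {g} g-0 g-0) (*-0ʳ g {q} ≡-refl))
      (neg-0 {q * q} (*-0ˡ {q} q ≡-refl))

    WWi : W * Wi ≈ # 1
    WWi = *-inv W W-0

    -- y² is the discriminant of the quadratic satisfied by 1/R⁵
    y² : y * y ≈ W
    y² = combine (solve 4 (λ x X g q →
          let y = x :+ q :* q :* X ; D = x :- (g :+ :# 11 :* q :+ q :* q :* X) in
          y :* y := g :* g :+ g :* q :- q :* q :+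
          ((x :- q :* q :* X :+ g :+ :# 11 :* q) :* (x :- (g :+ :# 11 :* q :+ q :* q :* X))
           :+ (:# 4 :* q :* q) :* (X :* x :- :# 1)
           :+ (:# 7 :* g :* q :+ :# 42 :* q :* q) :* (:# 3 :- :# 0))) refl x X g q)
      ((x - q * q * X + g + # 11 * q) ⊡ reduce inv-X≈ ⊞ (# 4 * q * q) ⊡ reduce X-inv
        ⊞ (# 7 * g * q + # 42 * q * q) ⊡ 0≈3)

    y≈ : y ≈ V * (W * W)
    y≈ = combine (solve 3 (λ y W w → y := y :^ 3 :* w :^ 3 :* (W :* W) :+
          ((:- (y :* w)) :* (y :* y :- W) :+
           (:- y :- y :^ 3 :* w :* (W :* w :+ :# 1) :+ :# 0) :* (W :* w :- :# 1))) refl y W Wi)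
      ((- (y * Wi)) ⊡ y² ⊞ (- y - y ^ 3 * Wi * (W * Wi + # 1) + # 0) ⊡ WWi)

    V-Supp : Supp 3 0 V
    V-Supp = Supp-* {d = 3} (cube-Supp y) (cube-Supp Wi)

    s³ : s ^ 3 ≈ V * (# 2 * g ^ 3 + q ^ 3)
    s³ = combine (solve 4 (λ y w g q → (y :* w :* (:# 2 :* g :+ q)) :^ 3 :=
          y :^ 3 :* w :^ 3 :* (:# 2 :* g :^ 3 :+ q :^ 3) :+
          (y :^ 3 :* w :^ 3 :* (:# 2 :* g :^ 3 :+ :# 4 :* g :* g :* q :+ :# 2 :* g :* q :* q))
            :* (:# 3 :- :# 0)) refl y Wi g q)
      ((y ^ 3 * Wi ^ 3 * (# 2 * g ^ 3 + # 4 * g * g * q + # 2 * g * q * q)) ⊡ 0≈3)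

    -- s = V W (2g + q), where the term linear in q is 3g² q and vanishes modulo 3. So s has no
    -- exponents in the class 1, which is what gives the second digit in base 3.
    s≈ : s ≈ V * (# 2 * (g * g * g)) + V * - (g * (q * q)) + V * - (q * q * q)
    s≈ = combine (solve 5 (λ y w g q V → let W = g :* g :+ g :* q :- q :* q ; G = :# 2 :* g :+ q in
          y :* w :* G := V :* (:# 2 :* (g :* g :* g)) :+ V :* :- (g :* (q :* q)) :+ V :* :- (q :* q :* q) :+
          ((w :* G) :* (y :- V :* (W :* W)) :+ (V :* W :* G) :* (W :* w :- :# 1)
            :+ (V :* g :* g :* q) :* (:# 3 :- :# 0))) refl y Wi g q V)
      ((Wi * (# 2 * g + q)) ⊡ y≈ ⊞ (V * W * (# 2 * g + q)) ⊡ WWi ⊞ (V * g * g * q) ⊡ 0≈3)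

    gg : Supp 3 0 (g * g)
    gg = Supp-* {d = 3} g-cube g-cube

    qq : Supp 3 2 (q * q)
    qq = Supp-* {d = 3} (Supp-q^ {3} 1) (Supp-q^ {3} 1)

    s-off : ∀ n → n % 3 ≡ 1 → s n ∼ + 0
    s-off n n≡1 = ∼-trans (at s≈ n)
      (∼-trans (∼-reflexive (≡-trans (coeff-+ a₁₂ a₃ n) (cong (ℤ._+ a₃ n) (coeff-+ a₁ a₂ n))))
      (∼-+ (∼-+ (off (Supp-* {d = 3} V-Supp (Supp-* {d = 3} (Supp-const (+ 2)) (Supp-* {d = 3} gg g-cube))) n
        (λ h → 1≢0 (≡-trans (≡-sym n≡1) h)))
                (off (Supp-* {d = 3} V-Supp (Supp-neg (Supp-* {d = 3} g-cube qq))) n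
                  (λ h → 1≢2 (≡-trans (≡-sym n≡1) h))))
           (off (Supp-* {d = 3} V-Supp (Supp-neg (Supp-* {d = 3} qq (Supp-q^ {3} 1)))) n
             (λ h → 1≢0 (≡-trans (≡-sym n≡1) h)))))
      where
      a₁ a₂ a₃ a₁₂ : Series
      a₁ = V * (# 2 * (g * g * g))
      a₂ = V * - (g * (q * q))
      a₃ = V * - (q * q * q)
      a₁₂ = a₁ + a₂
      1≢0 : 1 ≢ 0
      1≢0 ()
      1≢2 : 1 ≢ 2
      1≢2 ()

    y-split : y ≈ q * s ^ 3 + (V * (g * g * (g * g)) + V * - (g * g * (q * q)) + V * - (# 2 * g * (q * q * q)))
    y-split = combine (solve 5 (λ y g q V S → let W = g :* g :+ g :* q :- q :* q in
          y := q :* S :+ (V :* (g :* g :* (g :* g)) :+ V :* :- (g :* g :* (q :* q))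
            :+ V :* :- (:# 2 :* g :* (q :* q :* q))) :+
          (:# 1 :* (y :- V :* (W :* W)) :+ (:- q) :* (S :- V :* (:# 2 :* g :^ 3 :+ q :^ 3)))) refl y g q V
            (s ^ 3))
      (# 1 ⊡ y≈ ⊞ (- q) ⊡ s³)

    -- The terms of `y-split` other than q s³ have exponents in the classes 0 and 2, and s³ ≡ s(q³).
    y-off : ∀ k → y (suc (suc k ℕ.* 3)) ∼ s (suc k)
    y-off k = ∼-trans (at y-split (suc (suc k ℕ.* 3)))
      (∼-trans (∼-reflexive (coeff-+ (q * s ^ 3) rest (suc (suc k ℕ.* 3))))
      (∼-trans (∼-+ (∼-trans (∼-reflexive
        (≡-trans (coeff-* q (s ^ 3) (suc (suc k ℕ.* 3))) (qpow-⊛-+ 1 (s ^ 3) (suc k ℕ.* 3))))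
                       (∼-trans (at (frobenius₃ s) (suc k ℕ.* 3)) (∼-reflexive (dil-multiple 3 s (suc k)))))
                     rest-off) (∼-reflexive (ℤₚ.+-identityʳ (s (suc k))))))
      where
      b₁ b₂ b₃ rest : Series
      b₁ = V * (g * g * (g * g))
      b₂ = V * - (g * g * (q * q))
      b₃ = V * - (# 2 * g * (q * q * q))
      rest = b₁ + b₂ + b₃
      class : ∀ k → suc (k ℕ.* 3) % 3 ≡ 1
      class k = [m+kn]%n≡m%n 1 k 3
      N : ℕ
      N = suc (suc k ℕ.* 3)
      avoid : ∀ {c} → 1 ≢ c → N % 3 ≢ c
      avoid h h′ = h (≡-trans (≡-sym (class (suc k))) h′)
      rest-off : rest N ∼ + 0
      rest-off = ∼-trans (∼-reflexive (≡-trans (coeff-+ (b₁ + b₂) b₃ N) (cong (ℤ._+ b₃ N) (coeff-+ b₁ b₂ N))))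
        (∼-+ (∼-+ (off (Supp-* {d = 3} V-Supp (Supp-* {d = 3} gg gg)) N (avoid λ ()))
                  (off (Supp-* {d = 3} V-Supp (Supp-neg (Supp-* {d = 3} gg qq))) N (avoid λ ())))
             (off (Supp-* {d = 3} V-Supp
               (Supp-neg (Supp-* {d = 3} (Supp-* {d = 3} (Supp-const (+ 2)) g-cube)
               (Supp-* {d = 3} qq (Supp-q^ {3} 1))))) N (avoid λ ())))

  -- By `coeff-inv-X` the coefficient is g(n + 2) + 2B(n), and g is a series in q³ modulo 3.
  coeff-y : ∀ n → (suc (suc n)) % 3 ≡ 1 → y (suc (suc n)) ∼ + 2 ℤ.* X n
  coeff-y n n≡1 = ∼-trans (∼-reflexive (≡-trans (coeff-+ x (q * q * X) (suc (suc n)))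
      (cong₂ ℤ._+_ (coeff-inv-X n) (coeff-q²* X n))))
    (∼-trans (∼-+ (∼-+ (g-off n n≡1) ∼-refl) ∼-refl) (∼-reflexive (double (X n))))
    where
    double : ∀ t → + 0 ℤ.+ t ℤ.+ t ≡ + 2 ℤ.* t
    double = solve-∀
    g-off : ∀ n → suc (suc n) % 3 ≡ 1 → g (suc (suc n)) ∼ + 0
    g-off n h = off g-cube (suc (suc n)) (λ h′ → contr (≡-trans (≡-sym h) h′))
      where
      contr : 1 ≢ 0
      contr ()

  B-mod-3 : ∀ n → + 3 ∣ X (suc (suc (9 ℕ.* n)))
  B-mod-3 n = ∼0⇒∣ (∼-trans
    -- As 4 ≡ 1, doubling once more recovers X N from 2 X N, which is a coefficient of y with index
    -- ≡ 4 modulo 9.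
    (∼-sym (∼-trans (∼-reflexive (four (X N)))
    (∼-trans (∼-+ (three (X N)) ∼-refl) (∼-reflexive (ℤₚ.+-identityˡ (X N))))))
    (∼-trans (∼-* (∼-refl {+ 2})
      (∼-trans (∼-sym (coeff-y N N≡1))
      (∼-trans (∼-reflexive (cong y index)) (∼-trans (y-off (3 ℕ.* n)) (s-off (suc (3 ℕ.* n)) 3n+1)))))
      (∼-reflexive ≡-refl)))
    where
    N : ℕ
    N = suc (suc (9 ℕ.* n))
    index′ : ∀ n → suc (suc (suc (suc (9 ℕ.* n)))) ≡ suc (suc (3 ℕ.* n) ℕ.* 3)
    index′ = solve-∀ℕ
    index : suc (suc N) ≡ suc (suc (3 ℕ.* n) ℕ.* 3)
    index = index′ n
    N≡1 : suc (suc N) % 3 ≡ 1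
    N≡1 = ≡-trans (cong (_% 3) index) ([m+kn]%n≡m%n 1 (suc (3 ℕ.* n)) 3)
    3n+1 : suc (3 ℕ.* n) % 3 ≡ 1
    3n+1 = ≡-trans (cong (λ k → suc k % 3) (ℕₚ.*-comm 3 n)) ([m+kn]%n≡m%n 1 n 3)
    four : ∀ t → + 2 ℤ.* (+ 2 ℤ.* t) ≡ + 3 ℤ.* t ℤ.+ t
    four = solve-∀
    three : ∀ t → + 3 ℤ.* t ∼ + 0
    three t = ∣⇒∼0 (divides t (ℤₚ.*-comm (+ 3) t))

  A-mod-3 : ∀ n → + 3 ∣ inv X (suc (suc (suc (suc (9 ℕ.* n)))))
  A-mod-3 n = ∼0⇒∣ (∼-trans (∼-reflexive (coeff-inv-X N)) (∼-trans (∼-+ g-off (∣⇒∼0 (B-mod-3 n))) ∼-refl))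
    where
    N : ℕ
    N = suc (suc (9 ℕ.* n))
    index : ∀ n → suc (suc (suc (suc (9 ℕ.* n)))) ≡ suc (suc (3 ℕ.* n) ℕ.* 3)
    index = solve-∀ℕ
    contr : 1 ≢ 0
    contr ()
    g-off : g (suc (suc N)) ∼ + 0
    g-off = off g-cube (suc (suc N))
      (λ h → contr (≡-trans (≡-sym (≡-trans (cong (_% 3) (index n)) ([m+kn]%n≡m%n 1 (suc (3 ℕ.* n)) 3))) h))

-- Parities: the level five relation, and the series h and j.

module Modulo2 where
  open SeriesRing

  open SeriesMod (+ 2)
  open Substitutions (+ 2)
  open Support (+ 2)

  0≈2 : # 2 ≈ # 0
  0≈2 = const-m≈0 (+ 2)

  -- Coefficient n > 0 of Δ is a combination of coefficients of Δ at indices at most n/5, so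
  -- vanishing spreads from the constant term.
  dil-contraction : ∀ {Δ U} → Δ ≈ dil 5 Δ * U → Δ 0 ∼ + 0 → Δ ≈ # 0
  dil-contraction {Δ} {U} h h0 = mk λ n → ∼-trans (go n n ℕₚ.≤-refl) (∼-reflexive (≡-sym (const0≡0 n)))
    where
    go : ∀ n k → k ≤ n → Δ k ∼ + 0
    dilated : ∀ n j → j ≤ suc n → dil 5 Δ j ∼ + 0
    go n       zero    _          = h0
    go (suc n) (suc k) (s≤s k≤n) = ∼-trans (at h (suc k)) (*-off {dil 5 Δ} {U} (suc k) λ j j≤1+k →
      ∼0-*ˡ (U (suc k ℕ.∸ j)) (dilated n j (ℕₚ.≤-trans j≤1+k (s≤s k≤n))))
    dilated n zero    _        = h0
    dilated n (suc j) 1+j≤1+n with (suc j % 5) ℕ.≡ᵇ 0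
    ... | true  = go n (suc j / 5) (ℕₚ.≤-pred (ℕₚ.<-≤-trans (m/n<m (suc j) 5 (s≤s (s≤s z≤n))) 1+j≤1+n))
    ... | false = ∼-refl

  q : Series
  q = q^ 1

  e : Series
  e = inv E₅

  E₅e : E₅ * e ≈ # 1
  E₅e = reduce E₅-inv

  ri : r * i ≈ # 1
  ri = reduce r-inv

  q≈ui : q ≈ u * i
  q≈ui = combine (solve 3 (λ q r i → q := q :* r :* i :+ (:- q) :* (r :* i :- :# 1)) refl q r i) ((- q) ⊡ ri)

  𝐸≈Ffi : 𝐸 ≈ E₂₅ * f * i
  𝐸≈Ffi = combine (solve 5 (λ E r i F f → E :=
    F :* f :* i :+ ((:- E) :* (r :* i :- :# 1) :+ i :* (E :* r :- F :* f))) refl 𝐸 r i E₂₅ f)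
    ((- 𝐸) ⊡ ri ⊞ i ⊡ reduce euler-dissection)

  E₅⁶≈ : E₅ ^ 6 ≈ E₂₅ ^ 6 * T u * i ^ 5
  E₅⁶≈ = combine (solve 5 (λ E F T r i → E :=
    F :* T :* i :+ ((:- E) :* (r :* i :- :# 1) :+ (:- i) :* (F :* T :- E :* r))) refl (E₅ ^ 6) (E₂₅ ^ 6) (T u)
    (r ^ 5) (i ^ 5))
    ((- E₅ ^ 6) ⊡ reduce (^-1 r-inv 5) ⊞ (- i ^ 5) ⊡ reduce norm-identity)

  common : Series
  common = E₂₅ ^ 6 * i ^ 6 * f * (# 1 + u ^ 10)

  -- With E = E₂₅ f/r, E₅⁶ = E₂₅⁶ T/r⁵ and q = u/r the left side is E₂₅⁶ f (f⁵ + u P Q)/r⁶, and f⁵ +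
  -- u P Q ≡ 1 + u¹⁰. In `G₅≈` the same series appears because T + u⁵ ≡ 1 + u¹⁰.
  G≈ : 𝐸 ^ 6 + q * E₅ ^ 6 ≈ common
  G≈ = trans (+-cong (pow-cong 6 𝐸≈Ffi)
    (*-cong q≈ui (trans E₅⁶≈ (*-cong (*-cong refl (sym (reduce (factorisation u)))) refl))))
    (combine (solve 3 (λ F i u →
        let f = :# 1 :- u :- u :* u
            :P = :# 1 :+ :# 3 :* u :+ :# 4 :* u :^ 2 :+ :# 2 :* u :^ 3 :+ u :^ 4
            :Q = :# 1 :- :# 2 :* u :+ :# 4 :* u :^ 2 :- :# 3 :* u :^ 3 :+ u :^ 4 in
        (F :* f :* i) :^ 6 :+ u :* i :* (F :^ 6 :* (f :* (:P :* :Q)) :* i :^ 5) :=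
        F :^ 6 :* i :^ 6 :* f :* (:# 1 :+ u :^ 10) :+
        (F :^ 6 :* i :^ 6 :* f :* halfDefect u) :* (:# 2 :- :# 0)) refl E₂₅ i u)
      ((E₂₅ ^ 6 * i ^ 6 * f * halfDefect′ u) ⊡ 0≈2))
    where
    -- Half of f⁵ + u P Q - 1 - u¹⁰, which has even coefficients.
    halfDefect : ∀ {n} → Polynomial n → Polynomial n
    halfDefect u = con (ℤ.- + 2) :* u :^ 1 :+ :# 3 :* u :^ 2 :+ :# 6 :* u :^ 3 :+ con (ℤ.- + 6) :* u :^ 4
      :+ con (ℤ.- + 3) :* u :^ 5 :+ :# 6 :* u :^ 6 :+ :# 6 :* u :^ 7 :+ con (ℤ.- + 3) :* u :^ 8
      :+ con (ℤ.- + 2) :* u :^ 9 :+ con (ℤ.- + 1) :* u :^ 10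
    halfDefect′ : Series → Series
    halfDefect′ u = const (ℤ.- + 2) * u ^ 1 + # 3 * u ^ 2 + # 6 * u ^ 3 + const (ℤ.- + 6) * u ^ 4
      + const (ℤ.- + 3) * u ^ 5 + # 6 * u ^ 6 + # 6 * u ^ 7 + const (ℤ.- + 3) * u ^ 8 + const (ℤ.- + 2) * u ^ 9
      + const (ℤ.- + 1) * u ^ 10

  G₅≈ : (E₅ ^ 6 + q ^ 5 * E₂₅ ^ 6) * (i * f) ≈ common
  G₅≈ = trans (*-cong (+-cong E₅⁶≈ (*-cong (pow-cong 5 q≈ui) refl)) refl)
    (combine (solve 4 (λ F i u f →
      (F :* (:# 1 :- :# 11 :* u :^ 5 :- u :^ 10) :* i :^ 5 :+ (u :* i) :^ 5 :* F) :* (i :* f) :=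
        F :* i :^ 6 :* f :* (:# 1 :+ u :^ 10)
          :+ (F :* i :^ 6 :* f :* (:- (:# 5 :* u :^ 5) :- u :^ 10)) :* (:# 2 :- :# 0)) refl (E₂₅ ^ 6) i u f)
      ((E₂₅ ^ 6 * i ^ 6 * f * (- (# 5 * u ^ 5) - u ^ 10)) ⊡ 0≈2))

  -- Both sides satisfy φ(q) = φ(q⁵) f / R(q⁵).
  level-5-relation : 𝐸 * E₅ ≈ 𝐸 ^ 6 + q * E₅ ^ 6
  level-5-relation = combine
    (solve 2 (λ a b → b := a :+ (:- :# 1) :* (a :- b :- :# 0)) refl (𝐸 ^ 6 + q * E₅ ^ 6) (𝐸 * E₅))
    ((- # 1) ⊡ dil-contraction {Δ} {i * f} Δ≈ Δ-0)
    where
    Δ : Series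
    Δ = 𝐸 ^ 6 + q * E₅ ^ 6 - 𝐸 * E₅
    Δ-0 : Δ 0 ∼ + 0
    Δ-0 = ∼-reflexive (≡-trans (coeff-+ (𝐸 ^ 6 + q * E₅ ^ 6) (- (𝐸 * E₅)) 0) (cong₂ ℤ._+_
      (+-0 {𝐸 ^ 6} (^-0 {𝐸} 6 𝐸-0) (*-0ˡ {q} (E₅ ^ 6) ≡-refl))
        (≡-trans (coeff-neg (𝐸 * E₅) 0) (cong ℤ.-_ (*-0 {𝐸} 𝐸-0 E₅-0)))))
    dilΔ : dil 5 Δ ≈ E₅ ^ 6 + q ^ 5 * E₂₅ ^ 6 - E₅ * E₂₅
    dilΔ = trans (Dil.τ-+ 5 (𝐸 ^ 6 + q * E₅ ^ 6) (- (𝐸 * E₅))) (+-cong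
      (trans (Dil.τ-+ 5 (𝐸 ^ 6) (q * E₅ ^ 6))
        (+-cong (Dil.τ-^ 5 𝐸 6) (trans (Dil.τ-* 5 q (E₅ ^ 6))
        (*-cong (trans (dil-q^ 5 1) (sym (q^-^ (+ 2) 1 5))) (Dil.τ-^ 5 E₅ 6)))))
      (trans (Dil.τ-neg 5 (𝐸 * E₅)) (-‿cong (Dil.τ-* 5 𝐸 E₅))))
    Δ≈ : Δ ≈ dil 5 Δ * (i * f)
    Δ≈ = trans (+-cong (trans G≈ (sym G₅≈)) (-‿cong (*-cong 𝐸≈Ffi refl)))
      (trans (solve 5 (λ A F f i E → A :* (i :* f) :- F :* f :* i :* E := (A :- E :* F) :* (i :* f)) refl
        (E₅ ^ 6 + q ^ 5 * E₂₅ ^ 6) E₂₅ f i E₅)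
        (*-cong (sym dilΔ) refl))

  h : Series
  h = 𝐸 ^ 5 * e

  -- The level five relation turns the left side into X E⁶ + κ E₅⁶, and `ramanujan` makes the first
  -- term (1 - 11κ - κ²) E₅⁶, so the terms linear in κ cancel modulo 2.
  X𝐸E₅ : X * (𝐸 * E₅) ≈ (# 1 + κ * κ) * E₅ ^ 6
  X𝐸E₅ = trans (*-cong refl level-5-relation) (combine
    (solve 4 (λ X E F q → let k = q :* X in X :* (E :+ q :* F) := (:# 1 :+ k :* k) :* F :+
        ((:- :# 1) :* (F :* (:# 1 :- :# 11 :* k :- k :* k) :- E :* X)
          :+ (:- F :* (:# 5 :* k :+ k :* k)) :* (:# 2 :- :# 0))) refl X (𝐸 ^ 6) (E₅ ^ 6) q)
    ((- # 1) ⊡ reduce ramanujan ⊞ (- E₅ ^ 6 * (# 5 * κ + κ * κ)) ⊡ 0≈2))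

  -- The quotient of `ramanujan` by `X𝐸E₅`.
  h-equation : h * (# 1 + κ * κ) ≈ # 1 + κ + κ * κ
  h-equation = cancelˡ {E₅ ^ 6} (^-0 {E₅} 6 E₅-0) (combine
    (solve 6 (λ E F₆ F e X k → F₆ :* (E :^ 5 :* e :* (:# 1 :+ k :* k)) := F₆ :* (:# 1 :+ k :+ k :* k) :+
        ((:- (E :^ 5 :* e)) :* (X :* (E :* F) :- (:# 1 :+ k :* k) :* F₆) :+ (E :^ 6 :* X) :* (F :* e :- :# 1)
         :+ (:- :# 1) :* (F₆ :* (:# 1 :- :# 11 :* k :- k :* k) :- E :^ 6 :* X)
         :+ (:- F₆ :* (:# 6 :* k :+ k :* k)) :* (:# 2 :- :# 0))) refl 𝐸 (E₅ ^ 6) E₅ e X κ)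
    ((- (𝐸 ^ 5 * e)) ⊡ X𝐸E₅ ⊞ (𝐸 ^ 6 * X) ⊡ E₅e ⊞ (- # 1) ⊡ reduce ramanujan
      ⊞ (- E₅ ^ 6 * (# 6 * κ + κ * κ)) ⊡ 0≈2))

  -- The level five relation times E⁴/E₅². Modulo 2 the square is a series in q² and the fourth
  -- power one in q⁴, so this separates even and odd exponents.
  h-dissection : h ≈ h ^ 2 + q * (𝐸 * E₅) ^ 4
  h-dissection = combine
    (solve 4 (λ E F e q → E :^ 5 :* e := (E :^ 5 :* e) :^ 2 :+ q :* (E :* F) :^ 4 :+
        ((E :^ 4 :* e :^ 2) :* (E :* F :- (E :^ 6 :+ q :* F :^ 6)) :+
         (q :* E :^ 4 :* F :^ 4 :* (F :* e :+ :# 1) :- E :^ 5 :* e) :* (F :* e :- :# 1))) refl 𝐸 E₅ e q)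
    ((𝐸 ^ 4 * e ^ 2) ⊡ level-5-relation ⊞ (q * 𝐸 ^ 4 * E₅ ^ 4 * (E₅ * e + # 1) - 𝐸 ^ 5 * e) ⊡ E₅e)

  1+κ-0 : (# 1 + κ) 0 ≡ + 1
  1+κ-0 = +-0 {# 1} ≡-refl (*-0ˡ {q} X ≡-refl)

  j : Series
  j = inv (# 1 + κ)

  -- Modulo 2, h = 1 + κ/(1 + κ)² = 1 + j + j², so j = h + 1 + j², and j inherits the odd part of h.
  j-dissection : j ≈ q * (𝐸 * E₅) ^ 4 + (h ^ 2 + # 1 + j ^ 2)
  j-dissection = combine
    (solve 4 (λ j k h Y → let a = (:# 1 :+ k) :* j in j := Y :+ (h :^ 2 :+ :# 1 :+ j :^ 2) :+
        (j :^ 2 :* (h :* (:# 1 :+ k :* k) :- (:# 1 :+ k :+ k :* k))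
         :+ (:- ((h :- :# 1) :* (a :+ :# 1) :+ j)) :* (a :- :# 1)
         :+ :# 1 :* (h :- (h :^ 2 :+ Y)) :+ (h :* k :* j :^ 2 :- h) :* (:# 2 :- :# 0))) refl j κ h
           (q * (𝐸 * E₅) ^ 4))
    (j ^ 2 ⊡ h-equation ⊞ (- ((h - # 1) * ((# 1 + κ) * j + # 1) + j)) ⊡ *-inv (# 1 + κ) 1+κ-0
      ⊞ # 1 ⊡ h-dissection ⊞ (h * κ * j ^ 2 - h) ⊡ 0≈2)

  square-Supp : ∀ g → Supp 2 0 (g ^ 2)
  square-Supp g = Supp-cong (sym (frobenius₂ g)) (Supp-dil g)

  dil²-Supp : ∀ g → Supp 4 0 (dil 2 (dil 2 g))
  dil²-Supp g = supp λ n n≢0 → go n n≢0 (n % 2) ≡-refl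
    where
    even-off : ∀ k → k % 2 ≢ 0 → dil 2 (dil 2 g) (k ℕ.* 2) ∼ + 0
    even-off k k≢0 = ∼-trans (∼-reflexive (dil-multiple 2 (dil 2 g) k)) (off (Supp-dil {2} g) k k≢0)
    quarter : ∀ k → k % 2 ≡ 0 → (k ℕ.* 2) % 4 ≡ 0
    quarter k h = ≡-trans (cong (λ x → (x ℕ.* 2) % 4) (≡-trans (m≡m%n+[m/n]*n k 2) (cong (ℕ._+ k / 2 ℕ.* 2) h)))
      (≡-trans (cong (_% 4) (ℕₚ.*-assoc (k / 2) 2 2)) (m*n%n≡0 (k / 2) 4))
    go : ∀ n → n % 4 ≢ 0 → ∀ c → n % 2 ≡ c → dil 2 (dil 2 g) n ∼ + 0
    go n n≢0 zero    h = subst (λ n → dil 2 (dil 2 g) n ∼ + 0) (≡-sym n≡)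
      (even-off (n / 2) (λ h′ → n≢0 (≡-trans (cong (_% 4) n≡) (quarter (n / 2) h′))))
      where
      n≡ : n ≡ n / 2 ℕ.* 2
      n≡ = ≡-trans (m≡m%n+[m/n]*n n 2) (cong (ℕ._+ n / 2 ℕ.* 2) h)
    go n n≢0 (suc c) h = off (Supp-dil {2} (dil 2 g)) n (λ h′ → contradiction (≡-trans (≡-sym h) h′) λ ())

  fourth-Supp : ∀ g → Supp 4 0 (g ^ 4)
  fourth-Supp g = Supp-cong
    (sym (trans (solve 1 (λ g → g :^ 4 := (g :^ 2) :^ 2) refl g)
    (trans (frobenius₂ (g ^ 2)) (Dil.τ-cong 2 (frobenius₂ g))))) (dil²-Supp g)

  odd-part-Supp : Supp 4 1 (q * (𝐸 * E₅) ^ 4)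
  odd-part-Supp = Supp-* {d = 4} (Supp-q^ {4} 1) (fourth-Supp (𝐸 * E₅))

  %4⇒%2 : ∀ {c} n → n % 4 ≡ c → n % 2 ≡ c % 2
  %4⇒%2 n h = ≡-trans (≡-sym (m∣n⇒o%n%m≡o%m 2 4 n (dividesℕ 2 ≡-refl))) (cong (_% 2) h)

  h-even-at-3 : ∀ n → n % 4 ≡ 3 → h n ∼ + 0
  h-even-at-3 n n≡3 = ∼-trans (at h-dissection n) (∼-trans (∼-reflexive (coeff-+ (h ^ 2) (q * (𝐸 * E₅) ^ 4) n))
    (∼-+ (off (square-Supp h) n (λ h′ → contradiction (≡-trans (≡-sym (%4⇒%2 n n≡3)) h′) λ ()))
         (off odd-part-Supp n (λ h′ → contradiction (≡-trans (≡-sym n≡3) h′) λ ()))))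

  -- At even exponents only h² ≡ h(q²) contributes, which halves the index and reduces the claim to
  -- `h-even-at-3`.
  h-even-at-6 : ∀ n → n % 4 ≡ 3 → h (n ℕ.* 2) ∼ + 0
  h-even-at-6 n n≡3 = ∼-trans (at h-dissection (n ℕ.* 2))
    (∼-trans (∼-reflexive (coeff-+ (h ^ 2) (q * (𝐸 * E₅) ^ 4) (n ℕ.* 2)))
    (∼-+ (∼-trans (at (frobenius₂ h) (n ℕ.* 2))
      (∼-trans (∼-reflexive (dil-multiple 2 h n)) (h-even-at-3 n n≡3)))
         (off odd-part-Supp (n ℕ.* 2)
           (λ h′ → contradiction (≡-trans (≡-sym (≡-trans (%4⇒%2 (n ℕ.* 2) h′) ≡-refl)) (m*n%n≡0 n 2)) λ ()))))

  ω : Series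
  ω = j - π 2 j

  ω≈ : ω ≈ q * (𝐸 * E₅) ^ 4
  ω≈ = trans (+-cong j-dissection
    (-‿cong (trans (π-cong {2} j-dissection) (trans (π-+ {2} (q * (𝐸 * E₅) ^ 4) even)
      (trans (+-cong (π-kill {2} 0
        (Supp-* {d = 2} (Supp-q^ {2} 1)
        (Supp-cong (solve 1 (λ y → (y :^ 2) :^ 2 := y :^ 4) refl (𝐸 * E₅)) (square-Supp ((𝐸 * E₅) ^ 2)))))
        (π-id {2} (Supp-+ (Supp-+ (square-Supp h) (Supp-const (+ 1))) (square-Supp j)))) (+-identityˡ even))))))
    (solve 2 (λ y s → y :+ s :- s := y) refl (q * (𝐸 * E₅) ^ 4) even)
    where
    even : Series
    even = h ^ 2 + # 1 + j ^ 2

  ω-Supp : Supp 4 1 ω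
  ω-Supp = Supp-cong (sym ω≈) odd-part-Supp

  dil-j²-Supp : Supp 4 0 (dil 2 j * dil 2 j)
  dil-j²-Supp = Supp-cong (sym (trans (solve 1 (λ y → y :* y := y :^ 2) refl (dil 2 j)) (frobenius₂ (dil 2 j))))
    (dil²-Supp j)

  v : Series
  v = dil 2 κ

  dil-h-equation : dil 2 h * (# 1 + v * v) ≈ # 1 + v + v * v
  dil-h-equation = trans (sym
    (trans (Dil.τ-* 2 h (# 1 + κ * κ))
    (*-cong refl (trans (Dil.τ-+ 2 (# 1) (κ * κ)) (+-cong (Dil.τ-const 2 (+ 1)) (Dil.τ-* 2 κ κ))))))
    (trans (Dil.τ-cong 2 h-equation)
      (trans (Dil.τ-+ 2 (# 1 + κ) (κ * κ))
      (+-cong (trans (Dil.τ-+ 2 (# 1) κ) (+-cong (Dil.τ-const 2 (+ 1)) refl)) (Dil.τ-* 2 κ κ))))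

  ε : Series
  ε = 𝐸 * e

  -- The level five relation divided by E₅².
  ε≈ : ε ≈ 𝐸 ^ 6 * e ^ 2 + q * E₅ ^ 4
  ε≈ = combine
    (solve 4 (λ E F e q → E :* e := E :^ 6 :* e :^ 2 :+ q :* F :^ 4 :+
      (e :^ 2 :* (E :* F :- (E :^ 6 :+ q :* F :^ 6))
        :+ (q :* F :^ 4 :* (F :* e :+ :# 1) :- E :* e) :* (F :* e :- :# 1))) refl 𝐸 E₅ e q)
    (e ^ 2 ⊡ level-5-relation ⊞ (q * E₅ ^ 4 * (E₅ * e + # 1) - 𝐸 * e) ⊡ E₅e)

  -- ρ is the defect of multiplicativity in X(q) X(-q) = ρ X(q²), a consequence of `ℛ-norm`; modulo
  -- 2 it disappears because R(q⁴) ≡ R(q²)².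
  r₂ r₄ ρ : Series
  r₂ = dil 2 ℛ
  r₄ = dil 2 r₂
  ρ = (r₄ * inv r₂ ^ 2) ^ 5

  ρ≈1 : ρ ≈ # 1
  ρ≈1 = trans (pow-cong 5 (trans (*-cong (sym (frobenius₂ r₂)) refl)
      (trans (solve 2 (λ a b → a :^ 2 :* b :^ 2 := (a :* b) :^ 2) refl r₂ (inv r₂))
        (pow-cong 2 (*-inv r₂ (dilℛ-0 2))))))
    (solve 0 ((:# 1 :^ 2) :^ 5 := :# 1) refl)

open Modulo2

-- The congruences modulo 4.

module Modulo4 where
  open SeriesRing

  open SeriesMod (+ 4)
  open Substitutions (+ 4)
  open Support (+ 4)

  private
    module Z = SeriesMod (+ 0)
    module Supp₂ = Support (+ 2)

  0≈4 : # 4 ≈ # 0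
  0≈4 = const-m≈0 (+ 4)

  f+σf : ∀ g → g + σ g Z.≈ # 2 * π 2 g
  f+σf g = Z.≗⇒≈ λ n → ≡-trans (coeff-+ g (σ g) n) (≡-trans (go g n) (≡-sym (coeff-const* (+ 2) (π 2 g) n)))
    where
    double : ∀ t → t ℤ.+ t ≡ + 2 ℤ.* t
    double = solve-∀
    cancel-neg : ∀ t → t ℤ.+ ℤ.- t ≡ + 2 ℤ.* + 0
    cancel-neg t = ℤₚ.+-inverseʳ t
    neg-neg : ∀ s t → s ℤ.+ ℤ.- (ℤ.- t) ≡ s ℤ.+ t
    neg-neg s t = cong (λ x → s ℤ.+ x) (ℤₚ.neg-involutive t)
    go : ∀ g n → g n ℤ.+ σ g n ≡ + 2 ℤ.* π 2 g n
    go g zero          = double (g 0)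
    go g (suc zero)    = cancel-neg (g 1)
    go g (suc (suc n)) = ≡-trans (neg-neg (g (suc (suc n))) (σ (tail (tail g)) n)) (go (tail (tail g)) n)

  -- Fourth powers are the substitute for Frobenius modulo 4: they are even series.
  fourth-power : ∀ g → g ^ 4 ≈ dil 2 g * dil 2 g
  fourth-power g = trans (solve 1 (λ g → g :^ 4 := g :^ 2 :* g :^ 2) refl g) (square-mod-4 (frobenius₂ g))

  fourth-power-Supp : ∀ g → Supp 2 0 (g ^ 4)
  fourth-power-Supp g = Supp-cong (sym (fourth-power g)) (Supp-* {d = 2} (Supp-dil g) (Supp-dil g))

  -- Write g = ε⁴ ε² and insert the square of `ε≈`, valid modulo 4. The two squares give this even
  -- series; the cross term is 2q h², which is 2q h(q²) modulo 4.
  gₑ : Series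
  gₑ = ε ^ 4 * ((𝐸 ^ 3 * e) ^ 4 + q^ 2 * (E₅ ^ 2) ^ 4)

  gₑ-Supp : Supp 2 0 gₑ
  gₑ-Supp = Supp-* {d = 2} (fourth-power-Supp ε)
    (Supp-+ (fourth-power-Supp (𝐸 ^ 3 * e)) (Supp-* {d = 2} (Supp-q^ {2} 2) (fourth-power-Supp (E₅ ^ 2))))

  g-split : g ≈ gₑ + # 2 * dil 2 h * q
  g-split = combine
    (solve 6 (λ E F e q q₂ h₂ →
        E :^ 6 :* e :^ 6 := (E :* e) :^ 4 :* ((E :^ 3 :* e) :^ 4 :+ q₂ :* (F :^ 2) :^ 4) :+ :# 2 :* h₂ :* q :+
        (((E :* e) :^ 4) :* (E :* e :* (E :* e) :- (E :^ 6 :* e :^ 2 :+ q :* F :^ 4) :* (E :^ 6 :* e :^ 2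
          :+ q :* F :^ 4))
         :+ (E :^ 4 :* e :^ 4 :* F :^ 8) :* (q :* q :- q₂)
         :+ (:# 2 :* E :^ 10 :* e :^ 2 :* q) :* (e :^ 4 :* F :^ 4 :- :# 1)
         :+ q :* (:# 2 :* (E :^ 5 :* e) :^ 2 :- :# 2 :* h₂))) refl 𝐸 E₅ e q (q^ 2) (dil 2 h))
    ((ε ^ 4) ⊡ square-mod-4 ε≈ ⊞ (𝐸 ^ 4 * e ^ 4 * E₅ ^ 8) ⊡ sym (q^-+ (+ 4) 1 1)
      ⊞ (# 2 * 𝐸 ^ 10 * e ^ 2 * q) ⊡ trans (*-comm (e ^ 4) (E₅ ^ 4)) (reduce (^-1 E₅-inv 4))
        ⊞ q ⊡ double-mod-4 (frobenius₂ h))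

  -- The hypothesis makes the sixth power of the norm F(q²)¹⁸/F(q⁴)⁶. Modulo 4, F(q²)⁴ ≡ F(q⁴)², so
  -- the denominator is F(q²)¹².
  sixth-power-norm : ∀ {F} → F 0 ≡ + 1 → F * σ F * dil 2 (dil 2 F) ≈ dil 2 F * dil 2 F ^ 2 → (F * σ F) ^ 6
    ≈ dil 2 F ^ 6
  sixth-power-norm {F} F0 hyp = cancelˡ {dil 2 F ^ 12} (^-0 {dil 2 F} 12 (≡-trans (dil-0 2 F) F0)) (combine
    (solve 3 (λ N F₂ F₄ → F₂ :^ 12 :* N :^ 6 := F₂ :^ 12 :* F₂ :^ 6 :+
        ((N :^ 6 :* (F₂ :^ 8 :+ F₂ :^ 4 :* F₄ :^ 2 :+ F₄ :^ 4)) :* (F₂ :^ 2 :* F₂ :^ 2 :- F₄ :* F₄) :+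
         :# 1 :* ((N :* F₄) :^ 6 :- (F₂ :* F₂ :^ 2) :^ 6))) refl (F * σ F) (dil 2 F) (dil 2 (dil 2 F)))
    (((F * σ F) ^ 6 * (dil 2 F ^ 8 + dil 2 F ^ 4 * dil 2 (dil 2 F) ^ 2 + dil 2 (dil 2 F) ^ 4)) ⊡ square-mod-4
      (frobenius₂ (dil 2 F))
      ⊞ # 1 ⊡ pow-cong 6 hyp))

  E₅-norm : E₅ * σ E₅ * dil 2 (dil 2 E₅) ≈ dil 2 E₅ * dil 2 E₅ ^ 2
  E₅-norm = reduce (norm₂ {E₅} {poch 5 10} {E₅}
    (Z.trans dil5𝐸 (Z.trans (poch-split 2 5 5) (Z.*-cong (Z.*-identityˡ _)
      (Z.sym (Z.trans (Substitutions.Dil.τ-cong (+ 0) 2 dil5𝐸) (dil-poch 2 5 5)))))) (poch-odd-norm 2 5))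

  g-norm : g * σ g ≈ dil 2 g
  g-norm = cancelˡ {dil 2 E₅ ^ 6} (^-0 {dil 2 E₅} 6 (≡-trans (dil-0 2 E₅) E₅-0)) (trans left (sym right))
    where
    σg : σ g ≈ σ 𝐸 ^ 6 * σ e ^ 6
    σg = trans (Sigma.τ-* (𝐸 ^ 6) (e ^ 6)) (*-cong (Sigma.τ-^ 𝐸 6) (Sigma.τ-^ e 6))
    E₅eₘ : E₅ * e ≈ # 1
    E₅eₘ = reduce E₅-inv
    σE₅e : σ E₅ * σ e ≈ # 1
    σE₅e = trans (sym (Sigma.τ-* E₅ e)) (trans (Sigma.τ-cong E₅eₘ) (Sigma.τ-const (+ 1)))
    units : E₅ * σ E₅ * (e * σ e) ≈ # 1
    units = trans (solve 4 (λ a b c d → a :* b :* (c :* d) := a :* c :* (b :* d)) refl E₅ (σ E₅) e (σ e))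
      (trans (*-cong E₅eₘ σE₅e) (*-identityˡ (# 1)))
    units⁶ : (E₅ * σ E₅) ^ 6 * (e * σ e) ^ 6 ≈ # 1
    units⁶ = trans (solve 2 (λ a b → a :^ 6 :* b :^ 6 := (a :* b) :^ 6) refl (E₅ * σ E₅) (e * σ e))
      (trans (pow-cong 6 units) (solve 0 (:# 1 :^ 6 := :# 1) refl))
    left : dil 2 E₅ ^ 6 * (g * σ g) ≈ dil 2 𝐸 ^ 6
    left = trans (*-cong (sym (sixth-power-norm E₅-0 E₅-norm)) (*-cong refl σg))
      (trans (solve 5 (λ N a b c d → N :* (a :^ 6 :* c :^ 6 :* (b :^ 6 :* d :^ 6)) :=
        N :* (c :* d) :^ 6 :* (a :* b) :^ 6) refl ((E₅ * σ E₅) ^ 6) 𝐸 (σ 𝐸) e (σ e))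
        (trans (*-cong units⁶ (sixth-power-norm 𝐸-0 (reduce 𝐸-norm))) (*-identityˡ _)))
    right : dil 2 E₅ ^ 6 * dil 2 g ≈ dil 2 𝐸 ^ 6
    right = trans (*-cong (sym (Dil.τ-^ 2 E₅ 6)) refl) (trans (sym (Dil.τ-* 2 (E₅ ^ 6) g)) (trans (Dil.τ-cong 2
      (trans (solve 3 (λ F E e → F :^ 6 :* (E :^ 6 :* e :^ 6) := E :^ 6 :* (F :* e) :^ 6) refl E₅ 𝐸 e)
        (trans (*-cong refl (trans (pow-cong 6 E₅eₘ) (solve 0 (:# 1 :^ 6 := :# 1) refl))) (*-identityʳ _))))
          (Dil.τ-^ 2 𝐸 6)))

  -- The elimination in letters: c is the even part of κ, N = κ(q) κ(-q), v = κ(q²), ρ = 1 + 2δ and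
  -- H = h(q²). Nothing is known about δ at the outset: doubling h₃ gives 2c, then h₂ gives 2δ, and
  -- with these h₃ yields c, where h₄ removes H.
  module _ (c v N δ H : Series)
    (h₁ : N ≈ - ((# 1 + # 2 * δ) * v))
    (h₂ : # 1 + # 2 * c - N - # 2 * c * N + N * N ≈ (# 1 + # 2 * δ) * (# 1 + v - v * v))
    (h₃ : c + N - N * c ≈ # 2 * v * H)
    (h₄ : # 2 * (H * (# 1 + v * v)) ≈ # 2 * (# 1 + v + v * v))
    (v-0 : v 0 ≡ + 0) where
    private
      1+v-0 : (# 1 + v) 0 ≡ + 1
      1+v-0 = +-0 {# 1} ≡-refl v-0

      2c : # 2 * c * (# 1 + v) ≈ # 2 * v
      2c = combine
        (solve 5 (λ c v N δ H → :# 2 :* c :* (:# 1 :+ v) := :# 2 :* v :+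
          (:# 2 :* (c :+ N :- N :* c :- :# 2 :* v :* H)
            :+ (:- (:# 2 :* (:# 1 :- c))) :* (N :- :- ((:# 1 :+ :# 2 :* δ) :* v))
           :+ (v :* H :+ (:# 1 :- c) :* δ :* v) :* (:# 4 :- :# 0))) refl c v N δ H)
        (# 2 ⊡ h₃ ⊞ (- (# 2 * (# 1 - c))) ⊡ h₁ ⊞ (v * H + (# 1 - c) * δ * v) ⊡ 0≈4)

      2δ : # 2 * δ * (# 1 + v) ≈ # 2 * v
      2δ = cancelˡ {# 1 + v} 1+v-0 (combine
        (solve 4 (λ c v N δ → let M = :- ((:# 1 :+ :# 2 :* δ) :* v) in
          (:# 1 :+ v) :* (:# 2 :* δ :* (:# 1 :+ v)) := (:# 1 :+ v) :* (:# 2 :* v) :+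
          ((:- :# 1) :* (:# 1 :+ :# 2 :* c :- N :- :# 2 :* c :* N
            :+ N :* N :- (:# 1 :+ :# 2 :* δ) :* (:# 1 :+ v :- v :* v))
           :+ (:- :# 1 :- :# 2 :* c :+ N :+ M) :* (N :- M)
           :+ :# 1 :* (:# 2 :* c :* (:# 1 :+ v) :- :# 2 :* v)
           :+ (δ :* v :+ δ :* v :* v :+ c :* δ :* v :+ δ :* v :* v :+ δ :* δ :* v :* v) :* (:# 4 :- :# 0))) refl
             c v N δ)
        ((- # 1) ⊡ h₂ ⊞ (- # 1 - # 2 * c + N + - ((# 1 + # 2 * δ) * v)) ⊡ h₁ ⊞ # 1 ⊡ 2c
          ⊞ (δ * v + δ * v * v + c * δ * v + δ * v * v + δ * δ * v * v) ⊡ 0≈4))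

    even-part-equation : c * (# 1 + v) ≈ - v
    even-part-equation = cancelˡ {(# 1 + v) * (# 1 + v)} (*-0 {# 1 + v} 1+v-0 1+v-0) (combine
      (solve 5 (λ c v N δ H → let w = :# 1 :+ v in
        w :* w :* (c :* w) := w :* w :* (:- v) :+
        ((w :* w) :* (c :+ N :- N :* c :- :# 2 :* v :* H)
          :+ (:- (w :* w :* (:# 1 :- c))) :* (N :- :- ((:# 1 :+ :# 2 :* δ) :* v))
         :+ (v :* w :* (:# 1 :- c)) :* (:# 2 :* δ :* w :- :# 2 :* v)
           :+ (:- (v :* v)) :* (:# 2 :* c :* w :- :# 2 :* v)
         :+ v :* (:# 2 :* (H :* (:# 1 :+ v :* v)) :- :# 2 :* (:# 1 :+ v :+ v :* v))
         :+ (v :+ :# 2 :* v :* v :+ v :* v :* v :+ H :* v :* v) :* (:# 4 :- :# 0))) refl c v N δ H)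
      (((# 1 + v) * (# 1 + v)) ⊡ h₃ ⊞ (- ((# 1 + v) * (# 1 + v) * (# 1 - c))) ⊡ h₁
        ⊞ (v * (# 1 + v) * (# 1 - c)) ⊡ 2δ ⊞ (- (v * v)) ⊡ 2c ⊞ v ⊡ h₄
        ⊞ (v + # 2 * v * v + v * v * v + H * v * v) ⊡ 0≈4))

    norm-equation : N ≈ v + # 2 * c
    norm-equation = cancelˡ {# 1 + v} 1+v-0 (combine
      (solve 4 (λ c v N δ → let w = :# 1 :+ v in
        w :* N := w :* (v :+ :# 2 :* c) :+
        (w :* (N :- :- ((:# 1 :+ :# 2 :* δ) :* v)) :+ (:- v) :* (:# 2 :* δ :* w :- :# 2 :* v)
          :+ (:- :# 1) :* (:# 2 :* c :* w :- :# 2 :* v)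
         :+ (:- (v :+ v :* v)) :* (:# 4 :- :# 0))) refl c v N δ)
      ((# 1 + v) ⊡ h₁ ⊞ (- v) ⊡ 2δ ⊞ (- # 1) ⊡ 2c ⊞ (- (v + v * v)) ⊡ 0≈4))

  Xq² c N : Series
  Xq² = dil 2 X
  c = π 2 κ
  N = κ * σ κ

  v-0 : v 0 ≡ + 0
  v-0 = ≡-trans (dil-0 2 κ) (*-0ˡ {q} X ≡-refl)

  v≈ : v ≈ q * q * Xq²
  v≈ = trans (Dil.τ-* 2 q X) (*-cong (trans (dil-q^ 2 1) (q^-+ (+ 4) 1 1)) refl)

  XσX : X * σ X ≈ ρ * Xq²
  XσX = trans (*-cong refl (Sigma.τ-^ ℛ 5))
    (trans (solve 2 (λ a b → a :^ 5 :* b :^ 5 := (a :* b) :^ 5) refl ℛ (σ ℛ))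
    (trans (pow-cong 5 ratio)
      (trans (solve 3 (λ a b d → (a :* b :^ 2 :* d) :^ 5 := (a :* b :^ 2) :^ 5 :* d :^ 5) refl r₄ (inv r₂) r₂)
      (*-cong refl (sym (Dil.τ-^ 2 ℛ 5))))))
    where
    ratio : ℛ * σ ℛ ≈ r₄ * inv r₂ ^ 2 * r₂
    ratio = combine (solve 4 (λ n a b d → n :=
      a :* b :^ 2 :* d :+ ((:- n :- a :* b) :* (d :* b :- :# 1) :+ b :* (n :* d :- a))) refl (ℛ * σ ℛ) r₄
      (inv r₂) r₂)
      ((- (ℛ * σ ℛ) - r₄ * inv r₂) ⊡ *-inv r₂ (dilℛ-0 2) ⊞ inv r₂ ⊡ reduce ℛ-norm)

  σκ : σ κ ≈ - (q * σ X)
  σκ = trans (Sigma.τ-* q X)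
    (trans (*-cong (trans (Sigma.τ-q^ 1) (*-identityʳ _)) refl)
    (solve 2 (λ q x → :- q :* x := :- (q :* x)) refl q (σ X)))

  N≈ : N ≈ - (ρ * v)
  N≈ = trans (*-cong refl σκ)
    (trans (solve 3 (λ q x y → q :* x :* :- (q :* y) := :- (x :* y :* (q :* q))) refl q X (σ X))
    (-‿cong (trans (*-cong XσX refl)
      (trans (solve 3 (λ a b d → a :* b :* d := a :* (d :* b)) refl ρ Xq² (q * q)) (*-cong refl (sym v≈))))))

  half : Series
  half = proj₁ (∃-quotient ρ≈1)

  ρ≈ : ρ ≈ # 1 + # 2 * half
  ρ≈ = reduce (proj₂ (∃-quotient ρ≈1))

  ρ-Supp : Supp 2 0 ρ
  ρ-Supp = Supp-^ (Supp-* {d = 2} (Supp-dil r₂) (Supp-^ (Supp-inv (dilℛ-0 2) (Supp-dil ℛ)) 2)) 5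

  N-Supp : Supp 2 0 N
  N-Supp = Supp-cong (sym N≈) (Supp-neg (Supp-* {d = 2} ρ-Supp (Supp-dil κ)))

  κ+σκ : κ + σ κ ≈ # 2 * c
  κ+σκ = reduce (f+σf κ)

  X·g₄ : # 1 + κ - κ * κ ≈ X * g
  X·g₄ = trans (combine (solve 1 (λ k → :# 1 :+ k :- k :* k :=
    :# 1 :- :# 11 :* k :- k :* k :+ (:# 3 :* k) :* (:# 4 :- :# 0)) refl κ)
    ((# 3 * κ) ⊡ 0≈4)) (reduce X·g)

  σ-X·g₄ : # 1 + σ κ - σ κ * σ κ ≈ σ X * σ g
  σ-X·g₄ = trans (sym (trans (Sigma.τ-+ (# 1 + κ) (- (κ * κ)))
    (+-cong (trans (Sigma.τ-+ (# 1) κ) (+-cong (Sigma.τ-const (+ 1)) refl))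
    (trans (Sigma.τ-neg (κ * κ)) (-‿cong (Sigma.τ-* κ κ)))))) (trans (Sigma.τ-cong X·g₄) (Sigma.τ-* X g))

  dil-X·g₄ : # 1 + v - v * v ≈ Xq² * dil 2 g
  dil-X·g₄ = trans (sym (trans (Dil.τ-+ 2 (# 1 + κ) (- (κ * κ)))
    (+-cong (trans (Dil.τ-+ 2 (# 1) κ) (+-cong (Dil.τ-const 2 (+ 1)) refl))
    (trans (Dil.τ-neg 2 (κ * κ)) (-‿cong (Dil.τ-* 2 κ κ)))))) (trans (Dil.τ-cong 2 X·g₄) (Dil.τ-* 2 X g))

  equation₁ : N ≈ - ((# 1 + # 2 * half) * v)
  equation₁ = trans N≈ (-‿cong (*-cong ρ≈ refl))

  -- The product of 1 + κ - κ² = X g with its image under q ↦ -q. It equals ρ X(q²) g(q²), again of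
  -- the form 1 + v - v² up to ρ, and (κ + σ κ)² = 4c² drops out.
  equation₂ : # 1 + # 2 * c - N - # 2 * c * N + N * N ≈ (# 1 + # 2 * half) * (# 1 + v - v * v)
  equation₂ = trans (combine
      (solve 3 (λ k l c → let N = k :* l in
        :# 1 :+ :# 2 :* c :- N :- :# 2 :* c :* N :+ N :* N := (:# 1 :+ k :- k :* k) :* (:# 1 :+ l :- l :* l) :+
        ((:- :# 1 :+ N :+ (k :+ l) :+ :# 2 :* c) :* (k :+ l :- :# 2 :* c) :+ (c :* c :- N) :* (:# 4 :- :# 0)))
          refl κ (σ κ) c)
      ((- # 1 + N + (κ + σ κ) + # 2 * c) ⊡ κ+σκ ⊞ (c * c - N) ⊡ 0≈4))
    (trans (*-cong X·g₄ σ-X·g₄)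
      (trans (solve 4 (λ a b d k → a :* b :* (d :* k) := a :* d :* (b :* k)) refl X g (σ X) (σ g))
      (trans (*-cong XσX g-norm) (trans (*-assoc ρ Xq² (dil 2 g)) (*-cong ρ≈ (sym dil-X·g₄))))))

  π-σκ : π 2 (σ κ) ≈ c
  π-σκ = trans (π-cong {2} (combine
    (solve 3 (λ k l c → l := :# 2 :* c :+ (:- :# 1) :* k :+ :# 1 :* (k :+ l :- :# 2 :* c)) refl κ (σ κ) c)
    (# 1 ⊡ κ+σκ)))
    (trans (π-+ {2} (# 2 * c) ((- # 1) * κ))
      (trans (+-cong (π-id {2} (Supp-* {d = 2} (Supp-const (+ 2)) (Supp-π κ)))
      (π-* {2} (Supp-neg (Supp-const (+ 1))) κ))
      (solve 1 (λ c → :# 2 :* c :+ (:- :# 1) :* c := c) refl c)))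

  -- The even part of σ κ (1 + κ - κ²) = σ κ X g. On the right σ κ X = -q ρ X(q²), so only the odd
  -- part 2q h(q²) of g contributes, giving -2ρ v h(q²); here -2ρ ≡ 2 as ρ is 1 modulo 2.
  equation₃ : c + N - N * c ≈ # 2 * v * dil 2 h
  equation₃ = trans (sym projected) (trans (π-cong {2} (trans (combine
      (solve 5 (λ k l X Y g → l :+ k :* l :+ (:- (k :* l)) :* k :=
        l :* (X :* g) :+ l :* (:# 1 :+ k :- k :* k :- X :* g)) refl κ (σ κ) X (σ X) g) (σ κ ⊡ X·g₄)) expand))
    (trans (π-+ {2} (- (ρ * Xq²) * q * gₑ) (- (ρ * Xq²) * (# 2 * dil 2 h * (q * q))))
      (trans (+-cong odd even) (trans (+-identityˡ _) final))))
    where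
    projected : π 2 (σ κ + N + - N * κ) ≈ c + N - N * c
    projected = trans (π-+ {2} (σ κ + N) (- N * κ))
      (trans (+-cong (trans (π-+ {2} (σ κ) N) (+-cong π-σκ (π-id {2} N-Supp))) (π-* {2} (Supp-neg N-Supp) κ))
      (solve 2 (λ c N → c :+ N :+ :- N :* c := c :+ N :- N :* c) refl c N))
    expand : σ κ * (X * g) ≈ - (ρ * Xq²) * q * gₑ + - (ρ * Xq²) * (# 2 * dil 2 h * (q * q))
    expand = trans (*-cong σκ refl)
      (trans (solve 4 (λ q Y X g → :- (q :* Y) :* (X :* g) := :- (X :* Y) :* q :* g) refl q (σ X) X g)
      (trans (*-cong (*-cong (-‿cong XσX) refl) g-split)
        (solve 4 (λ a q b d → a :* q :* (b :+ :# 2 :* d :* q) :=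
          a :* q :* b :+ a :* (:# 2 :* d :* (q :* q))) refl (- (ρ * Xq²)) q gₑ (dil 2 h))))
    ρX₂-Supp : Supp 2 0 (- (ρ * Xq²))
    ρX₂-Supp = Supp-neg (Supp-* {d = 2} ρ-Supp (Supp-dil X))
    odd : π 2 (- (ρ * Xq²) * q * gₑ) ≈ # 0
    odd = π-kill {2} 0 (Supp-* {d = 2} (Supp-* {d = 2} ρX₂-Supp (Supp-q^ {2} 1)) gₑ-Supp)
    even : π 2 (- (ρ * Xq²) * (# 2 * dil 2 h * (q * q))) ≈ - (ρ * Xq²) * (# 2 * dil 2 h * (q * q))
    even = π-id {2} (Supp-* {d = 2} ρX₂-Supp
      (Supp-* {d = 2} (Supp-* {d = 2} (Supp-const (+ 2)) (Supp-dil h))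
      (Supp-* {d = 2} (Supp-q^ {2} 1) (Supp-q^ {2} 1))))
    final : - (ρ * Xq²) * (# 2 * dil 2 h * (q * q)) ≈ # 2 * v * dil 2 h
    final = combine
      (solve 6 (λ ρ Y H q v δ → :- (ρ :* Y) :* (:# 2 :* H :* (q :* q)) := :# 2 :* v :* H :+
        ((:- (:# 2 :* H :* Y :* (q :* q))) :* (ρ :- (:# 1 :+ :# 2 :* δ))
          :+ (:- (:# 2 :* H)) :* (v :- q :* q :* Y)
         :+ (:- (H :* (q :* q) :* Y) :- δ :* H :* (q :* q) :* Y) :* (:# 4 :- :# 0))) refl ρ Xq²
           (dil 2 h) q v half)
      ((- (# 2 * dil 2 h * Xq² * (q * q))) ⊡ ρ≈ ⊞ (- (# 2 * dil 2 h)) ⊡ v≈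
        ⊞ (- (dil 2 h * (q * q) * Xq²) - half * dil 2 h * (q * q) * Xq²) ⊡ 0≈4)

  equation₄ : # 2 * (dil 2 h * (# 1 + v * v)) ≈ # 2 * (# 1 + v + v * v)
  equation₄ = double-mod-4 dil-h-equation

  j₂ : Series
  j₂ = dil 2 j

  1+v-0 : (# 1 + v) 0 ≡ + 1
  1+v-0 = +-0 {# 1} ≡-refl v-0

  j-inv : (# 1 + κ) * j ≈ # 1
  j-inv = *-inv (# 1 + κ) 1+κ-0

  j₂-inv : (# 1 + v) * j₂ ≈ # 1
  j₂-inv = trans (*-cong (sym (trans (Dil.τ-+ 2 (# 1) κ) (+-cong (Dil.τ-const 2 (+ 1)) refl))) refl)
    (trans (sym (Dil.τ-* 2 (# 1 + κ) j)) (trans (Dil.τ-cong 2 j-inv) (Dil.τ-const 2 (+ 1))))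

  c≈ : c ≈ j₂ - # 1
  c≈ = cancelˡ {# 1 + v} 1+v-0 (combine
    (solve 3 (λ c v j → (:# 1 :+ v) :* c := (:# 1 :+ v) :* (j :- :# 1) :+
      (:# 1 :* (c :* (:# 1 :+ v) :- :- v) :+ (:- :# 1) :* ((:# 1 :+ v) :* j :- :# 1))) refl c v j₂)
    (# 1 ⊡ even-part-equation c v N half (dil 2 h) equation₁ equation₂ equation₃ equation₄ v-0
      ⊞ (- # 1) ⊡ j₂-inv))

  -- (1 + κ)(1 + σ κ) = 1 + 2c + N, which by `norm-equation` is 1 + v + 4c ≡ 1 + v, the reciprocal
  -- of j(q²).
  j≈ : j ≈ j₂ * (# 1 + σ κ)
  j≈ = cancelˡ {# 1 + v} 1+v-0 (combine
    (solve 6 (λ c v k l j j₂ → (:# 1 :+ v) :* j := (:# 1 :+ v) :* (j₂ :* (:# 1 :+ l)) :+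
      ((:# 1 :+ l) :* ((:# 1 :+ k) :* j :- :# 1) :+ (:- (:# 1 :+ l)) :* ((:# 1 :+ v) :* j₂ :- :# 1)
       :+ (:- j) :* (k :* l :- (v :+ :# 2 :* c)) :+ (:- j) :* (k :+ l :- :# 2 :* c)
         :+ (:- (c :* j)) :* (:# 4 :- :# 0))) refl c v κ (σ κ) j j₂)
    ((# 1 + σ κ) ⊡ j-inv ⊞ (- (# 1 + σ κ)) ⊡ j₂-inv
      ⊞ (- j) ⊡ norm-equation c v N half (dil 2 h) equation₁ equation₂ equation₃ equation₄ v-0 ⊞ (- j) ⊡ κ+σκ
        ⊞ (- (c * j)) ⊡ 0≈4))

  π-j : π 2 j ≈ j₂ * j₂
  π-j = trans (π-cong {2} j≈) (trans (π-* {2} (Supp-dil j) (# 1 + σ κ)) (*-cong refl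
    (trans (π-+ {2} (# 1) (σ κ))
      (trans (+-cong (π-id {2} (Supp-const (+ 1))) (trans π-σκ c≈))
      (solve 1 (λ j → :# 1 :+ (j :- :# 1) := j) refl j₂)))))

  π-multiple : ∀ f n → π 2 f (n ℕ.* 2) ≡ f (n ℕ.* 2)
  π-multiple f n = cong (λ c → if c ℕ.≡ᵇ 0 then f (n ℕ.* 2) else + 0) (m*n%n≡0 n 2)

  ω-odd : Supp 2 1 ω
  ω-odd = supp off-ω
    where
    off-ω : ∀ n → n % 2 ≢ 1 → ω n ∼ + 0
    off-ω n n≢1 = ∼-trans (∼-reflexive
      (≡-trans (coeff-+ j (- π 2 j) n) (cong (λ x → j n ℤ.+ x) (coeff-neg (π 2 j) n)))) (go (n % 2) ≡-refl)
      where
      go : ∀ m → n % 2 ≡ m → j n ℤ.+ ℤ.- π 2 j n ∼ + 0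
      go zero          h = ∼-reflexive
        (≡-trans (cong (λ c → j n ℤ.+ ℤ.- (if c ℕ.≡ᵇ 0 then j n else + 0)) h) (ℤₚ.+-inverseʳ (j n)))
      go (suc zero)    h = contradiction h n≢1
      go (suc (suc m)) h = contradiction (m%n<n n 2) (λ lt → ℕₚ.<⇒≱ (subst (ℕ._< 2) h lt) (ℕ.s≤s (ℕ.s≤s ℕ.z≤n)))

  πj·ω-Supp : Supp₂.Supp 4 1 (π 2 j * ω)
  πj·ω-Supp = Supp₂.Supp-* {d = 4}
    (Supp₂.Supp-cong (Ring.sym (+ 2) (weaken (divides (+ 2) ≡-refl) π-j)) dil-j²-Supp) ω-Supp

  -- Let J be the even part of j. Then j² = J² + ω² + 2Jω; the first two terms are even series, and
  -- for the last only parities matter: J ≡ j(q²)² is a series in q⁴ and ω lies in the class 1.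
  j²-off : ∀ n → n % 4 ≡ 3 → (j * j) n ∼ + 0
  j²-off n n≡3 = ∼-trans (at square n)
    (∼-trans (∼-reflexive (≡-trans (coeff-+ (π 2 j * π 2 j + ω * ω) cross n)
    (cong (ℤ._+ cross n) (coeff-+ (π 2 j * π 2 j) (ω * ω) n))))
    (∼-+ (∼-+ (off (Supp-* {d = 2} (Supp-π j) (Supp-π j)) n n-odd) (off (Supp-* {d = 2} ω-odd ω-odd) n n-odd))
      (∼-trans (∼-reflexive (coeff-const* (+ 2) (π 2 j * ω) n))
        (∣⇒∼0 (*-monoʳ-∣ (+ 2) (Supp₂.off-∣ πj·ω-Supp n (λ h → contradiction (≡-trans (≡-sym n≡3) h) λ ())))))))
    where
    cross : Series
    cross = # 2 * (π 2 j * ω)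
    n-odd : n % 2 ≢ 0
    n-odd h = contradiction (≡-trans (≡-sym (%4⇒%2 n n≡3)) h) λ ()
    square : j * j ≈ π 2 j * π 2 j + ω * ω + cross
    square = solve 2 (λ j J → j :* j := J :* J :+ (j :- J) :* (j :- J) :+ :# 2 :* (J :* (j :- J))) refl j
      (π 2 j)

  -- The index descends through X(k) = κ(4n) = j(q²) at 4n = j(2n) = j(q²)² at 2n = j² at n, using
  -- the even parts of κ and of j modulo 4.
  B-mod-4 : ∀ n k → n % 4 ≡ 3 → suc k ≡ n ℕ.* 2 ℕ.* 2 → X k ∼ + 0
  B-mod-4 n k n≡3 eq =
    ∼-trans (∼-reflexive (≡-sym (≡-trans (coeff-* q X (suc k)) (qpow-⊛-+ 1 X k))))
    (∼-trans (∼-reflexive (≡-trans (cong κ eq) (≡-sym (π-multiple κ (n ℕ.* 2)))))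
    (∼-trans (at c≈ (n ℕ.* 2 ℕ.* 2))
    (∼-trans (∼-reflexive (≡-trans (coeff-+ j₂ (- # 1) (n ℕ.* 2 ℕ.* 2))
      (cong₂ ℤ._+_ (dil-multiple 2 j (n ℕ.* 2))
      (≡-trans (coeff-neg (# 1) (n ℕ.* 2 ℕ.* 2)) (cong (λ m → ℤ.- const (+ 1) m) (≡-sym eq))))))
    (∼-trans (∼-reflexive (≡-trans (ℤₚ.+-identityʳ (j (n ℕ.* 2))) (≡-sym (π-multiple j n))))
    (∼-trans (at π-j (n ℕ.* 2))
    (∼-trans (at (sym (Dil.τ-* 2 j j)) (n ℕ.* 2))
    (∼-trans (∼-reflexive (dil-multiple 2 (j * j) n)) (j²-off n n≡3))))))))

  -- The index k + 2 = 4n + 1 is odd, so g contributes only twice the coefficient of h at 2n, which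
  -- is even by `h-even-at-6`.
  A-mod-4 : ∀ n k → n % 4 ≡ 3 → suc k ≡ n ℕ.* 2 ℕ.* 2 → inv X (suc (suc k)) ∼ + 0
  A-mod-4 n k n≡3 eq = ∼-trans (∼-reflexive (coeff-inv-X k)) (∼-+ g-off (B-mod-4 n k n≡3 eq))
    where
    last : Series
    last = # 2 * dil 2 h * q
    odd : suc (suc k) % 2 ≢ 0
    odd h = contradiction (≡-trans (≡-sym (≡-trans (cong (λ m → suc m % 2) eq) ([m+kn]%n≡m%n 1 (n ℕ.* 2) 2))) h)
      λ ()
    coeff-last : last (suc (suc k)) ≡ + 2 ℤ.* h (n ℕ.* 2)
    coeff-last = ≡-trans (exact-≡ (Z.*-comm (# 2 * dil 2 h) q) (suc (suc k)))
      (≡-trans (coeff-* q (# 2 * dil 2 h) (suc (suc k)))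
      (≡-trans (qpow-⊛-+ 1 (# 2 * dil 2 h) (suc k))
        (≡-trans (coeff-const* (+ 2) (dil 2 h) (suc k))
        (cong (+ 2 ℤ.*_) (≡-trans (cong (dil 2 h) eq) (dil-multiple 2 h (n ℕ.* 2)))))))
    g-off : g (suc (suc k)) ∼ + 0
    g-off = ∼-trans (at g-split (suc (suc k))) (∼-trans (∼-reflexive (coeff-+ gₑ last (suc (suc k))))
      (∼-+ (off gₑ-Supp (suc (suc k)) odd)
        (∼-trans (∼-reflexive coeff-last) (∣⇒∼0 (*-monoʳ-∣ (+ 2) (Mod.∼0⇒∣ (+ 2) (h-even-at-6 n n≡3)))))))

-- Transfer to A, B, C and D, and the arithmetic progressions.

module Coefficients where
  open SeriesRing using (*≡⊛; _^_) renaming (_*_ to _·_)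
  open import Data.Nat using (_+_; _*_)
  open import Data.Integer.Divisibility.Signed using (_∣_)
  open import Relation.Binary.PropositionalEquality using (refl; sym; trans)

  powS≡^ : ∀ f n → powS f n ≡ f ^ n
  powS≡^ f zero    = refl
  powS≡^ f (suc n) = trans (cong (f ⊛_) (powS≡^ f n)) (cong (λ op → op f (f ^ n)) (sym *≡⊛))

  R⁵≡X : R⁵ ≡ X
  R⁵≡X = trans (powS≡^ R 5) (cong (_^ 5) (sym ℛ≡R))

  dil5R≡r : dil5 R ≡ r
  dil5R≡r = cong (dil 5) (sym ℛ≡R)

  A≡ : A ≡ inv X
  A≡ = cong inv R⁵≡X

  C≡ : C ≡ X · i
  C≡ = trans (cong₂ _⊛_ R⁵≡X (cong inv dil5R≡r)) (cong (λ op → op X i) (sym *≡⊛))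

  D≡ : D ≡ r · inv X
  D≡ = trans (cong₂ _⊛_ dil5R≡r (cong inv R⁵≡X)) (cong (λ op → op r (inv X)) (sym *≡⊛))

  at : ∀ {m} {f g : Series} → f ≡ g → ∀ n → m ∣ g n → m Unsigned.∣ f n
  at refl n h = ∣⇒∣ᵤ h

  mod-5 : ∀ n r → (15 * n + r) % 5 ≡ r % 5
  mod-5 n r = trans (cong (_% 5) (index n r)) ([m+kn]%n≡m%n r (3 * n) 5)
    where
    index : ∀ n r → 15 * n + r ≡ r + 3 * n * 5
    index = solve-∀ℕ

  mod-3 : ∀ n r → (15 * n + r) % 3 ≡ r % 3
  mod-3 n r = trans (cong (_% 3) (index n r)) ([m+kn]%n≡m%n r (5 * n) 3)
    where
    index : ∀ n r → 15 * n + r ≡ r + 5 * n * 3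
    index = solve-∀ℕ

  avoid : ∀ n r {c} → r % 3 ≢ c → (15 * n + r) % 3 ≢ c
  avoid n r h h′ = h (trans (sym (mod-3 n r)) h′)

  3-mod-4 : ∀ n → (3 + n * 4) % 4 ≡ 3
  3-mod-4 n = [m+kn]%n≡m%n 3 n 4

  index₁₁ : ∀ n → suc (16 * n + 11) ≡ (3 + n * 4) * 2 * 2
  index₁₁ = solve-∀ℕ

  A-9n+4 : ∀ n → (+ 3) Unsigned.∣ A (9 * n + 4)
  A-9n+4 n = at A≡ (9 * n + 4) (subst (λ k → + 3 ∣ inv X k) (ℕₚ.+-comm 4 (9 * n)) (Modulo3.A-mod-3 n))

  B-9n+2 : ∀ n → (+ 3) Unsigned.∣ B (9 * n + 2)
  B-9n+2 n = at R⁵≡X (9 * n + 2) (subst (λ k → + 3 ∣ X k) (ℕₚ.+-comm 2 (9 * n)) (Modulo3.B-mod-3 n))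

  A-16n+13 : ∀ n → (+ 4) Unsigned.∣ A (16 * n + 13)
  A-16n+13 n = at A≡ (16 * n + 13)
    (subst (λ k → + 4 ∣ inv X k) (index n)
    (Mod.∼0⇒∣ (+ 4) (Modulo4.A-mod-4 (3 + n * 4) (16 * n + 11) (3-mod-4 n) (index₁₁ n))))
    where
    index : ∀ n → suc (suc (16 * n + 11)) ≡ 16 * n + 13
    index = solve-∀ℕ

  B-16n+11 : ∀ n → (+ 4) Unsigned.∣ B (16 * n + 11)
  B-16n+11 n = at R⁵≡X (16 * n + 11)
    (Mod.∼0⇒∣ (+ 4) (Modulo4.B-mod-4 (3 + n * 4) (16 * n + 11) (3-mod-4 n) (index₁₁ n)))

  A-15n+4 : ∀ n → (+ 15) Unsigned.∣ A (15 * n + 4)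
  A-15n+4 n = at A≡ (15 * n + 4) (A-class-4 (15 * n + 4) (mod-5 n 4) (avoid n 4 λ ()))

  A-15n+8 : ∀ n → (+ 15) Unsigned.∣ A (15 * n + 8)
  A-15n+8 n = at A≡ (15 * n + 8) (A-class-3 (15 * n + 8) (mod-5 n 8) (avoid n 8 λ ()))

  A-15n+13 : ∀ n → (+ 15) Unsigned.∣ A (15 * n + 13)
  A-15n+13 n = at A≡ (15 * n + 13) (A-class-3 (15 * n + 13) (mod-5 n 13) (avoid n 13 λ ()))

  A-15n+14 : ∀ n → (+ 15) Unsigned.∣ A (15 * n + 14)
  A-15n+14 n = at A≡ (15 * n + 14) (A-class-4 (15 * n + 14) (mod-5 n 14) (avoid n 14 λ ()))

  B-15n+2 : ∀ n → (+ 15) Unsigned.∣ B (15 * n + 2)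
  B-15n+2 n = at R⁵≡X (15 * n + 2) (B-class-2 (15 * n + 2) (mod-5 n 2) (avoid n 2 λ ()))

  B-15n+6 : ∀ n → (+ 15) Unsigned.∣ B (15 * n + 6)
  B-15n+6 n = at R⁵≡X (15 * n + 6) (B-class-1 (15 * n + 6) (mod-5 n 6) (avoid n 6 λ ()))

  B-15n+11 : ∀ n → (+ 15) Unsigned.∣ B (15 * n + 11)
  B-15n+11 n = at R⁵≡X (15 * n + 11) (B-class-1 (15 * n + 11) (mod-5 n 11) (avoid n 11 λ ()))

  B-15n+12 : ∀ n → (+ 15) Unsigned.∣ B (15 * n + 12)
  B-15n+12 n = at R⁵≡X (15 * n + 12) (B-class-2 (15 * n + 12) (mod-5 n 12) (avoid n 12 λ ()))

  C-15n+3 : ∀ n → (+ 30) Unsigned.∣ C (15 * n + 3)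
  C-15n+3 n = at C≡ (15 * n + 3) (C-class-3 (15 * n + 3) (mod-5 n 3) (avoid n 3 λ ()))

  C-15n+13 : ∀ n → (+ 30) Unsigned.∣ C (15 * n + 13)
  C-15n+13 n = at C≡ (15 * n + 13) (C-class-3 (15 * n + 13) (mod-5 n 13) (avoid n 13 λ ()))

  D-15n+7 : ∀ n → (+ 30) Unsigned.∣ D (15 * n + 7)
  D-15n+7 n = at D≡ (15 * n + 7) (D-class-2 (15 * n + 7) (mod-5 n 7) (avoid n 7 λ ()))

  D-15n+12 : ∀ n → (+ 30) Unsigned.∣ D (15 * n + 12)
  D-15n+12 n = at D≡ (15 * n + 12) (D-class-2 (15 * n + 12) (mod-5 n 12) (avoid n 12 λ ()))

open Coefficients
open import Data.Nat using (_+_; _*_)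
open import Data.Integer.Divisibility using (_∣_)

theorem1p6 : (n : ℕ) →
    ((+ 3) ∣ A (9 * n + 4)) × ((+ 3) ∣ B (9 * n + 2)) ×
    ((+ 4) ∣ A (16 * n + 13)) × ((+ 4) ∣ B (16 * n + 11)) ×
    ((+ 15) ∣ A (15 * n + 4)) × ((+ 15) ∣ A (15 * n + 8)) ×
    ((+ 15) ∣ A (15 * n + 13)) × ((+ 15) ∣ A (15 * n + 14)) ×
    ((+ 15) ∣ B (15 * n + 2)) × ((+ 15) ∣ B (15 * n + 6)) ×
    ((+ 15) ∣ B (15 * n + 11)) × ((+ 15) ∣ B (15 * n + 12)) ×
    ((+ 30) ∣ C (15 * n + 3)) × ((+ 30) ∣ C (15 * n + 13)) ×
    ((+ 30) ∣ D (15 * n + 7)) × ((+ 30) ∣ D (15 * n + 12))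
theorem1p6 n =
    A-9n+4 n , B-9n+2 n , A-16n+13 n , B-16n+11 n
  , A-15n+4 n , A-15n+8 n , A-15n+13 n , A-15n+14 n
  , B-15n+2 n , B-15n+6 n , B-15n+11 n , B-15n+12 n
  , C-15n+3 n , C-15n+13 n , D-15n+7 n , D-15n+12 n
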